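{- Let $a,b\in\mathbb Z$ be such that $F(x)=x^7+ax+b$ is irreducible over $\mathbb Q$, and assume that for every prime integer $p$ one has $\nu_p(a)\le 5$ or $\nu_p(b)\le 6$. Let $\alpha$ be a root of $F(x)$, $K=\mathbb Q(\alpha)$ and $\mathbb Z_K$ its ring of integers. Then $\mathbb Z[\alpha]=\mathbb Z_K$ (i.e. $\mathbb Z[\alpha]$ is integrally closed) if and only if all of the following conditions hold: (1) For every prime integer $p$, if $p$ divides both $a$ and $b$, then $\nu_p(b)=1$. (2) If $2$ divides $b$ and $2$ does not divide $a$, then either ($a\equiv 3 \pmod 4$ and $b\equiv 2\pmod 4$) or ($a\equiv 1\pmod 4$ and $b\equiv 0\pmod 4$). (3) If $3$ divides $b$ and $a\equiv -1\pmod 3$, then $\nu_3(b+1+a)=\nu_3(b-1-a)=1$. (4) If $3$ divides $b$ and $a\equiv 1\pmod 3$, then $a\equiv 4\pmod 9$ or $a\equiv 7\pmod 9$ or $\nu_3(b)=1$. (5) If $7$ divides $a$ and $7$ does not divide $b$, then $\nu_7(1-a-b^6)=1$. (6) For every prime integer $p\notin\{2,3,7\}$, if $p$ does not divide both $a$ and $b$, then $\nu_p(7^7b^6+6^6a^7)\le 1$.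
   Context: For a prime $p$, $\nu_p$ denotes the $p$-adic valuation. -}

module Defs where

open import Data.Nat as ℕ using (ℕ; zero; suc; _<_)
open import Data.Nat.Primality using (Prime)
open import Data.Integer as ℤ using (ℤ; +_; -[1+_])
open import Data.Integer.Divisibility using (_∣_)
open import Data.Rational as ℚ using (ℚ; 0ℚ; 1ℚ)
open import Data.List using (List; []; _∷_; _++_; map)
open import Data.Product using (Σ; _×_; ∃; ∃-syntax; _,_)
open import Data.Sum using (_⊎_)
open import Relation.Nullary using (¬_)
open import Relation.Binary.PropositionalEquality using (_≡_; _≢_)

-- p-adic valuation predicates (ν_p(0) = ∞, so ν_p(0) ≤ k is false
-- and ν_p(0) = k is false, as with the usual convention)

νLe : ℕ → ℕ → ℤ → Set
νLe p k x = ¬ ((+ (p ℕ.^ suc k)) ∣ x)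

νEq : ℕ → ℕ → ℤ → Set
νEq p k x = ((+ (p ℕ.^ k)) ∣ x) × ¬ ((+ (p ℕ.^ suc k)) ∣ x)

ModEq : ℕ → ℤ → ℤ → Set
ModEq n x y = (+ n) ∣ (x ℤ.- y)

-- Polynomials over ℚ, as coefficient lists (lowest degree first)

Poly : Set
Poly = List ℚ

coeff : Poly → ℕ → ℚ
coeff []       _       = 0ℚ
coeff (c ∷ cs) zero    = c
coeff (c ∷ cs) (suc k) = coeff cs k

-- equality of polynomials (coefficientwise, trailing zeros ignored)
_≈P_ : Poly → Poly → Set
p ≈P q = ∀ k → coeff p k ≡ coeff q k

_+P_ : Poly → Poly → Poly
[]       +P q        = q
(c ∷ cs) +P []       = c ∷ cs
(c ∷ cs) +P (d ∷ ds) = (c ℚ.+ d) ∷ (cs +P ds)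

scaleP : ℚ → Poly → Poly
scaleP c = map (c ℚ.*_)

negP : Poly → Poly
negP = map (λ c → ℚ.- c)

_-P_ : Poly → Poly → Poly
p -P q = p +P negP q

_*P_ : Poly → Poly → Poly
[]       *P q = []
(c ∷ cs) *P q = scaleP c q +P (0ℚ ∷ (cs *P q))

composeP : Poly → Poly → Poly
composeP []       p = []
composeP (c ∷ cs) p = (c ∷ []) +P (p *P composeP cs p)

HasDegree : Poly → ℕ → Set
HasDegree p d = (coeff p d ≢ 0ℚ) × (∀ k → d < k → coeff p k ≡ 0ℚ)

_∣P_ : Poly → Poly → Set
f ∣P g = ∃[ h ] (g ≈P (f *P h))

-- irreducibility in ℚ[x]: not zero, not a unit (units = nonzero constants),
-- and in every factorisation one factor is a unit
Irreducible : Poly → Set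
Irreducible f =
  (∃[ d ] (HasDegree f d × 0 < d)) ×
  (∀ g h → f ≈P (g *P h) → HasDegree g 0 ⊎ HasDegree h 0)

ℤtoℚ : ℤ → ℚ
ℤtoℚ z = z ℚ./ 1

PolyZ : Set
PolyZ = List ℤ

toℚ[x] : PolyZ → Poly
toℚ[x] = map ℤtoℚ

MonicZ : PolyZ → Set
MonicZ g = ∃[ cs ] (g ≡ cs ++ (+ 1 ∷ []))

-- The number field K = ℚ(α) ≅ ℚ[x]/(F) for F irreducible, α = class of x.
-- An element of K is represented by a polynomial p (standing for p(α)).

IsAlgInt : Poly → Poly → Set
IsAlgInt F p = ∃[ g ] (MonicZ g × (F ∣P composeP (toℚ[x] g) p))

InZα : Poly → Poly → Set
InZα F p = ∃[ q ] (F ∣P (p -P toℚ[x] q))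

ZαIsRingOfIntegers : Poly → Set
ZαIsRingOfIntegers F =
  (∀ p → IsAlgInt F p → InZα F p) × (∀ p → InZα F p → IsAlgInt F p)

trinomial7 : ℤ → ℤ → Poly
trinomial7 a b = ℤtoℚ b ∷ ℤtoℚ a ∷ 0ℚ ∷ 0ℚ ∷ 0ℚ ∷ 0ℚ ∷ 0ℚ ∷ 1ℚ ∷ []

ℤ2 ℤ3 ℤ7 : ℤ
ℤ2 = + 2
ℤ3 = + 3
ℤ7 = + 7

Cond1 Cond2 Cond3 Cond4 Cond5 Cond6 : ℤ → ℤ → Set
Cond1 a b = ∀ p → Prime p → (+ p) ∣ a → (+ p) ∣ b → νEq p 1 b
Cond2 a b = ℤ2 ∣ b → ¬ (ℤ2 ∣ a) →
  (ModEq 4 a (+ 3) × ModEq 4 b (+ 2)) ⊎ (ModEq 4 a (+ 1) × ModEq 4 b (+ 0))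
Cond3 a b = ℤ3 ∣ b → ModEq 3 a (ℤ.- (+ 1)) →
  νEq 3 1 (b ℤ.+ + 1 ℤ.+ a) × νEq 3 1 (b ℤ.- + 1 ℤ.- a)
Cond4 a b = ℤ3 ∣ b → ModEq 3 a (+ 1) →
  ModEq 9 a (+ 4) ⊎ ModEq 9 a (+ 7) ⊎ νEq 3 1 b
Cond5 a b = ℤ7 ∣ a → ¬ (ℤ7 ∣ b) → νEq 7 1 (+ 1 ℤ.- a ℤ.- b ℤ.^ 6)
Cond6 a b = ∀ p → Prime p → p ≢ 2 → p ≢ 3 → p ≢ 7 →
  ¬ ((+ p) ∣ a × (+ p) ∣ b) →
  νLe p 1 ((+ 7) ℤ.^ 7 ℤ.* b ℤ.^ 6 ℤ.+ (+ 6) ℤ.^ 6 ℤ.* a ℤ.^ 7)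

{-# OPTIONS --safe #-}

-- Call a prime p good if F = gᵉ⁺¹ h + p T in ℤ[X], where g and gh are monic, gh is separable modulo p
-- and T is a unit modulo (p, g).
--
-- If every prime is good, a rational polynomial integral modulo F can be freed of its denominator one
-- prime p at a time.  Let q / p be integral, killed by a monic polynomial of degree n.  Whenever
-- y ≡ z (q / p) modulo F, clearing denominators gives yⁿ ∈ z ℤ[X] + F ℤ[X].  With z = p this puts qⁿ,
-- hence q, in (p, gh); if q = gⁱ⁺¹ h r + p s with i < e, then z = gᵉ⁻ⁱ and y = s z − T r give y ∈ (p, g),
-- so r ∈ (p, g) and q ∈ (p, gⁱ⁺² h).  In the end q ∈ (p, F).  Both steps use that ℤ[X]/(p, G) is reduced
-- for G separable modulo p: if G ∣ fᵖ modulo p, differentiating repeatedly gives Gᵖ ∣ fᵖ, which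
-- forces f ≡ 0 when deg f < deg G.
--
-- Conversely, if F = g² h + p g s + p² t with g and h monic, then ω = (gh + p s) / p satisfies
-- ω² = s ω − h t modulo F, but it does not lie in ℤ[α].  It is integral because ℤ[α, ω] is a finitely
-- generated ℤ-module: a fraction-free elimination replaces the usual determinant.
--
-- For X⁷ + aX + b all primes with p ∤ 7⁷b⁶ + 6⁶a⁷ are good (g = 1).  At the others g is X, X³ + 1,
-- X² ± 1, X + b or X + 7b/6a, and conditions (1)–(6) say that T is a unit modulo (p, g).
module Submission where

open import Defs
open import Data.Nat as ℕ using (ℕ; zero; suc)
open import Data.Nat.Primality using (Prime; euclidsLemma; prime?; prime⇒nonTrivial; prime⇒nonZero; prime⇒irreducible)
open import Data.Integer as ℤ using (ℤ; +_; -[1+_])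
open import Data.Product using (Σ; _×_; ∃; ∃-syntax; _,_; proj₁; proj₂)
open import Data.Sum using (_⊎_; inj₁; inj₂)
open import Function.Bundles using (_⇔_; mk⇔)
open import Algebra.Bundles using (CommutativeRing; RawRing)
import Algebra.Morphism.RingMonomorphism as RingMonomorphism
open import Algebra.Solver.Ring.AlmostCommutativeRing using (fromCommutativeRing; _-Raw-AlmostCommutative⟶_)
open import Data.Empty using (⊥; ⊥-elim)
open import Data.Fin using (Fin; zero; suc; fromℕ; fromℕ<; toℕ)
import Data.Fin.Properties as Finₚ
open import Data.Integer.Divisibility.Signed as ℤᵈ using (_∣_; divides; ∣ᵤ⇒∣; ∣⇒∣ᵤ; _∣?_; ∣m∣n⇒∣m+n; ∣m+n∣m⇒∣n; ∣m⇒∣m*n; ∣n⇒∣m*n)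
open import Data.Integer.DivMod using (_/ℕ_; a≡a%ℕn+[a/ℕn]*n; n%ℕd<d)
import Data.Integer.Properties as ℤₚ
open import Data.Integer.Solver using (module +-*-Solver)
open import Data.List using (List; []; _∷_; _++_; length)
open import Data.List.Relation.Unary.All using (All; []; _∷_)
open import Data.Maybe using (Maybe; just; nothing)
open import Data.Nat.Coprimality using (Coprime; coprime-Bézout)
import Data.Nat.Divisibility as ℕᵈ
open import Data.Nat.GCD using (module Bézout)
open import Data.Nat.ListAction using (product)
open import Data.Nat.Primality.Factorisation using (PrimeFactorisation; factorise)
import Data.Nat.Properties as ℕₚ
open import Data.Rational as ℚ using (ℚ; 0ℚ; 1ℚ; mkℚ; ↥_; ↧_)
import Data.Rational.Properties as ℚₚ
import Data.Rational.Unnormalised as ℚᵘ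
import Data.Rational.Unnormalised.Properties as ℚᵘₚ
open import Data.Vec as Vec using (Vec; []; _∷_)
import Data.Vec.Relation.Unary.All as VAll
import Data.Vec.Relation.Unary.All.Properties as VAllₚ
open import Level using (0ℓ)
open import Relation.Binary.PropositionalEquality as ≡ using (_≡_; _≢_)
open import Relation.Nullary using (¬_; Dec; yes; no)
open import Relation.Nullary.Decidable using (from-yes; from-no)

-- Elements integral over ℤ

-- No field 𝔽ₚ is built and nothing is factored into irreducibles: every g is explicit, and "modulo
-- p" always means an explicit multiple of p in ℤ[X]. Where the g come from. Euler's relation X F′ -
-- 7F = -(6aX + 7b) leaves -7b/6a as the only candidate for a multiple root modulo a prime p ∤ 6a,
-- and Δ = 7⁷b⁶ + 6⁶a⁷ decides whether it is one. At the other primes dividing Δ a high power shows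
-- up: F ≡ X⁷ when p divides a and b, F ≡ X⁷ + b ≡ (X + b)⁷ at 7, F ≡ X (X² ± 1)³ at 3 and F ≡ X (X³
-- + 1)² at 2. The two directions use different g. To refute integral closedness an integer c with p
-- ∣ F′(c) and p² ∣ F(c) suffices, and c = 0, 1, ±1, -b and an approximation of -7b/6a yield (1),
-- (2), (3), (5) and (6). Only (4) calls for a quadratic g, because X² + 1 has no root modulo 3.
-- Integrality reaches the prime-by-prime argument only as a statement about powers in ℤ[X], so that
-- argument never mentions ℚ. All rings involved (ℚ, ℚ[X], ℤ[X] and K) are treated as commutative
-- rings with a map from ℤ, which lets one solver with integer coefficients serve them all.

record ℤ-Algebra : Set₁ where
  field
    ring : CommutativeRing 0ℓ 0ℓ
    unit : CommutativeRing.rawRing ℤₚ.+-*-commutativeRing -Raw-AlmostCommutative⟶ fromCommutativeRing ring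

module Algebraic (A : ℤ-Algebra) where
  open CommutativeRing (ℤ-Algebra.ring A) public hiding (zero)
  open _-Raw-AlmostCommutative⟶_ (ℤ-Algebra.unit A) public
    renaming (⟦_⟧ to ι; +-homo to ι-+; *-homo to ι-*; -‿homo to ι-neg; 0-homo to ι-0; 1-homo to ι-1)
  open import Algebra.Properties.Semiring.Exp semiring public
  open import Algebra.Properties.Semiring.Sum semiring public
  open import Relation.Binary.Reasoning.Setoid setoid public

  ι-≟ : ∀ m n → Maybe (ι m ≈ ι n)
  ι-≟ m n with m ℤ.≟ n
  ... | yes ≡.refl = just refl
  ... | no _ = nothing

  open import Algebra.Solver.Ring
    (CommutativeRing.rawRing ℤₚ.+-*-commutativeRing)
    (fromCommutativeRing (ℤ-Algebra.ring A)) (ℤ-Algebra.unit A) ι-≟ public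
    using (solve; con; _:+_; _:*_; _:-_; :-_; _:^_; _:=_)

  ι-cong : ∀ {m n} → m ≡ n → ι m ≈ ι n
  ι-cong ≡.refl = refl

  -- y = c₀ + c₁ θ + ⋯ + cₖ₋₁ θᵏ⁻¹ + ε θᵏ with integer coefficients.
  data Pol (θ : Carrier) : ℕ → ℤ → Carrier → Set where
    const : ∀ {ε y} → y ≈ ι ε → Pol θ 0 ε y
    step  : ∀ {k ε y z} c → Pol θ k ε z → y ≈ ι c + θ * z → Pol θ (suc k) ε y

  module _ {θ : Carrier} where

    pol-resp : ∀ {k ε y z} → y ≈ z → Pol θ k ε y → Pol θ k ε z
    pol-resp y≈z (const e)    = const (trans (sym y≈z) e)
    pol-resp y≈z (step c p e) = step c p (trans (sym y≈z) e)

    pol-lead : ∀ {k ε δ y} → ε ≡ δ → Pol θ k ε y → Pol θ k δ y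
    pol-lead ≡.refl p = p

    pol-+ : ∀ {k ε δ y z} → Pol θ k ε y → Pol θ k δ z → Pol θ k (ε ℤ.+ δ) (y + z)
    pol-+ (const e) (const f) = const (trans (+-cong e f) (sym (ι-+ _ _)))
    pol-+ (step {z = y} c p e) (step {z = z} d q f) = step (c ℤ.+ d) (pol-+ p q) (begin
      _ + _                                ≈⟨ +-cong e f ⟩
      (ι c + θ * y) + (ι d + θ * z)        ≈⟨ solve 5 (λ c d t y z → (c :+ t :* y) :+ (d :+ t :* z) := (c :+ d) :+ t :* (y :+ z)) refl (ι c) (ι d) θ y z ⟩
      (ι c + ι d) + θ * (y + z)            ≈⟨ +-congʳ (ι-+ c d) ⟨
      ι (c ℤ.+ d) + θ * (y + z)            ∎)

    pol-scale : ∀ {k ε y} a → Pol θ k ε y → Pol θ k (a ℤ.* ε) (ι a * y)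
    pol-scale a (const e) = const (trans (*-congˡ e) (sym (ι-* _ _)))
    pol-scale a (step {z = y} c p e) = step (a ℤ.* c) (pol-scale a p) (begin
      ι a * _                          ≈⟨ *-congˡ e ⟩
      ι a * (ι c + θ * y)              ≈⟨ solve 4 (λ a c t y → a :* (c :+ t :* y) := a :* c :+ t :* (a :* y)) refl (ι a) (ι c) θ y ⟩
      ι a * ι c + θ * (ι a * y)        ≈⟨ +-congʳ (ι-* a c) ⟨
      ι (a ℤ.* c) + θ * (ι a * y)      ∎)

    pol-neg : ∀ {k ε y} → Pol θ k ε y → Pol θ k (ℤ.- ε) (- y)
    pol-neg (const e) = const (trans (-‿cong e) (sym (ι-neg _)))
    pol-neg (step {z = y} c p e) = step (ℤ.- c) (pol-neg p) (begin
      - _                    ≈⟨ -‿cong e ⟩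
      - (ι c + θ * y)        ≈⟨ solve 3 (λ c t y → :- (c :+ t :* y) := :- c :+ t :* (:- y)) refl (ι c) θ y ⟩
      - ι c + θ * (- y)      ≈⟨ +-congʳ (ι-neg c) ⟨
      ι (ℤ.- c) + θ * (- y)  ∎)

    pol-raise : ∀ {k ε y} → Pol θ k ε y → Pol θ (suc k) (+ 0) y
    pol-raise {ε = ε} (const e) = step ε (const refl) (trans e
      (solve 2 (λ e t → e := e :+ t :* con (+ 0)) refl (ι ε) θ))
    pol-raise (step c p e) = step c (pol-raise p) e

    pol-pad : ∀ {k n y} → k ℕ.≤′ n → Pol θ k (+ 0) y → Pol θ n (+ 0) y
    pol-pad (ℕ.≤′-reflexive ≡.refl) p = p
    pol-pad (ℕ.≤′-step k≤n) p = pol-raise (pol-pad k≤n p)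

    pol-shift : ∀ {k ε y} → Pol θ k ε y → Pol θ (suc k) ε (θ * y)
    pol-shift {y = y} p = step (+ 0) p (solve 2 (λ t y → t :* y := con (+ 0) :+ t :* y) refl θ y)

    pol-* : ∀ {j k ε δ y z} → Pol θ j ε y → Pol θ k δ z → Pol θ (j ℕ.+ k) (ε ℤ.* δ) (y * z)
    pol-* {ε = ε} (const e) q = pol-resp (*-congʳ (sym e)) (pol-scale ε q)
    pol-* {suc j} {k} {ε} {δ} {z = z} (step {z = y} c p e) q =
      pol-resp
        (begin
          ι c * z + θ * (y * z)  ≈⟨ solve 4 (λ c t y z → c :* z :+ t :* (y :* z) := (c :+ t :* y) :* z) refl (ι c) θ y z ⟩
          (ι c + θ * y) * z      ≈⟨ *-congʳ e ⟨
          _ * z                  ∎)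
        (pol-lead (ℤₚ.+-identityˡ (ε ℤ.* δ))
          -- As a polynomial of formal degree 1 + j + k, the term c z has top coefficient 0, so the
          -- lead comes from the shifted product alone.
          (pol-+ (pol-pad (ℕₚ.≤⇒≤′ (ℕ.s≤s (ℕₚ.m≤n+m k j))) (pol-raise (pol-scale c q)))
                 (pol-shift (pol-* p q))))

    pol-ι : ∀ c → Pol θ 0 c (ι c)
    pol-ι c = const refl

    pol-1 : Pol θ 0 (+ 1) 1#
    pol-1 = const (sym ι-1)

    pol-var : Pol θ 1 (+ 1) θ
    pol-var = pol-resp (*-identityʳ θ) (pol-shift pol-1)

    pol-^ : ∀ {k ε y} n → Pol θ k ε y → Pol θ (n ℕ.* k) (ε ℤ.^ n) (y ^ n)
    pol-^ zero    p = pol-1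
    pol-^ (suc n) p = pol-* p (pol-^ n p)

    -- Exposes the coefficient just below a vanishing top one; division by a monic polynomial
    -- recurses on it.
    pol-lower : ∀ {k y} → Pol θ (suc k) (+ 0) y → ∃[ ε ] Pol θ k ε y
    pol-lower (step c (const f) e) = c , const (begin
      _                      ≈⟨ e ⟩
      ι c + θ * _            ≈⟨ +-congˡ (*-congˡ f) ⟩
      ι c + θ * ι (+ 0)      ≈⟨ solve 2 (λ c t → c :+ t :* con (+ 0) := c) refl (ι c) θ ⟩
      ι c                    ∎)
    pol-lower (step c p@(step _ _ _) e) = let ε , q = pol-lower p in ε , step c q e

    pol-split : ∀ {k ε y} → Pol θ k ε y → Pol θ k (+ 0) (y - ι ε * θ ^ k)
    pol-split {ε = ε} (const {y = y} e) = const (begin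
      y - ι ε * 1#    ≈⟨ +-congʳ e ⟩
      ι ε - ι ε * 1#  ≈⟨ +-congˡ (-‿cong (*-identityʳ (ι ε))) ⟩
      ι ε - ι ε       ≈⟨ solve 1 (λ e → e :- e := con (+ 0)) refl (ι ε) ⟩
      ι (+ 0)         ∎)
    pol-split {suc k} {ε} (step {z = z} c p e) = step c (pol-split p) (begin
      _ - ι ε * (θ * θ ^ k)                ≈⟨ +-congʳ e ⟩
      (ι c + θ * z) - ι ε * (θ * θ ^ k)    ≈⟨ solve 5 (λ c t z e u → (c :+ t :* z) :- e :* (t :* u) := c :+ t :* (z :- e :* u)) refl (ι c) θ z (ι ε) (θ ^ k) ⟩
      ι c + θ * (z - ι ε * θ ^ k)          ∎)

  eval : List ℤ → Carrier → Carrier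
  eval []       θ = 0#
  eval (c ∷ cs) θ = ι c + θ * eval cs θ

  pol⇒eval : ∀ {k θ y} → Pol θ k (+ 1) y → ∃[ cs ] (y ≈ eval (cs ++ + 1 ∷ []) θ)
  pol⇒eval {θ = θ} (const e) = [] , trans e (trans (sym (+-identityʳ _)) (+-congˡ (sym (zeroʳ θ))))
  pol⇒eval (step c p e) = let cs , f = pol⇒eval p in c ∷ cs , trans e (+-congˡ (*-congˡ f))

  pol₀⇒eval : ∀ {k θ y} → Pol θ k (+ 0) y → ∃[ cs ] (y ≈ eval cs θ)
  pol₀⇒eval (const e) = [] , trans e ι-0
  pol₀⇒eval (step c p e) = let cs , f = pol₀⇒eval p in c ∷ cs , trans e (+-congˡ (*-congˡ f))

  δ : ∀ {n} → Fin n → Fin n → ℤ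
  δ zero    zero    = + 1
  δ zero    (suc j) = + 0
  δ (suc i) zero    = + 0
  δ (suc i) (suc j) = δ i j

  -- Fraction-free elimination: replacing the rows by N₀₀ Nᵢ − Nᵢ₀ N₀ keeps the diagonal
  -- monic of some common degree and the other entries of smaller degree.
  eliminate : ∀ {θ} n {k} (N : Fin (suc n) → Fin (suc n) → Carrier) (e : Fin (suc n) → Carrier) →
    (∀ i j → Pol θ k (δ i j) (N i j)) → (∀ i → sum (λ j → N i j * e j) ≈ 0#) →
    ∃[ m ] ∃[ d ] (Pol θ m (+ 1) d × d * e (fromℕ n) ≈ 0#)
  eliminate zero {k} N e pol rel =
    k , N zero zero , pol zero zero , trans (sym (+-identityʳ _)) (rel zero)
  eliminate {θ} (suc n) {k} N e pol rel = eliminate n N′ (λ j → e (suc j)) pol′ rel′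
    where
    N′ : Fin (suc n) → Fin (suc n) → Carrier
    N′ i j = N zero zero * N (suc i) (suc j) - N (suc i) zero * N zero (suc j)
    pol′ : ∀ i j → Pol θ (k ℕ.+ k) (δ i j) (N′ i j)
    pol′ i j = pol-lead
      (≡.trans (≡.cong (ℤ._+ + 0) (ℤₚ.*-identityˡ (δ i j))) (ℤₚ.+-identityʳ (δ i j)))
      (pol-+ (pol-* (pol zero zero) (pol (suc i) (suc j)))
             (pol-neg (pol-* (pol (suc i) zero) (pol zero (suc j)))))
    tail-sum : Fin (suc (suc n)) → Carrier
    tail-sum i = sum (λ j → N i (suc j) * e (suc j))
    rel′ : ∀ i → sum (λ j → N′ i j * e (suc j)) ≈ 0#
    rel′ i = begin
      sum (λ j → N′ i j * e (suc j))
        ≈⟨ sum-cong-≋ (λ j → solve 5 (λ a b c d e → (a :* b :- c :* d) :* e := a :* (b :* e) :+ (:- c) :* (d :* e)) refl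
             (N zero zero) (N (suc i) (suc j)) (N (suc i) zero) (N zero (suc j)) (e (suc j))) ⟩
      sum (λ j → N zero zero * (N (suc i) (suc j) * e (suc j)) + - N (suc i) zero * (N zero (suc j) * e (suc j)))
        ≈⟨ ∑-distrib-+ (λ j → N zero zero * (N (suc i) (suc j) * e (suc j))) (λ j → - N (suc i) zero * (N zero (suc j) * e (suc j))) ⟩
      sum (λ j → N zero zero * (N (suc i) (suc j) * e (suc j))) + sum (λ j → - N (suc i) zero * (N zero (suc j) * e (suc j)))
        ≈⟨ +-cong (*-distribˡ-sum (N zero zero) (λ j → N (suc i) (suc j) * e (suc j)))
                  (*-distribˡ-sum (- N (suc i) zero) (λ j → N zero (suc j) * e (suc j))) ⟨
      N zero zero * tail-sum (suc i) + - N (suc i) zero * tail-sum zero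
        -- The two terms in `e zero` cancel, so they can be added back to complete both row
        -- relations.
        ≈⟨ solve 5 (λ a c e s t → a :* s :+ (:- c) :* t := a :* (c :* e :+ s) :- c :* (a :* e :+ t)) refl
             (N zero zero) (N (suc i) zero) (e zero) (tail-sum (suc i)) (tail-sum zero) ⟩
      N zero zero * (N (suc i) zero * e zero + tail-sum (suc i)) - N (suc i) zero * (N zero zero * e zero + tail-sum zero)
        ≈⟨ +-cong (*-congˡ (rel (suc i))) (-‿cong (*-congˡ (rel zero))) ⟩
      N zero zero * 0# - N (suc i) zero * 0#
        ≈⟨ +-cong (zeroʳ _) (-‿cong (zeroʳ _)) ⟩
      0# - 0#
        ≈⟨ -‿inverseʳ 0# ⟩
      0# ∎

  module _ {n : ℕ} (e : Fin n → Carrier) where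

    Span : Carrier → Set
    Span y = Σ (Fin n → ℤ) λ c → (y ≈ sum (λ j → ι (c j) * e j))

    span-resp : ∀ {y z} → y ≈ z → Span y → Span z
    span-resp y≈z (c , eq) = c , trans (sym y≈z) eq

    span-+ : ∀ {y z} → Span y → Span z → Span (y + z)
    span-+ {y} {z} (c , p) (d , q) = (λ j → c j ℤ.+ d j) , (begin
      y + z                                                          ≈⟨ +-cong p q ⟩
      sum (λ j → ι (c j) * e j) + sum (λ j → ι (d j) * e j)          ≈⟨ ∑-distrib-+ (λ j → ι (c j) * e j) (λ j → ι (d j) * e j) ⟨
      sum (λ j → ι (c j) * e j + ι (d j) * e j)                      ≈⟨ sum-cong-≋ (λ j → trans (sym (distribʳ (e j) _ _)) (*-congʳ (sym (ι-+ (c j) (d j))))) ⟩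
      sum (λ j → ι (c j ℤ.+ d j) * e j)                              ∎)

    span-scale : ∀ {y} a → Span y → Span (ι a * y)
    span-scale {y} a (c , p) = (λ j → a ℤ.* c j) , (begin
      ι a * y                              ≈⟨ *-congˡ p ⟩
      ι a * sum (λ j → ι (c j) * e j)      ≈⟨ *-distribˡ-sum (ι a) (λ j → ι (c j) * e j) ⟩
      sum (λ j → ι a * (ι (c j) * e j))    ≈⟨ sum-cong-≋ (λ j → trans (sym (*-assoc _ _ (e j))) (*-congʳ (sym (ι-* a (c j))))) ⟩
      sum (λ j → ι (a ℤ.* c j) * e j)      ∎)

  sum-0 : ∀ n (e : Fin n → Carrier) → sum (λ j → ι (+ 0) * e j) ≈ 0#
  sum-0 n e = trans (sym (*-distribˡ-sum (ι (+ 0)) e)) (trans (*-congʳ ι-0) (zeroˡ _))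

  sum-δ : ∀ {n} (e : Fin n → Carrier) i → sum (λ j → ι (δ i j) * e j) ≈ e i
  sum-δ {suc n} e zero = begin
    ι (+ 1) * e zero + sum (λ j → ι (+ 0) * e (suc j))  ≈⟨ +-cong (trans (*-congʳ ι-1) (*-identityˡ _)) (sum-0 n (λ j → e (suc j))) ⟩
    e zero + 0#                                         ≈⟨ +-identityʳ _ ⟩
    e zero                                              ∎
  sum-δ {suc n} e (suc i) = begin
    ι (+ 0) * e zero + sum (λ j → ι (δ i j) * e (suc j))  ≈⟨ +-cong (trans (*-congʳ ι-0) (zeroˡ _)) (sum-δ (λ j → e (suc j)) i) ⟩
    0# + e (suc i)                                        ≈⟨ +-identityˡ _ ⟩
    e (suc i)                                             ∎

  span-gen : ∀ {n} (e : Fin n → Carrier) i → Span e (e i)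
  span-gen e i = δ i , sym (sum-δ e i)

  span-0 : ∀ {n} (e : Fin n → Carrier) → Span e 0#
  span-0 e = (λ _ → + 0) , sym (sum-0 _ e)

  snoc : ∀ {a} {B : Set a} {n} → (Fin n → B) → B → Fin (suc n) → B
  snoc {n = zero}  e b zero    = b
  snoc {n = suc n} e b zero    = e zero
  snoc {n = suc n} e b (suc i) = snoc (λ j → e (suc j)) b i

  snoc-last : ∀ {n} (e : Fin n → Carrier) b → snoc e b (fromℕ n) ≈ b
  snoc-last {zero}  e b = refl
  snoc-last {suc n} e b = snoc-last (λ j → e (suc j)) b

  snoc-all : ∀ {n} (Q : Carrier → Set) {e : Fin n → Carrier} {b} → (∀ i → Q (e i)) → Q b → ∀ i → Q (snoc e b i)
  snoc-all {zero}  Q h q zero    = q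
  snoc-all {suc n} Q h q zero    = h zero
  snoc-all {suc n} Q h q (suc i) = snoc-all Q (λ j → h (suc j)) q i

  span-snoc : ∀ {n} {e : Fin n → Carrier} {y} b → Span e y → Span (snoc e b) y
  span-snoc {e = e} b (c , eq) = snoc c (+ 0) , trans eq (sym (sum-snoc e c))
    where
    sum-snoc : ∀ {n} (e : Fin n → Carrier) (c : Fin n → ℤ) →
      sum (λ j → ι (snoc c (+ 0) j) * snoc e b j) ≈ sum (λ j → ι (c j) * e j)
    sum-snoc {zero}  e c = trans (+-identityʳ _) (trans (*-congʳ ι-0) (zeroˡ b))
    sum-snoc {suc n} e c = +-congˡ (sum-snoc (λ j → e (suc j)) (λ j → c (suc j)))

  -- Repeating 1 as the last generator lets the elimination end with an equation for 1 itself.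
  integral : ∀ {n θ} (e : Fin n → Carrier) → Span e θ →
    (∀ i → Span e (θ * e i)) → ∃[ cs ] (eval (cs ++ + 1 ∷ []) θ ≈ 0#)
  integral {n} {θ} e₀ θ∈span stable₀ =
    let m , d , pol , d≈0 = eliminate n N e (λ i j → step (ℤ.- c i j) (const refl) refl) rel
        cs , eq = pol⇒eval pol
    in cs , (begin
      eval (cs ++ + 1 ∷ []) θ  ≈⟨ eq ⟨
      d                        ≈⟨ *-identityʳ d ⟨
      d * 1#                   ≈⟨ *-congˡ (snoc-last e₀ 1#) ⟨
      d * e (fromℕ n)          ≈⟨ d≈0 ⟩
      0#                       ∎)
    where
    e : Fin (suc n) → Carrier
    e = snoc e₀ 1#
    stable : ∀ i → Span e (θ * e i)
    stable = snoc-all (λ b → Span e (θ * b)) (λ i → span-snoc 1# (stable₀ i)) (span-snoc 1# (span-resp e₀ (sym (*-identityʳ θ)) θ∈span))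
    c : Fin (suc n) → Fin (suc n) → ℤ
    c i = proj₁ (stable i)
    -- The matrix θ·1 - c, which annihilates the generators; its determinant would be the
    -- characteristic polynomial of multiplication by θ.
    N : Fin (suc n) → Fin (suc n) → Carrier
    N i j = ι (ℤ.- c i j) + θ * ι (δ i j)
    rel : ∀ i → sum (λ j → N i j * e j) ≈ 0#
    rel i = begin
      sum (λ j → N i j * e j)
        ≈⟨ sum-cong-≋ (λ j → trans (*-congʳ (+-congʳ (ι-neg (c i j))))
             (solve 4 (λ c t d e → (:- c :+ t :* d) :* e := con -[1+ 0 ] :* (c :* e) :+ t :* (d :* e)) refl (ι (c i j)) θ (ι (δ i j)) (e j))) ⟩
      sum (λ j → ι -[1+ 0 ] * (ι (c i j) * e j) + θ * (ι (δ i j) * e j))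
        ≈⟨ ∑-distrib-+ (λ j → ι -[1+ 0 ] * (ι (c i j) * e j)) (λ j → θ * (ι (δ i j) * e j)) ⟩
      sum (λ j → ι -[1+ 0 ] * (ι (c i j) * e j)) + sum (λ j → θ * (ι (δ i j) * e j))
        ≈⟨ +-cong (*-distribˡ-sum (ι -[1+ 0 ]) (λ j → ι (c i j) * e j)) (*-distribˡ-sum θ (λ j → ι (δ i j) * e j)) ⟨
      ι -[1+ 0 ] * sum (λ j → ι (c i j) * e j) + θ * sum (λ j → ι (δ i j) * e j)
        ≈⟨ +-cong (*-congˡ (sym (proj₂ (stable i)))) (*-congˡ (sum-δ e i)) ⟩
      ι -[1+ 0 ] * (θ * e i) + θ * e i
        ≈⟨ solve 2 (λ t e → con -[1+ 0 ] :* (t :* e) :+ t :* e := con (+ 0)) refl θ (e i) ⟩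
      ι (+ 0)
        ≈⟨ ι-0 ⟩
      0# ∎

-- Polynomials over ℤ

prime-∣-* : ∀ {p} m n → Prime p → + p ∣ m ℤ.* n → ¬ + p ∣ m → + p ∣ n
prime-∣-* m n pr d ¬d with euclidsLemma ℤ.∣ m ∣ ℤ.∣ n ∣ pr (≡.subst (_ ℕᵈ.∣_) (ℤₚ.abs-* m n) (∣⇒∣ᵤ d))
... | inj₁ e = ⊥-elim (¬d (∣ᵤ⇒∣ e))
... | inj₂ e = ∣ᵤ⇒∣ e

∤1 : ∀ {p} → Prime p → ¬ + p ∣ + 1
∤1 {p} pr d = ℕₚ.<-irrefl (≡.sym (ℕᵈ.∣1⇒≡1 (∣⇒∣ᵤ d))) (ℕ.nonTrivial⇒n>1 p {{prime⇒nonTrivial pr}})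

prime-∣-^ : ∀ {p} m n → Prime p → + p ∣ m ℤ.^ n → + p ∣ m
prime-∣-^ m zero pr d = ⊥-elim (∤1 pr d)
prime-∣-^ {p} m (suc n) pr d with + p ℤᵈ.∣? m
... | yes e = e
... | no ¬e = prime-∣-^ m n pr (prime-∣-* m (m ℤ.^ n) pr d ¬e)

prime∤⇒coprime : ∀ {p n} → Prime p → ¬ p ℕᵈ.∣ n → Coprime p n
prime∤⇒coprime pr ¬d (d∣p , d∣n) with prime⇒irreducible pr d∣p
... | inj₁ d≡1 = d≡1
... | inj₂ ≡.refl = ⊥-elim (¬d d∣n)

coprime-inverse : ∀ {p n} → Coprime p n → ∃[ y ] ∃[ l ] (y ℤ.* + n ≡ + 1 ℤ.+ + p ℤ.* l)
coprime-inverse {p} {n} c with coprime-Bézout c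
... | Bézout.-+ x y eq = + y , + x , (begin
  + y ℤ.* + n              ≡⟨ ℤₚ.pos-* y n ⟨
  + (y ℕ.* n)              ≡⟨ ≡.cong +_ eq ⟨
  + (1 ℕ.+ x ℕ.* p)        ≡⟨ ≡.cong (λ w → + 1 ℤ.+ w) (≡.trans (ℤₚ.pos-* x p) (ℤₚ.*-comm (+ x) (+ p))) ⟩
  + 1 ℤ.+ + p ℤ.* + x      ∎)
  where open ≡.≡-Reasoning
... | Bézout.+- x y eq = ℤ.- + y , ℤ.- + x , (begin
  ℤ.- + y ℤ.* + n                                    ≡⟨ solve 2 (λ y n → :- y :* n := con (+ 1) :- (con (+ 1) :+ y :* n)) ≡.refl (+ y) (+ n) ⟩
  + 1 ℤ.- (+ 1 ℤ.+ + y ℤ.* + n)                      ≡⟨ ≡.cong (λ w → + 1 ℤ.- (+ 1 ℤ.+ w)) (ℤₚ.pos-* y n) ⟨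
  + 1 ℤ.- + (1 ℕ.+ y ℕ.* n)                          ≡⟨ ≡.cong (λ w → + 1 ℤ.- + w) eq ⟩
  + 1 ℤ.- + (x ℕ.* p)                                ≡⟨ ≡.cong (λ w → + 1 ℤ.- w) (ℤₚ.pos-* x p) ⟩
  + 1 ℤ.- + x ℤ.* + p                                ≡⟨ solve 2 (λ x p → con (+ 1) :- x :* p := con (+ 1) :+ p :* (:- x)) ≡.refl (+ x) (+ p) ⟩
  + 1 ℤ.+ + p ℤ.* (ℤ.- + x)                          ∎)
  where
  open ≡.≡-Reasoning
  open +-*-Solver

prime-inverse : ∀ {p} m → Prime p → ¬ + p ∣ m → ∃[ y ] ∃[ l ] (y ℤ.* m ≡ + 1 ℤ.+ + p ℤ.* l)
prime-inverse {p} (+ n) pr ¬d = coprime-inverse (prime∤⇒coprime pr (λ d → ¬d (∣ᵤ⇒∣ d)))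
prime-inverse {p} -[1+ n ] pr ¬d =
  let y , l , eq = coprime-inverse (prime∤⇒coprime pr (λ d → ¬d (∣ᵤ⇒∣ d)))
  in ℤ.- y , l , ≡.trans (≡.sym (ℤₚ.neg-distribˡ-* y -[1+ n ])) (≡.trans (ℤₚ.neg-distribʳ-* y -[1+ n ]) eq)

-- ℤ[X] is specified without coefficient functions: `X-free` compares constant terms and strips a
-- factor X, so comparing coefficients becomes induction on a `Pol`.
record PolynomialRing : Set₁ where
  field
    algebra : ℤ-Algebra
  open Algebraic algebra
  field
    X         : Carrier
    X-free    : ∀ c f → ι c + X * f ≈ 0# → c ≡ + 0 × f ≈ 0#
    generated : ∀ f → ∃[ k ] Pol X k (+ 0) f
    D         : Carrier → Carrier
    D-cong    : ∀ {f g} → f ≈ g → D f ≈ D g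
    D-+       : ∀ f g → D (f + g) ≈ D f + D g
    D-*       : ∀ f g → D (f * g) ≈ D f * g + f * D g
    D-ι       : ∀ c → D (ι c) ≈ 0#
    D-X       : D X ≈ 1#

module Polynomials (Z : PolynomialRing) where
  open PolynomialRing Z public
  open Algebraic algebra public

  Monic : ℕ → Carrier → Set
  Monic n f = Pol X n (+ 1) f

  Low : ℕ → Carrier → Set
  Low n f = Pol X n (+ 0) f

  monic-^ : ∀ {k f} n → Monic k f → Monic (n ℕ.* k) (f ^ n)
  monic-^ n m = pol-lead (ℤₚ.^-zeroˡ n) (pol-^ n m)

  low-0 : ∀ n → Low n 0#
  low-0 zero    = const (sym ι-0)
  low-0 (suc n) = pol-raise (low-0 n)

  infix 4 _∣ᴾ_ _∈⟨_,_⟩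

  _∣ᴾ_ : ℤ → Carrier → Set
  m ∣ᴾ f = ∃[ s ] (f ≈ ι m * s)

  _∈⟨_,_⟩ : Carrier → ℤ → Carrier → Set
  f ∈⟨ m , G ⟩ = ∃[ u ] ∃[ v ] (f ≈ ι m * u + G * v)

  -- Writing the quotient as s = d + X z turns divisibility by m into the equation (c - dm) + X (f -
  -- mz) = 0, to which `X-free` applies.
  X-free-mod : ∀ {m c f} → m ∣ᴾ ι c + X * f → m ∣ c × m ∣ᴾ f
  X-free-mod {m} {c} {f} (s , eq) with generated s
  ... | _ , const e =
    let c≡0 , f≈0 = X-free c f (trans eq (trans (*-congˡ (trans e ι-0)) (zeroʳ _)))
    in divides (+ 0) c≡0 , 0# , trans f≈0 (sym (zeroʳ _))
  ... | _ , step {z = z} d _ e =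
    let c≡ , f≈ = X-free (c ℤ.- d ℤ.* m) (f - ι m * z) (begin
          ι (c ℤ.- d ℤ.* m) + X * (f - ι m * z)
            ≈⟨ +-congʳ (trans (ι-+ _ _) (+-congˡ (trans (ι-neg _) (-‿cong (ι-* _ _))))) ⟩
          (ι c - ι d * ι m) + X * (f - ι m * z)
            ≈⟨ solve 6 (λ c d m x f z → (c :- d :* m) :+ x :* (f :- m :* z) := (c :+ x :* f) :- m :* (d :+ x :* z)) refl (ι c) (ι d) (ι m) X f z ⟩
          (ι c + X * f) - ι m * (ι d + X * z)
            ≈⟨ +-cong eq (-‿cong (*-congˡ (sym e))) ⟩
          ι m * s - ι m * s
            ≈⟨ -‿inverseʳ _ ⟩
          0# ∎)
    in divides d (≡.trans (lem c (d ℤ.* m)) (≡.trans (≡.cong (ℤ._+ d ℤ.* m) c≡) (ℤₚ.+-identityˡ _)))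
     , z , (begin
          f                          ≈⟨ solve 2 (λ f w → f := (f :- w) :+ w) refl f (ι m * z) ⟩
          (f - ι m * z) + ι m * z    ≈⟨ +-congʳ f≈ ⟩
          0# + ι m * z               ≈⟨ +-identityˡ _ ⟩
          ι m * z                    ∎)
    where
    lem : ∀ a b → a ≡ (a ℤ.- b) ℤ.+ b
    lem = ℤsolve 2 (λ a b → a ℤ:= (a ℤ:- b) ℤ:+ b) ≡.refl
      where open +-*-Solver renaming (solve to ℤsolve; _:=_ to _ℤ:=_; _:-_ to _ℤ:-_; _:+_ to _ℤ:+_)

  ∣ᴾ-resp : ∀ {m f g} → f ≈ g → m ∣ᴾ f → m ∣ᴾ g
  ∣ᴾ-resp f≈g (s , eq) = s , trans (sym f≈g) eq

  ∣ᴾ-+ : ∀ {m f g} → m ∣ᴾ f → m ∣ᴾ g → m ∣ᴾ f + g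
  ∣ᴾ-+ (s , p) (t , q) = s + t , trans (+-cong p q) (sym (distribˡ _ s t))

  ∣ᴾ-* : ∀ {m f} g → m ∣ᴾ f → m ∣ᴾ g * f
  ∣ᴾ-* {m} g (s , p) = g * s , trans (*-congˡ p) (solve 3 (λ g m s → g :* (m :* s) := m :* (g :* s)) refl g (ι m) s)

  ∣ᴾ-neg : ∀ {m f} → m ∣ᴾ f → m ∣ᴾ - f
  ∣ᴾ-neg {m} (s , p) = - s , trans (-‿cong p) (solve 2 (λ m s → :- (m :* s) := m :* (:- s)) refl (ι m) s)

  ∣⇒∣ᴾ : ∀ {m c} → m ∣ c → m ∣ᴾ ι c
  ∣⇒∣ᴾ {m} (divides d ≡.refl) = ι d , trans (ι-* d m) (*-comm _ _)

  ∣ᴾ-ι : ∀ {m c} → m ∣ᴾ ι c → m ∣ c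
  ∣ᴾ-ι {c = c} d = proj₁ (X-free-mod (∣ᴾ-resp (trans (sym (+-identityʳ _)) (+-congˡ (sym (zeroʳ X)))) d))

  ∣ᴾ-lead : ∀ {m k ε f} → Pol X k ε f → m ∣ᴾ f → m ∣ ε
  ∣ᴾ-lead (const e)    d = ∣ᴾ-ι (∣ᴾ-resp e d)
  ∣ᴾ-lead (step c p e) d = ∣ᴾ-lead p (proj₂ (X-free-mod (∣ᴾ-resp e d)))

  x-0≈x : ∀ {f} → f - 0# ≈ f
  x-0≈x {f} = trans (+-congˡ (-‿cong (sym ι-0))) (solve 1 (λ f → f :- con (+ 0) := f) refl f)

  -- Uniqueness of division modulo m. As H is monic and l has smaller degree, the top coefficient ε
  -- of k is also that of H k - l; so m divides ε, and the term ε Xʲ can be removed from k.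
  ∣ᴾ-monic : ∀ {m n H l k} → Monic n H → Low n l → m ∣ᴾ H * k - l → m ∣ᴾ k
  ∣ᴾ-monic {m} {n} {H} {l} {k} mon low = go (proj₂ (generated k))
    where
    go : ∀ {j k} → Low j k → m ∣ᴾ H * k - l → m ∣ᴾ k
    go {zero} (const e) d = 0# , trans e (trans ι-0 (sym (zeroʳ _)))
    go {suc j} {k} p d = ∣ᴾ-resp (solve 2 (λ k w → (k :- w) :+ w := k) refl k (ι ε * X ^ j))
      (∣ᴾ-+ (go (pol-split q) (∣ᴾ-resp (solve 4 (λ h k l w → (h :* k :- l) :+ (:- (h :* w)) := h :* (k :- w) :- l) refl H k l (ι ε * X ^ j))
                (∣ᴾ-+ d (∣ᴾ-neg (∣ᴾ-* H m∣εXʲ)))))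
             m∣εXʲ)
      where
      ε = proj₁ (pol-lower p)
      q = proj₂ (pol-lower p)
      low′ : Pol X (n ℕ.+ j) (+ 0) l
      low′ = pol-pad (ℕₚ.≤⇒≤′ (ℕₚ.m≤m+n n j)) low
      m∣ε : m ∣ ε
      m∣ε = ≡.subst (m ∣_) (≡.trans (ℤₚ.+-identityʳ _) (ℤₚ.*-identityˡ ε))
        (∣ᴾ-lead (pol-+ (pol-* mon q) (pol-neg low′)) d)
      m∣εXʲ : m ∣ᴾ ι ε * X ^ j
      m∣εXʲ = ∣ᴾ-resp (*-comm _ _) (∣ᴾ-* (X ^ j) (∣⇒∣ᴾ m∣ε))

  ∣ᴾ-cancel : ∀ {m n H k} → Monic n H → m ∣ᴾ H * k → m ∣ᴾ k
  ∣ᴾ-cancel {n = n} mon d = ∣ᴾ-monic mon (low-0 n) (∣ᴾ-resp (sym x-0≈x) d)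

  divMod : ∀ {d G} → Monic d G → ∀ f → ∃[ k ] ∃[ r ] (Low d r × f ≈ G * k + r)
  divMod {d} {G} mon f = go (proj₂ (generated f))
    where
    go : ∀ {j f} → Low j f → ∃[ k ] ∃[ r ] (Low d r × f ≈ G * k + r)
    go (const e) = 0# , 0# , low-0 d , (begin
      _            ≈⟨ e ⟩
      ι (+ 0)      ≈⟨ ι-0 ⟩
      0#           ≈⟨ zeroʳ G ⟨
      G * 0#       ≈⟨ +-identityʳ _ ⟨
      G * 0# + 0#  ∎)
    go (step {y = f} {z = z} c p e) with go p
    -- The remainder c + X r may reach degree d; its coefficient ε there moves into the quotient.
    ... | k , r , low , eq with pol-lower (step c low refl)
    ...   | ε , q = X * k + ι ε , (ι c + X * r) + - (ι ε * G)
      , pol-lead (≡.trans (≡.cong (λ w → ε ℤ.+ ℤ.- w) (ℤₚ.*-identityʳ ε)) (ℤₚ.+-inverseʳ ε)) (pol-+ q (pol-neg (pol-scale ε mon)))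
      , (begin
          f                                                  ≈⟨ e ⟩
          ι c + X * z                                        ≈⟨ +-congˡ (*-congˡ eq) ⟩
          ι c + X * (G * k + r)                              ≈⟨ solve 6 (λ c x g k r e → c :+ x :* (g :* k :+ r) := g :* (x :* k :+ e) :+ ((c :+ x :* r) :+ :- (e :* g))) refl (ι c) X G k r (ι ε) ⟩
          G * (X * k + ι ε) + ((ι c + X * r) + - (ι ε * G))  ∎)

  -- I stands for an ideal: both the multiples of p and the ideals (p, G) will be substituted.
  module _ (I : Carrier → Set) (I-resp : ∀ {f g} → f ≈ g → I f → I g) (I-+ : ∀ {f g} → I f → I g → I (f + g)) (I-* : ∀ {f} g → I f → I (g * f)) where

    pow-cong : ∀ {f g} n → I (f - g) → I (f ^ n - g ^ n)
    pow-cong {f} {g} zero d = I-resp (trans (zeroˡ _) (sym (-‿inverseʳ 1#))) (I-* 0# d)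
    pow-cong {f} {g} (suc n) d = I-resp
      (solve 4 (λ f g u v → f :* (u :- v) :+ v :* (f :- g) := f :* u :- g :* v) refl f g (f ^ n) (g ^ n))
      (I-+ (I-* f (pow-cong n d)) (I-* (g ^ n) d))

  ι-^ : ∀ c n → ι (c ℤ.^ n) ≈ ι c ^ n
  ι-^ c zero    = ι-1
  ι-^ c (suc n) = trans (ι-* c (c ℤ.^ n)) (*-congˡ (ι-^ c n))

  pow-const : ∀ c z n → ∃[ w ] ((ι c + X * z) ^ n ≈ ι (c ℤ.^ n) + X * w)
  pow-const c z zero = 0# , trans (sym ι-1) (trans (sym (+-identityʳ _)) (+-congˡ (sym (zeroʳ X))))
  pow-const c z (suc n) =
    let w , eq = pow-const c z n
    in ι c * w + z * (ι (c ℤ.^ n) + X * w) , (begin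
      (ι c + X * z) * (ι c + X * z) ^ n              ≈⟨ *-congˡ eq ⟩
      (ι c + X * z) * (ι (c ℤ.^ n) + X * w)          ≈⟨ solve 5 (λ c x z d w → (c :+ x :* z) :* (d :+ x :* w) := c :* d :+ x :* (c :* w :+ z :* (d :+ x :* w))) refl (ι c) X z (ι (c ℤ.^ n)) w ⟩
      ι c * ι (c ℤ.^ n) + X * (ι c * w + z * (ι (c ℤ.^ n) + X * w))  ≈⟨ +-congʳ (ι-* c (c ℤ.^ n)) ⟨
      ι (c ℤ.^ suc n) + X * (ι c * w + z * (ι (c ℤ.^ n) + X * w))    ∎)

  ^-distrib-* : ∀ f g n → (f * g) ^ n ≈ f ^ n * g ^ n
  ^-distrib-* f g zero    = sym (*-identityˡ 1#)
  ^-distrib-* f g (suc n) = trans (*-congˡ (^-distrib-* f g n))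
    (solve 4 (λ f g u v → (f :* g) :* (u :* v) := (f :* u) :* (g :* v)) refl f g (f ^ n) (g ^ n))

  D-^ : ∀ f n → D (f ^ suc n) ≈ ι (+ suc n) * (f ^ n * D f)
  D-^ f zero = begin
    D (f * 1#)              ≈⟨ D-cong (*-identityʳ f) ⟩
    D f                     ≈⟨ *-identityˡ _ ⟨
    1# * D f                ≈⟨ *-identityˡ _ ⟨
    1# * (1# * D f)         ≈⟨ *-congʳ ι-1 ⟨
    ι (+ 1) * (1# * D f)    ∎
  D-^ f (suc n) = begin
    D (f * f ^ suc n)                                        ≈⟨ D-* f (f ^ suc n) ⟩
    D f * f ^ suc n + f * D (f ^ suc n)                      ≈⟨ +-congˡ (*-congˡ (D-^ f n)) ⟩
    D f * (f * f ^ n) + f * (ι (+ suc n) * (f ^ n * D f))    ≈⟨ solve 4 (λ d f u n → d :* (f :* u) :+ f :* (n :* (u :* d)) := (con (+ 1) :+ n) :* ((f :* u) :* d)) refl (D f) f (f ^ n) (ι (+ suc n)) ⟩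
    (ι (+ 1) + ι (+ suc n)) * (f ^ suc n * D f)              ≈⟨ *-congʳ (ι-+ (+ 1) (+ suc n)) ⟨
    ι (+ suc (suc n)) * (f ^ suc n * D f)                    ∎

-- Polynomials modulo a prime: reduced quotients and Dedekind's criterion

n<p^n : ∀ {p} → 2 ℕ.≤ p → ∀ n → n ℕ.< p ℕ.^ n
n<p^n 2≤p zero = ℕ.s≤s ℕ.z≤n
n<p^n {p} 2≤p (suc n) = ℕₚ.≤-trans
  (ℕₚ.+-mono-≤ (ℕₚ.≤-trans (ℕ.s≤s ℕ.z≤n) (n<p^n 2≤p n)) (ℕₚ.≤-trans (n<p^n 2≤p n) (ℕₚ.≤-reflexive (≡.sym (ℕₚ.+-identityʳ _)))))
  (ℕₚ.*-monoˡ-≤ (p ℕ.^ n) 2≤p)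

module ModuloPrime (Z : PolynomialRing) {p : ℕ} (pr : Prime p) where
  open Polynomials Z

  P : Carrier
  P = ι (+ p)

  module _ {G : Carrier} where

    ideal-resp : ∀ {f g} → f ≈ g → f ∈⟨ + p , G ⟩ → g ∈⟨ + p , G ⟩
    ideal-resp f≈g (u , v , eq) = u , v , trans (sym f≈g) eq

    ideal-+ : ∀ {f g} → f ∈⟨ + p , G ⟩ → g ∈⟨ + p , G ⟩ → f + g ∈⟨ + p , G ⟩
    ideal-+ (u , v , e) (u′ , v′ , e′) = u + u′ , v + v′ , trans (+-cong e e′)
      (solve 6 (λ p u u′ g v v′ → (p :* u :+ g :* v) :+ (p :* u′ :+ g :* v′) := p :* (u :+ u′) :+ g :* (v :+ v′)) refl P u u′ G v v′)

    ideal-* : ∀ {f} g → f ∈⟨ + p , G ⟩ → g * f ∈⟨ + p , G ⟩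
    ideal-* h (u , v , e) = h * u , h * v , trans (*-congˡ e)
      (solve 5 (λ h p u g v → h :* (p :* u :+ g :* v) := p :* (h :* u) :+ g :* (h :* v)) refl h P u G v)

    ideal-neg : ∀ {f} → f ∈⟨ + p , G ⟩ → - f ∈⟨ + p , G ⟩
    ideal-neg {f} i = ideal-resp (solve 1 (λ f → con -[1+ 0 ] :* f := :- f) refl f) (ideal-* (ι -[1+ 0 ]) i)

    ideal-p : ∀ f → P * f ∈⟨ + p , G ⟩
    ideal-p f = f , 0# , trans (sym (+-identityʳ _)) (+-congˡ (sym (zeroʳ G)))

    ideal-G : ∀ f → G * f ∈⟨ + p , G ⟩
    ideal-G f = 0# , f , trans (sym (+-identityˡ _)) (+-congʳ (sym (zeroʳ P)))

  -- 𝔽ₚ[X] is reduced: the constant term of fⁿ is cⁿ, so p ∣ c; then p ∣ Xⁿ zⁿ and the monic Xⁿ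
  -- cancels.
  ∣ᴾ-root : ∀ n {k ε f} → Pol X k ε f → + p ∣ᴾ f ^ n → + p ∣ᴾ f
  ∣ᴾ-root n {ε = ε} (const e) d = ∣ᴾ-resp (sym e) (∣⇒∣ᴾ (prime-∣-^ ε n pr
    (∣ᴾ-ι (∣ᴾ-resp (trans (^-congˡ n e) (sym (ι-^ ε n))) d))))
  ∣ᴾ-root n {f = f} (step {z = z} c pol e) d =
    ∣ᴾ-resp (sym e) (∣ᴾ-+ p∣c (∣ᴾ-* X (∣ᴾ-root n pol (∣ᴾ-cancel (monic-^ n pol-var) p∣Xzⁿ))))
    where
    p∣c : + p ∣ᴾ ι c
    p∣c = ∣⇒∣ᴾ (prime-∣-^ c n pr (proj₁ (X-free-mod
      (∣ᴾ-resp (trans (^-congˡ n e) (proj₂ (pow-const c z n))) d))))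
    p∣Xzⁿ : + p ∣ᴾ X ^ n * z ^ n
    p∣Xzⁿ = ∣ᴾ-resp
      (trans (solve 2 (λ u v → u :+ (v :- u) := v) refl (f ^ n) ((X * z) ^ n)) (^-distrib-* X z n))
      (∣ᴾ-+ d (pow-cong (+ p ∣ᴾ_) ∣ᴾ-resp ∣ᴾ-+ ∣ᴾ-* n
        (∣ᴾ-resp (sym (trans (+-congˡ (-‿cong e)) (solve 2 (λ c w → w :- (c :+ w) := :- c) refl (ι c) (X * z)))) (∣ᴾ-neg p∣c))))

  -- Coprimality of G and G′ modulo p, encoded as a Bézout identity so that it can be multiplied
  -- into other congruences.
  Separable : Carrier → Set
  Separable G = ∃[ u ] ∃[ v ] ∃[ w ] (u * G + v * D G ≈ 1# + P * w)

  -- If p ∣ y′ and y ≡ Gⁱ⁺¹ k, differentiation gives G ∣ (i+1) G′ k modulo p, hence G ∣ k.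
  lift-power : ∀ {d G y} → Monic d G → Separable G → + p ∣ᴾ D y → y ∈⟨ + p , G ⟩ →
    ∀ i → i ℕ.< p → y ∈⟨ + p , G ^ suc i ⟩
  lift-power {G = G} mon sep py (u , v , e) zero i<p = u , v , trans e (+-congˡ (*-congʳ (sym (*-identityʳ G))))
  lift-power {G = G} {y} mon sep@(u , v , w , sep-eq) (y₁ , py) y∈ (suc i) i<p =
    m + Gⁱ⁺¹ * m₂ , k₂ , (begin
      y                                       ≈⟨ eq ⟩
      P * m + Gⁱ⁺¹ * k                        ≈⟨ +-congˡ (*-congˡ k≈) ⟩
      P * m + Gⁱ⁺¹ * (P * m₂ + G * k₂)        ≈⟨ solve 6 (λ p m h m₂ g k₂ → p :* m :+ h :* (p :* m₂ :+ g :* k₂) := p :* (m :+ h :* m₂) :+ (g :* h) :* k₂) refl P m Gⁱ⁺¹ m₂ G k₂ ⟩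
      P * (m + Gⁱ⁺¹ * m₂) + (G * Gⁱ⁺¹) * k₂   ∎)
    where
    Gⁱ⁺¹ = G ^ suc i
    previous = lift-power mon sep (y₁ , py) y∈ i (ℕₚ.<-trans (ℕₚ.n<1+n i) i<p)
    m = proj₁ previous
    k = proj₁ (proj₂ previous)
    eq = proj₂ (proj₂ previous)
    a = ι (+ suc i)
    cancelled : + p ∣ᴾ a * (D G * k) + G * D k
    cancelled = ∣ᴾ-cancel (monic-^ i mon) (y₁ - D m , (begin
      G ^ i * (a * (D G * k) + G * D k)
        ≈⟨ solve 7 (λ h a d k g e q → h :* (a :* (d :* k) :+ g :* e) := (q :+ ((a :* (h :* d)) :* k :+ (g :* h) :* e)) :- q) refl (G ^ i) a (D G) k G (D k) (P * D m) ⟩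
      (P * D m + ((a * (G ^ i * D G)) * k + Gⁱ⁺¹ * D k)) - P * D m
        ≈⟨ +-congʳ (+-cong D-const (trans (D-* Gⁱ⁺¹ k) (+-congʳ (*-congʳ (D-^ G i))))) ⟨
      (D (P * m) + D (Gⁱ⁺¹ * k)) - P * D m
        ≈⟨ +-congʳ (trans (D-cong eq) (D-+ (P * m) (Gⁱ⁺¹ * k))) ⟨
      D y - P * D m
        ≈⟨ +-congʳ py ⟩
      P * y₁ - P * D m
        ≈⟨ solve 3 (λ p y m → p :* y :- p :* m := p :* (y :- m)) refl P y₁ (D m) ⟩
      P * (y₁ - D m) ∎))
      where
      D-const : D (P * m) ≈ P * D m
      D-const = trans (D-* P m) (trans (+-congʳ (trans (*-congʳ (D-ι (+ p))) (zeroˡ m))) (+-identityˡ _))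
    t = proj₁ cancelled
    -- The range of i matters here: 0 < i + 1 < p, so i + 1 is invertible modulo p. This is why the
    -- lifting reaches Gᵖ and stops.
    inverse = prime-inverse (+ suc i) pr (λ d → ℕₚ.<⇒≱ i<p (ℕᵈ.∣⇒≤ (∣⇒∣ᵤ d)))
    j = ι (proj₁ inverse)
    l = ι (proj₁ (proj₂ inverse))
    ja≈ : j * a ≈ 1# + P * l
    ja≈ = begin
      j * a                                        ≈⟨ ι-* _ _ ⟨
      ι (proj₁ inverse ℤ.* + suc i)                ≈⟨ ι-cong (proj₂ (proj₂ inverse)) ⟩
      ι (+ 1 ℤ.+ + p ℤ.* proj₁ (proj₂ inverse))    ≈⟨ trans (ι-+ _ _) (+-cong ι-1 (ι-* _ _)) ⟩
      1# + P * l                                   ∎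
    -- Obtained by multiplying a G′ k = p t - G k′ by j v and then replacing j a by 1 and v G′ by 1
    -- - u G modulo p.
    m₂ = j * (v * t) - (j * a) * (w * k) - l * k
    k₂ = (j * a) * (u * k) - j * (v * D k)
    k≈ : k ≈ P * m₂ + G * k₂
    k≈ = begin
      k
        ≈⟨ trans (sym (*-identityˡ k)) (trans (sym (+-identityʳ _)) (+-congˡ (sym (-‿inverseʳ _)))) ⟩
      1# * k + (j * (v * (a * (D G * k) + G * D k)) - j * (v * (a * (D G * k) + G * D k)))
        ≈⟨ +-cong (*-congʳ one) (+-congʳ (*-congˡ (*-congˡ (proj₂ cancelled)))) ⟩
      ((j * a) * (u * G + v * D G - P * w) - P * l) * k + (j * (v * (P * t)) - j * (v * (a * (D G * k) + G * D k)))
        ≈⟨ rearrange j a u G v (D G) P w l k t (D k) ⟩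
      P * m₂ + G * k₂ ∎
      where
      one : 1# ≈ (j * a) * (u * G + v * D G - P * w) - P * l
      one = begin
        1#                                                ≈⟨ *-identityˡ 1# ⟨
        1# * 1#                                           ≈⟨ *-congʳ (trans (solve 2 (λ e q → e := (e :+ q) :- q) refl 1# (P * l)) (+-congʳ (sym ja≈))) ⟩
        (j * a - P * l) * 1#                              ≈⟨ trans (distribʳ _ _ _) (+-cong (*-congˡ (trans (solve 2 (λ e q → e := (e :+ q) :- q) refl 1# (P * w)) (+-congʳ (sym sep-eq)))) (*-identityʳ _)) ⟩
        (j * a) * (u * G + v * D G - P * w) - P * l       ∎
      rearrange : ∀ j a u g v d p w l k t e →
        ((j * a) * (u * g + v * d - p * w) - p * l) * k + (j * (v * (p * t)) - j * (v * (a * (d * k) + g * e)))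
        ≈ p * (j * (v * t) - (j * a) * (w * k) - l * k) + g * ((j * a) * (u * k) - j * (v * e))
      rearrange = solve 12 (λ j a u g v d p w l k t e →
        ((j :* a) :* (u :* g :+ v :* d :- p :* w) :- p :* l) :* k :+ (j :* (v :* (p :* t)) :- j :* (v :* (a :* (d :* k) :+ g :* e)))
        := p :* (j :* (v :* t) :- (j :* a) :* (w :* k) :- l :* k) :+ g :* ((j :* a) :* (u :* k) :- j :* (v :* e))) refl

  private
    p≥2 : 2 ℕ.≤ p
    p≥2 = ℕ.nonTrivial⇒n>1 p {{prime⇒nonTrivial pr}}

  -- Replace f by its remainder r. The derivative of rᵖ is divisible by p, so `lift-power` applies
  -- up to Gᵖ; the cofactor of Gᵖ then vanishes modulo p for reasons of degree, and p ∣ rᵖ gives p ∣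
  -- r.
  frobenius-reduced : ∀ {d G f} → Monic d G → Separable G → f ^ p ∈⟨ + p , G ⟩ → f ∈⟨ + p , G ⟩
  frobenius-reduced {d} {G} {f} mon sep fᵖ∈ = proj₁ p∣r , k , trans f≈ (trans (+-comm _ _) (+-congʳ (proj₂ p∣r)))
    where
    k = proj₁ (divMod mon f)
    r = proj₁ (proj₂ (divMod mon f))
    low = proj₁ (proj₂ (proj₂ (divMod mon f)))
    f≈ = proj₂ (proj₂ (proj₂ (divMod mon f)))
    rᵖ∈ : r ^ p ∈⟨ + p , G ⟩
    rᵖ∈ = ideal-resp (solve 2 (λ u v → u :+ (v :- u) := v) refl (f ^ p) (r ^ p)) (ideal-+ fᵖ∈
      (pow-cong (_∈⟨ + p , G ⟩) ideal-resp ideal-+ ideal-* p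
        (ideal-resp (sym (trans (+-congˡ (-‿cong f≈)) (solve 3 (λ g k r → r :- (g :* k :+ r) := g :* :- k) refl G k r))) (ideal-G (- k)))))
    -- Stated for a general q ≥ 2, as the exponent has to be matched against a successor while p is
    -- a fixed parameter.
    low-^ : ∀ q → 2 ℕ.≤ q → Low (q ℕ.* d) (r ^ q)
    low-^ (suc q) _ = pol-lead (ℤₚ.*-zeroˡ ((+ 0) ℤ.^ q)) (pol-^ (suc q) low)
    D-^-∣ : ∀ q → 2 ℕ.≤ q → + q ∣ᴾ D (r ^ q)
    D-^-∣ (suc q) _ = _ , D-^ r q
    power : ∀ q → 2 ℕ.≤ q → (∀ i → i ℕ.< q → r ^ p ∈⟨ + p , G ^ suc i ⟩) → r ^ p ∈⟨ + p , G ^ q ⟩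
    power (suc q) _ h = h q (ℕₚ.n<1+n q)
    rᵖ∈Gᵖ : r ^ p ∈⟨ + p , G ^ p ⟩
    rᵖ∈Gᵖ = power p p≥2 (lift-power mon sep (D-^-∣ p p≥2) rᵖ∈)
    p∣r : + p ∣ᴾ r
    p∣r = let m , k′ , eq = rᵖ∈Gᵖ
              s , k′≈ = ∣ᴾ-monic (monic-^ p mon) (low-^ p p≥2) (- m , trans (+-congˡ (-‿cong eq))
                          (solve 3 (λ p m w → w :- (p :* m :+ w) := p :* :- m) refl P m (G ^ p * k′)))
          in ∣ᴾ-root p low (m + G ^ p * s , trans eq (trans (+-congˡ (*-congˡ k′≈))
               (solve 4 (λ p m g s → p :* m :+ g :* (p :* s) := p :* (m :+ g :* s)) refl P m (G ^ p) s)))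

  -- Since n < pⁿ, the power f^(pⁿ) also lies in (p, G), and p-th roots can be taken n times.
  reduced : ∀ {d G f} n → Monic d G → Separable G → f ^ n ∈⟨ + p , G ⟩ → f ∈⟨ + p , G ⟩
  reduced {G = G} {f} n mon sep fⁿ∈ = descend n (ideal-resp
    (trans (sym (^-homo-* f (p ℕ.^ n ℕ.∸ n) n)) (^-congʳ f (ℕₚ.m∸n+n≡m (ℕₚ.<⇒≤ (n<p^n p≥2 n)))))
    (ideal-* (f ^ (p ℕ.^ n ℕ.∸ n)) fⁿ∈))
    where
    descend : ∀ m → f ^ (p ℕ.^ m) ∈⟨ + p , G ⟩ → f ∈⟨ + p , G ⟩
    descend zero    f∈ = ideal-resp (*-identityʳ f) f∈
    descend (suc m) f∈ = descend m (frobenius-reduced mon sep (ideal-resp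
      (trans (^-congʳ f (ℕₚ.*-comm p (p ℕ.^ m))) (sym (^-assocʳ f (p ℕ.^ m) p))) f∈))

  separable-factor : ∀ {g h} → Separable (g * h) → Separable g
  separable-factor {g} {h} (u , v , w , eq) = u * h + v * D h , v * h , w , (begin
    (u * h + v * D h) * g + (v * h) * D g    ≈⟨ solve 6 (λ u v g h a b → (u :* h :+ v :* b) :* g :+ (v :* h) :* a := u :* (g :* h) :+ v :* (a :* h :+ g :* b)) refl u v g h (D g) (D h) ⟩
    u * (g * h) + v * (D g * h + g * D h)    ≈⟨ +-congˡ (*-congˡ (D-* g h)) ⟨
    u * (g * h) + v * D (g * h)              ≈⟨ eq ⟩
    1# + P * w                               ∎)

  -- The hypothesis of Dedekind's criterion at p, with g the product of the irreducible factors that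
  -- divide F modulo p with multiplicity e + 1 > 1 and gh the radical of F modulo p.
  record DedekindData (F : Carrier) : Set where
    field
      {deg deg′}     : ℕ
      e              : ℕ
      g h T          : Carrier
      monic-g        : Monic deg g
      monic-gh       : Monic deg′ (g * h)
      separable      : Separable (g * h)
      factorisation  : F ≈ g ^ suc e * h + P * T
      T⁻¹            : Carrier
      T-invertible   : T⁻¹ * T - 1# ∈⟨ + p , g ⟩

  -- q / p is killed by a monic polynomial of degree n in the sense that y ^ n ∈ z ℤ[X] + F ℤ[X]
  -- whenever y ≡ z (q / p) modulo F.
  PowerBound : ℕ → Carrier → Carrier → Set
  PowerBound n F q = ∀ z y t → z * q ≈ P * y + F * t → ∃[ u ] ∃[ v ] (y ^ n ≈ z * u + F * v)

  -- The conclusion q = p u + F v reads q / p ≡ u modulo F: the prime p leaves the denominator.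
  dedekind : ∀ {F q} n → DedekindData F → PowerBound n F q → q ∈⟨ + p , F ⟩
  dedekind {F} {q} n data′ bound = to-F (climb e ℕₚ.≤-refl)
    where
    open DedekindData data′
    F∈gh : F ∈⟨ + p , g * h ⟩
    F∈gh = T , g ^ e , trans factorisation
      (solve 5 (λ g u h p t → (g :* u) :* h :+ p :* t := p :* t :+ (g :* h) :* u) refl g (g ^ e) h P T)
    F∈g : F ∈⟨ + p , g ⟩
    F∈g = T , g ^ e * h , trans factorisation
      (solve 5 (λ g u h p t → (g :* u) :* h :+ p :* t := p :* t :+ g :* (u :* h)) refl g (g ^ e) h P T)
    base : q ∈⟨ + p , g * h ⟩
    base = reduced n monic-gh separable
      (let u , v , eq = bound P q 0# (trans (sym (+-identityʳ _)) (+-congˡ (sym (zeroʳ F))))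
       in ideal-resp (sym eq) (ideal-+ (ideal-p u) (ideal-resp (*-comm v F) (ideal-* v F∈gh))))
    climb : ∀ i → i ℕ.≤ e → q ∈⟨ + p , g ^ suc i * h ⟩
    climb zero _ = let u , v , eq = base in u , v , trans eq (+-congˡ (*-congʳ (*-congʳ (sym (*-identityʳ g)))))
    climb (suc i) i<e = s + gⁱ⁺¹ * h * r₁ , r₂ , (begin
      q                                                  ≈⟨ eq ⟩
      P * s + gⁱ⁺¹ * h * r                               ≈⟨ +-congˡ (*-congˡ r≈) ⟩
      P * s + gⁱ⁺¹ * h * (P * r₁ + g * r₂)               ≈⟨ solve 7 (λ p s u h a g b → p :* s :+ u :* h :* (p :* a :+ g :* b) := p :* (s :+ u :* h :* a) :+ g :* u :* h :* b) refl P s gⁱ⁺¹ h r₁ g r₂ ⟩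
      P * (s + gⁱ⁺¹ * h * r₁) + g * gⁱ⁺¹ * h * r₂        ∎)
      where
      gⁱ⁺¹ = g ^ suc i
      previous = climb i (ℕₚ.<⇒≤ i<e)
      s = proj₁ previous
      r = proj₁ (proj₂ previous)
      eq = proj₂ (proj₂ previous)
      -- Chosen so that z gⁱ⁺¹ = gᵉ⁺¹. As i + 1 ≤ e, the exponent j + 1 is positive and g divides z.
      j = e ℕ.∸ suc i
      z = g ^ suc j
      y = s * z - T * r
      zg≈ : z * gⁱ⁺¹ ≈ g ^ suc e
      zg≈ = trans (sym (^-homo-* g (suc j) (suc i))) (^-congʳ g (≡.cong suc (ℕₚ.m∸n+n≡m i<e)))
      zq≈ : z * q ≈ P * y + F * r
      zq≈ = begin
        z * q                                              ≈⟨ *-congˡ eq ⟩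
        z * (P * s + gⁱ⁺¹ * h * r)                         ≈⟨ solve 6 (λ z p s u h r → z :* (p :* s :+ u :* h :* r) := z :* (p :* s) :+ (z :* u) :* h :* r) refl z P s gⁱ⁺¹ h r ⟩
        z * (P * s) + (z * gⁱ⁺¹) * h * r                   ≈⟨ +-congˡ (*-congʳ (*-congʳ zg≈)) ⟩
        z * (P * s) + g ^ suc e * h * r                    ≈⟨ solve 6 (λ z p s u t r → z :* (p :* s) :+ u :* r := p :* (s :* z :- t :* r) :+ (u :+ p :* t) :* r) refl z P s (g ^ suc e * h) T r ⟩
        P * y + (g ^ suc e * h + P * T) * r                ≈⟨ +-congˡ (*-congʳ factorisation) ⟨
        P * y + F * r                                      ∎
      y∈g : y ∈⟨ + p , g ⟩
      y∈g = reduced n monic-g (separable-factor separable)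
        (let u , v , eq′ = bound z y r zq≈
         in ideal-resp (sym eq′) (ideal-+ (ideal-resp (sym (*-assoc _ _ _)) (ideal-G (g ^ j * u))) (ideal-resp (*-comm v F) (ideal-* v F∈g))))
      -- Both y and z vanish modulo (p, g), hence so does T r = s z - y, and T is a unit there.
      r∈g : r ∈⟨ + p , g ⟩
      r∈g = ideal-resp
        (solve′ T⁻¹ s g (g ^ j) T r)
        (ideal-+ (ideal-* T⁻¹ (ideal-+ (ideal-G (g ^ j * s)) (ideal-neg y∈g))) (ideal-neg (ideal-* r T-invertible)))
        where
        solve′ : ∀ w s g v t r → w * (g * (v * s) + - (s * (g * v) - t * r)) + - (r * (w * t - 1#)) ≈ r
        solve′ w s g v t r = trans (+-congˡ (-‿cong (*-congˡ (+-congˡ (-‿cong (sym ι-1))))))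
          (solve 6 (λ w s g v t r → w :* (g :* (v :* s) :+ :- (s :* (g :* v) :- t :* r)) :+ :- (r :* (w :* t :- con (+ 1))) := r) refl w s g v t r)
      r₁ = proj₁ r∈g
      r₂ = proj₁ (proj₂ r∈g)
      r≈ = proj₂ (proj₂ r∈g)
    to-F : q ∈⟨ + p , g ^ suc e * h ⟩ → q ∈⟨ + p , F ⟩
    to-F (u , v , eq) = u - T * v , v , (begin
      q                                                  ≈⟨ eq ⟩
      P * u + g ^ suc e * h * v                          ≈⟨ solve 5 (λ p u f t v → p :* u :+ f :* v := p :* (u :- t :* v) :+ (f :+ p :* t) :* v) refl P u (g ^ suc e * h) T v ⟩
      P * (u - T * v) + (g ^ suc e * h + P * T) * v      ≈⟨ +-congˡ (*-congʳ factorisation) ⟨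
      P * (u - T * v) + F * v                            ∎)

-- ℤ[X] inside ℚ[X], and integral elements modulo F

record RationalPolynomialRing : Set₁ where
  field
    algebra : ℤ-Algebra
  open Algebraic algebra
  field
    X           : Carrier
    X-free      : ∀ c f → ι c + X * f ≈ 0# → c ≡ + 0 × f ≈ 0#
    D           : Carrier → Carrier
    D-cong      : ∀ {f g} → f ≈ g → D f ≈ D g
    D-+         : ∀ f g → D (f + g) ≈ D f + D g
    D-*         : ∀ f g → D (f * g) ≈ D f * g + f * D g
    D-ι         : ∀ c → D (ι c) ≈ 0#
    D-X         : D X ≈ 1#
    fraction    : ∀ n → ∃[ v ] (ι (+ suc n) * v ≈ 1#)
    denominator : ∀ f → ∃[ n ] ∃[ k ] Pol X k (+ 0) (ι (+ suc n) * f)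

module IntegralPolynomials (Q : RationalPolynomialRing) where
  open RationalPolynomialRing Q
  open Algebraic algebra

  -- Having integer coefficients, that is membership in ℤ[X]; integrality over ℤ modulo F is
  -- `IntegralElement`.
  IsIntegral : Carrier → Set
  IsIntegral f = ∃[ k ] Pol X k (+ 0) f

  pol⇒integral : ∀ {k ε f} → Pol X k ε f → IsIntegral f
  pol⇒integral {k} p = suc k , pol-raise p

  integral-+ : ∀ {f g} → IsIntegral f → IsIntegral g → IsIntegral (f + g)
  integral-+ (j , p) (k , q) = j ℕ.⊔ k ,
    pol-+ (pol-pad (ℕₚ.≤⇒≤′ (ℕₚ.m≤m⊔n j k)) p) (pol-pad (ℕₚ.≤⇒≤′ (ℕₚ.m≤n⊔m j k)) q)

  ℤ[X]-raw : RawRing 0ℓ 0ℓ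
  ℤ[X]-raw = record
    { Carrier = ∃ IsIntegral
    ; _≈_     = λ f g → proj₁ f ≈ proj₁ g
    ; _+_     = λ (f , p) (g , q) → f + g , integral-+ p q
    ; _*_     = λ (f , j , p) (g , k , q) → f * g , j ℕ.+ k , pol-* p q
    ; -_      = λ (f , k , p) → - f , k , pol-neg p
    ; 0#      = 0# , 0 , const (sym ι-0)
    ; 1#      = 1# , pol⇒integral pol-1 }

  -- Equality in ℤ[X] is that of ℚ[X], so the first projection is injective and the ring laws pull
  -- back along it.
  ℤ[X]-ring : CommutativeRing 0ℓ 0ℓ
  ℤ[X]-ring = record
    { isCommutativeRing = RingMonomorphism.isCommutativeRing {R₁ = ℤ[X]-raw} {R₂ = rawRing} {⟦_⟧ = proj₁}
        (record
          { isRingHomomorphism = record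
            { isSemiringHomomorphism = record
              { isNearSemiringHomomorphism = record
                { +-isMonoidHomomorphism = record
                  { isMagmaHomomorphism = record { isRelHomomorphism = record { cong = λ e → e } ; homo = λ _ _ → refl }
                  ; ε-homo = refl }
                ; *-homo = λ _ _ → refl }
              ; 1#-homo = refl }
            ; -‿homo = λ _ → refl }
          ; injective = λ e → e })
        isCommutativeRing }

  ℤ[X]-algebra : ℤ-Algebra
  ℤ[X]-algebra = record
    { ring = ℤ[X]-ring
    ; unit = record
      { ⟦_⟧ = λ c → ι c , pol⇒integral (pol-ι c)
      ; +-homo = ι-+ ; *-homo = ι-* ; -‿homo = ι-neg ; 0-homo = ι-0 ; 1-homo = ι-1 } }

  X̂ : ∃ IsIntegral
  X̂ = X , pol⇒integral pol-var

  restrict : ∀ {k ε f} (f∈ : IsIntegral f) → Pol X k ε f → Algebraic.Pol ℤ[X]-algebra X̂ k ε (f , f∈)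
  restrict f∈ (const e)    = Algebraic.const e
  restrict f∈ (step c p e) = Algebraic.step {z = _ , pol⇒integral p} c (restrict (pol⇒integral p) p) e

  extend : ∀ {k ε f} → Algebraic.Pol ℤ[X]-algebra X̂ k ε f → Pol X k ε (proj₁ f)
  extend (Algebraic.const e)    = const e
  extend (Algebraic.step c p e) = step c (extend p) e

  integral-D : ∀ {k ε f} → Pol X k ε f → IsIntegral (D f)
  integral-D (const {ε = ε} e) = 0 , const (trans (D-cong e) (trans (D-ι ε) (sym ι-0)))
  integral-D {suc k} (step {y = f} {z = z} c p e) =
    let j , q = integral-+ (pol⇒integral p) (let j , q = integral-D p in suc j , pol-shift q)
    in j , pol-resp (sym (begin
      D f                            ≈⟨ D-cong e ⟩
      D (ι c + X * z)                ≈⟨ D-+ (ι c) (X * z) ⟩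
      D (ι c) + D (X * z)            ≈⟨ +-cong (D-ι c) (D-* X z) ⟩
      0# + (D X * z + X * D z)       ≈⟨ +-identityˡ _ ⟩
      D X * z + X * D z              ≈⟨ +-congʳ (trans (*-congʳ D-X) (*-identityˡ z)) ⟩
      z + X * D z                    ∎)) q

  ℤ[X] : PolynomialRing
  ℤ[X] = record
    { algebra   = ℤ[X]-algebra
    ; X         = X̂
    ; X-free    = λ c f → X-free c (proj₁ f)
    ; generated = λ (f , k , p) → k , restrict (k , p) p
    ; D         = λ (f , k , p) → D f , integral-D p
    ; D-cong    = D-cong
    ; D-+       = λ f g → D-+ (proj₁ f) (proj₁ g)
    ; D-*       = λ f g → D-* (proj₁ f) (proj₁ g)
    ; D-ι       = D-ι
    ; D-X       = D-X }

  module Z = Polynomials ℤ[X]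

  ι-cancel : ∀ {n f g} → ι (+ suc n) * f ≈ ι (+ suc n) * g → f ≈ g
  ι-cancel {n} {f} {g} e = let v , nv≈1 = fraction n in begin
    f                            ≈⟨ *-identityˡ f ⟨
    1# * f                       ≈⟨ *-congʳ nv≈1 ⟨
    (ι (+ suc n) * v) * f        ≈⟨ solve 3 (λ n v f → (n :* v) :* f := v :* (n :* f)) refl (ι (+ suc n)) v f ⟩
    v * (ι (+ suc n) * f)        ≈⟨ *-congˡ e ⟩
    v * (ι (+ suc n) * g)        ≈⟨ solve 3 (λ n v f → v :* (n :* f) := (n :* v) :* f) refl (ι (+ suc n)) v g ⟩
    (ι (+ suc n) * v) * g        ≈⟨ *-congʳ nv≈1 ⟩
    1# * g                       ≈⟨ *-identityˡ g ⟩
    g                            ∎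

  integral-resp : ∀ {f g} → f ≈ g → IsIntegral f → IsIntegral g
  integral-resp e (k , p) = k , pol-resp e p

  -- A form of Gauss's lemma. Some multiple n k is integral and n divides F · (n k); the monic F
  -- cancels, so n divides n k within ℤ[X].
  integral-quotient : ∀ {d} {F : Z.Carrier} {k} → Z.Monic d F → IsIntegral (proj₁ F * k) → IsIntegral k
  integral-quotient {F = F} {k} mon Fk∈ =
    let n , nk∈ = denominator k
        (s , s∈) , eq = Z.∣ᴾ-cancel {m = + suc n} {k = _ , nk∈} mon
          ((_ , Fk∈) , solve 3 (λ f n k → f :* (n :* k) := n :* (f :* k)) refl (proj₁ F) (ι (+ suc n)) k)
    in integral-resp (sym (ι-cancel eq)) s∈

  -- The quotient K = ℚ[X]/(F) and its integral elements

  module Quotient (F : Carrier) where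

    infix 4 _≡F_
    -- The multiplier k may have denominators: this is congruence in ℚ[X], also when f and g lie in
    -- ℤ[X].
    _≡F_ : Carrier → Carrier → Set
    f ≡F g = ∃[ k ] (f ≈ g + F * k)

    ≈⇒≡F : ∀ {f g} → f ≈ g → f ≡F g
    ≈⇒≡F {f} {g} e = 0# , trans e (trans (sym (+-identityʳ g)) (+-congˡ (sym (zeroʳ F))))

    quotient-ring : CommutativeRing 0ℓ 0ℓ
    quotient-ring = record
      { Carrier = Carrier ; _≈_ = _≡F_ ; _+_ = _+_ ; _*_ = _*_ ; -_ = -_ ; 0# = 0# ; 1# = 1#
      ; isCommutativeRing = record
        { isRing = record
          { +-isAbelianGroup = record
            { isGroup = record
              { isMonoid = record
                { isSemigroup = record
                  { isMagma = record
                    { isEquivalence = record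
                      { refl  = ≈⇒≡F refl
                      ; sym   = λ {f} {g} (k , e) → - k , trans (solve 3 (λ g f k → g := (g :+ f :* k) :+ f :* :- k) refl g F k) (+-congʳ (sym e))
                      ; trans = λ {f} {g} {h} (k , e) (l , e′) → l + k , trans e (trans (+-congʳ e′)
                          (solve 4 (λ h f k l → (h :+ f :* l) :+ f :* k := h :+ f :* (l :+ k)) refl h F k l)) }
                    ; ∙-cong = λ {f} {f′} {g} {g′} (k , e) (l , e′) → k + l , trans (+-cong e e′)
                        (solve 5 (λ f g q k l → (f :+ q :* k) :+ (g :+ q :* l) := (f :+ g) :+ q :* (k :+ l)) refl f′ g′ F k l) }
                  ; assoc = λ f g h → ≈⇒≡F (+-assoc f g h) }
                ; identity = (λ f → ≈⇒≡F (+-identityˡ f)) , (λ f → ≈⇒≡F (+-identityʳ f)) }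
              ; inverse = (λ f → ≈⇒≡F (-‿inverseˡ f)) , (λ f → ≈⇒≡F (-‿inverseʳ f))
              ; ⁻¹-cong = λ {f} {g} (k , e) → - k , trans (-‿cong e) (solve 3 (λ g f k → :- (g :+ f :* k) := :- g :+ f :* :- k) refl g F k) }
            ; comm = λ f g → ≈⇒≡F (+-comm f g) }
          ; *-cong = λ {f} {f′} {g} {g′} (k , e) (l , e′) → f′ * l + (k * g′ + F * (k * l)) , trans (*-cong e e′)
              (solve 5 (λ f g q k l → (f :+ q :* k) :* (g :+ q :* l) := f :* g :+ q :* (f :* l :+ (k :* g :+ q :* (k :* l)))) refl f′ g′ F k l)
          ; *-assoc = λ f g h → ≈⇒≡F (*-assoc f g h)
          ; *-identity = (λ f → ≈⇒≡F (*-identityˡ f)) , (λ f → ≈⇒≡F (*-identityʳ f))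
          ; distrib = (λ f g h → ≈⇒≡F (distribˡ f g h)) , (λ f g h → ≈⇒≡F (distribʳ f g h)) }
        ; *-comm = λ f g → ≈⇒≡F (*-comm f g) } }

    quotient-algebra : ℤ-Algebra
    quotient-algebra = record
      { ring = quotient-ring
      ; unit = record
        { ⟦_⟧ = ι ; +-homo = λ m n → ≈⇒≡F (ι-+ m n) ; *-homo = λ m n → ≈⇒≡F (ι-* m n)
        ; -‿homo = λ m → ≈⇒≡F (ι-neg m) ; 0-homo = ≈⇒≡F ι-0 ; 1-homo = ≈⇒≡F ι-1 } }

  module Integrality {d : ℕ} (F̂ : Z.Carrier) (monic : Z.Monic d F̂) where

    F : Carrier
    F = proj₁ F̂

    open Quotient F public
    module K = Algebraic quotient-algebra

    IntegralElement : Carrier → Set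
    IntegralElement θ = ∃[ cs ] (K.eval (cs ++ + 1 ∷ []) θ ≡F 0#)

    gens : ∀ k → Carrier → Carrier → Vec Carrier k
    gens zero    f m = []
    gens (suc k) f m = f * m ∷ gens k (X * f) m

    gens-all : ∀ (Q : Carrier → Set) {m} → (∀ {f} → IsIntegral f → Q (f * m)) →
      ∀ k {f} → IsIntegral f → VAll.All Q (gens k f m)
    gens-all Q h zero    f∈      = VAll.[]
    gens-all Q h (suc k) (j , p) = h (j , p) VAll.∷ gens-all Q h k (suc j , pol-shift p)

    -- ℤ[X, ω] is spanned modulo F by the Xⁱ and Xⁱω with i < d.
    quadratic-integral : ∀ {ω} (s t : Z.Carrier) → ω * ω ≡F proj₁ s * ω + proj₁ t → IntegralElement ω
    quadratic-integral {ω} (s , s∈) (t , t∈) ω²≡ = K.integral e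
      (K.span-resp e (K.*-identityˡ ω) (spanω (pol⇒integral pol-1)))
      (VAllₚ.lookup⁺ stable)
      where
      V : Vec Carrier (d ℕ.+ d)
      V = gens d 1# 1# Vec.++ gens d 1# ω
      e : Fin (d ℕ.+ d) → Carrier
      e = Vec.lookup V
      span-low : ∀ {k f m r} → VAll.All (K.Span e) (gens k f m) → Pol X k (+ 0) r → K.Span e (r * (f * m))
      span-low {f = f} {m} VAll.[] (const e₀) =
        K.span-resp e (≈⇒≡F (sym (trans (*-congʳ (trans e₀ ι-0)) (zeroˡ (f * m))))) (K.span-0 e)
      span-low {f = f} {m} (q VAll.∷ qs) (step {z = z} c p e₀) = K.span-resp e
        (≈⇒≡F (trans (solve 5 (λ c x z f m → c :* (f :* m) :+ z :* ((x :* f) :* m) := (c :+ x :* z) :* (f :* m)) refl (ι c) X z f m) (*-congʳ (sym e₀))))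
        (K.span-+ e (K.span-scale e c q) (span-low qs p))
      span-gens : ∀ {f m} → VAll.All (K.Span e) (gens d 1# m) → IsIntegral f → K.Span e (f * m)
      span-gens {f} {m} qs f∈ =
        -- Division by the monic F, with remainder in ℤ[X], brings every f below degree d, where the
        -- powers of X among the generators suffice.
        let (k , _) , (r , _) , low , eq = Z.divMod monic (f , f∈)
        in K.span-resp e
          (K.trans (K.*-congˡ {r} (K.*-identityˡ m)) (K.*-congʳ {m} (- k , trans (solve 2 (λ r w → r := (w :+ r) :+ :- w) refl r (F * k))
             (+-cong (sym eq) (solve 2 (λ f k → :- (f :* k) := f :* :- k) refl F k)))))
          (span-low qs (extend low))
      members : VAll.All (K.Span e) V
      members = VAllₚ.lookup⁻ (K.span-gen e)
      span1 : ∀ {f} → IsIntegral f → K.Span e (f * 1#)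
      span1 = span-gens (VAllₚ.++ˡ⁻ (gens d 1# 1#) members)
      spanω : ∀ {f} → IsIntegral f → K.Span e (f * ω)
      spanω = span-gens (VAllₚ.++ʳ⁻ (gens d 1# 1#) members)
      stable : VAll.All (λ v → K.Span e (ω * v)) V
      stable = VAllₚ.++⁺
        (gens-all _ (λ {f} f∈ → K.span-resp e (≈⇒≡F (trans (*-comm f ω) (*-congˡ (sym (*-identityʳ f))))) (spanω f∈)) d (pol⇒integral pol-1))
        (gens-all _ (λ {f} f∈ → K.span-resp e
          (K.trans (≈⇒≡F (trans (+-congˡ (*-identityʳ (f * t))) (solve 4 (λ f s t w → (f :* s) :* w :+ f :* t := f :* (s :* w :+ t)) refl f s t ω)))
          (K.trans (K.*-congˡ {f} (K.sym ω²≡))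
          (≈⇒≡F (solve 2 (λ f w → f :* (w :* w) := w :* (f :* w)) refl f ω))))
          (K.span-+ e (spanω (proj₂ ((f , f∈) Z.* (s , s∈)))) (span1 (proj₂ ((f , f∈) Z.* (t , t∈)))))) d (pol⇒integral pol-1))

    -- An element of ℤ[α] is a root of Y² - sY, so the quadratic case with t = 0 applies.
    congruent-integral : ∀ {θ} (s : Z.Carrier) → θ ≡F proj₁ s → IntegralElement θ
    congruent-integral {θ} s θ≡s = quadratic-integral s Z.0#
      (K.trans (K.*-congʳ {θ} θ≡s) (≈⇒≡F (sym (+-identityʳ (proj₁ s * θ)))))

    -- All that is retained of a monic equation of degree n for θ; for θ = q / p it becomes the
    -- `PowerBound` of Dedekind's criterion.
    Bounded : ℕ → Carrier → Set
    Bounded n θ = ∀ z y → proj₁ z * θ ≡F proj₁ y → ∃[ u ] ∃[ v ] (y Z.^ n Z.≈ z Z.* u Z.+ F̂ Z.* v)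

    Z-^ : ∀ f n → proj₁ (f Z.^ n) ≈ proj₁ f K.^ n
    Z-^ f zero    = refl
    Z-^ f (suc n) = *-congˡ (Z-^ f n)

    -- Multiplying the equation by zⁿ and replacing z θ by y leaves yⁿ + z u ≡ 0 with u in ℤ[X]. The
    -- multiplier of F is a priori rational; it is integral because F is monic.
    integral⇒bounded : ∀ {θ} ((cs , _) : IntegralElement θ) → Bounded (length cs) θ
    integral⇒bounded {θ} (cs , root) z y zθ≡y =
      let u , eq = homogenise cs
          k , eq′ = K.trans (K.sym eq) (K.trans (K.*-congˡ {proj₁ z K.^ length cs} root) (≈⇒≡F (zeroʳ _)))
          yⁿ+zu = (y Z.^ length cs) Z.+ (z Z.* u)
          k∈ = integral-quotient {k = k} monic (integral-resp (trans (+-congʳ (Z-^ y (length cs))) (trans eq′ (+-identityˡ _))) (proj₂ yⁿ+zu))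
      in Z.- u , (k , k∈) , (begin
        proj₁ (y Z.^ length cs)                                          ≈⟨ solve 3 (λ y z u → y := z :* :- u :+ (y :+ z :* u)) refl (proj₁ (y Z.^ length cs)) (proj₁ z) (proj₁ u) ⟩
        proj₁ z * - proj₁ u + (proj₁ (y Z.^ length cs) + proj₁ z * proj₁ u)  ≈⟨ +-congˡ (trans (+-congʳ (Z-^ y (length cs))) (trans eq′ (+-identityˡ _))) ⟩
        proj₁ z * - proj₁ u + F * k                                      ∎)
      where
      homogenise : ∀ cs → ∃[ u ] (proj₁ z K.^ length cs * K.eval (cs ++ + 1 ∷ []) θ ≡F proj₁ y K.^ length cs + proj₁ z * proj₁ u)
      homogenise [] = Z.0# , ≈⇒≡F (begin
        1# * (ι (+ 1) + θ * 0#)  ≈⟨ trans (*-identityˡ _) (trans (+-congˡ (zeroʳ θ)) (+-congʳ ι-1)) ⟩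
        1# + 0#                  ≈⟨ +-congˡ (zeroʳ (proj₁ z)) ⟨
        1# + proj₁ z * 0#        ∎)
      homogenise (c ∷ cs) =
        let u , eq = homogenise cs
            zⁿ = z Z.^ length cs
        in (Z.ι c Z.* zⁿ) Z.+ (y Z.* u) ,
           K.trans (≈⇒≡F (solve 5 (λ z w c t v → (z :* w) :* (c :+ t :* v) := z :* (c :* w) :+ (z :* t) :* (w :* v)) refl (proj₁ z) (proj₁ z K.^ length cs) (ι c) θ (K.eval (cs ++ + 1 ∷ []) θ)))
          (K.trans (K.+-cong (≈⇒≡F (*-congˡ (*-congˡ (sym (Z-^ z (length cs)))))) (K.*-cong zθ≡y eq))
          (≈⇒≡F (solve 6 (λ z w c y v u → z :* (c :* w) :+ y :* (v :+ z :* u) := y :* v :+ z :* (c :* w :+ y :* u)) refl (proj₁ z) (proj₁ zⁿ) (ι c) (proj₁ y) (proj₁ y K.^ length cs) (proj₁ u))))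

    -- As z (c θ) = (z c) θ, the bound for θ is used with z c. It passes from θ to the multiples of
    -- θ met while a denominator is cleared.
    bounded-* : ∀ n {θ} (c : Z.Carrier) → Bounded n θ → Bounded n (proj₁ c * θ)
    bounded-* n c b z y e =
      let u , v , eq = b (z Z.* c) y (K.trans (≈⇒≡F (*-assoc (proj₁ z) (proj₁ c) _)) e)
      in c Z.* u , v , trans eq (+-congʳ (*-assoc (proj₁ z) (proj₁ c) (proj₁ u)))

    ≡F-cancel : ∀ {n f g} → ι (+ suc n) * f ≡F ι (+ suc n) * g → f ≡F g
    ≡F-cancel {n} {f} {g} (k , e) = let v , nv≈1 = fraction n in v * k , ι-cancel (begin
      ι (+ suc n) * f                                ≈⟨ e ⟩
      ι (+ suc n) * g + F * k                        ≈⟨ +-congˡ (trans (*-congˡ (sym (*-identityˡ k))) (*-congˡ (*-congʳ (sym nv≈1)))) ⟩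
      ι (+ suc n) * g + F * ((ι (+ suc n) * v) * k)  ≈⟨ solve 5 (λ n g f v k → n :* g :+ f :* ((n :* v) :* k) := n :* (g :+ f :* (v :* k))) refl (ι (+ suc n)) g F v k ⟩
      ι (+ suc n) * (g + F * (v * k))                ∎)

    ≡F-cancel-prime : ∀ {p f g} → Prime p → ι (+ p) * f ≡F ι (+ p) * g → f ≡F g
    ≡F-cancel-prime {suc p} pr = ≡F-cancel
    ≡F-cancel-prime {zero} pr with () ← prime⇒nonZero pr

    module _ (dedekind-data : ∀ {p} (pr : Prime p) → ModuloPrime.DedekindData ℤ[X] pr F̂) where

      -- Let θ′ be θ times the product of the remaining primes. Then p θ′ ≡ q, so θ′ plays the part
      -- of q / p and inherits the bound; q = p u + F v gives θ′ ≡ u, an equation with one prime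
      -- fewer. Repeated primes do no harm.
      clear-denominator : ∀ n ps → All Prime ps → ∀ θ (q : Z.Carrier) → Bounded n θ →
        ι (+ product ps) * θ ≡F proj₁ q → ∃[ s ] (θ ≡F proj₁ {B = IsIntegral} s)
      clear-denominator n [] [] θ q b e =
        q , K.trans (≈⇒≡F (trans (sym (*-identityˡ θ)) (*-congʳ (sym ι-1)))) e
      clear-denominator n (p ∷ ps) (pr ∷ prs) θ q b e =
        let u , v , q≈ = M.dedekind {q = q} n (dedekind-data pr) bound
        in clear-denominator n ps prs θ u b (≡F-cancel-prime pr (K.trans pθ′≡ (proj₁ v , q≈)))
        where
        module M = ModuloPrime ℤ[X] pr
        θ′ = ι (+ product ps) * θ
        pθ′≡ : ι (+ p) * θ′ ≡F proj₁ q
        pθ′≡ = K.trans (≈⇒≡F (trans (sym (*-assoc _ _ θ)) (*-congʳ (trans (sym (ι-* _ _)) (ι-cong (≡.sym (ℤₚ.pos-* p (product ps)))))))) e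
        bound : M.PowerBound n F̂ q
        bound z y t eq = bounded-* n (Z.ι (+ product ps)) b z y (≡F-cancel-prime pr
          (K.trans (≈⇒≡F (solve 3 (λ p z t → p :* (z :* t) := z :* (p :* t)) refl (ι (+ p)) (proj₁ z) θ′))
          (K.trans (K.*-congˡ {proj₁ z} pθ′≡) (proj₁ t , eq))))

      integrally-closed : ∀ θ → IntegralElement θ → ∃[ s ] (θ ≡F proj₁ {B = IsIntegral} s)
      integrally-closed θ root =
        let n , nθ∈ = denominator θ
            open PrimeFactorisation (factorise (suc n)) renaming (factors to ps)
        in clear-denominator (length (proj₁ root)) ps factorsPrime θ (_ , nθ∈) (integral⇒bounded root)
             (≈⇒≡F (*-congʳ (ι-cong (≡.cong +_ (≡.sym isFactorisation)))))

    -- If ω ≡ q with q in ℤ[X], then gh is a multiple of F modulo p. Since F is monic of degree d >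
    -- deg gh, that multiple is 0, so p divides gh, whose leading coefficient is 1.
    not-integrally-closed : ∀ {p i j} {g h s t : Z.Carrier} → Prime p → Z.Monic i g → Z.Monic j h → i ℕ.+ j ℕ.< d →
      F̂ Z.≈ g Z.* g Z.* h Z.+ Z.ι (+ p) Z.* (g Z.* s) Z.+ Z.ι (+ p) Z.* Z.ι (+ p) Z.* t →
      ¬ (∀ θ → IntegralElement θ → ∃[ q ] (θ ≡F proj₁ {B = IsIntegral} q))
    not-integrally-closed {zero} pr with () ← prime⇒nonZero pr
    not-integrally-closed {suc p-1} {i} {j} {ĝ} {ĥ} {ŝ} {t̂} pr mon-g mon-h i+j<d F≈ closed = ∤1 pr p∣1
      where
      p = suc p-1
      P = ι (+ p)
      g = proj₁ ĝ
      h = proj₁ ĥ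
      s = proj₁ ŝ
      t = proj₁ t̂
      P⁻¹ = proj₁ (fraction p-1)
      PP⁻¹≈1 = proj₂ (fraction p-1)
      ω = P⁻¹ * (g * h) + s
      Pω≈ : P * ω ≈ g * h + P * s
      Pω≈ = begin
        P * (P⁻¹ * (g * h) + s)        ≈⟨ solve 4 (λ p v w s → p :* (v :* w :+ s) := (p :* v) :* w :+ p :* s) refl P P⁻¹ (g * h) s ⟩
        (P * P⁻¹) * (g * h) + P * s    ≈⟨ +-congʳ (trans (*-congʳ PP⁻¹≈1) (*-identityˡ _)) ⟩
        g * h + P * s                  ∎
      -- As g (gh + ps) = F - p²t, one has (gh + ps)² = ps (gh + ps) + h (F - p²t); division by p²
      -- gives the relation.
      ω²≡ : ω * ω ≡F s * ω + - (h * t)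
      ω²≡ = ≡F-cancel {p-1} (≡F-cancel {p-1} (h , (begin
        P * (P * (ω * ω))
          ≈⟨ solve 2 (λ p w → p :* (p :* (w :* w)) := (p :* w) :* (p :* w)) refl P ω ⟩
        (P * ω) * (P * ω)
          ≈⟨ *-cong Pω≈ Pω≈ ⟩
        (g * h + P * s) * (g * h + P * s)
          ≈⟨ solve 5 (λ g h p s t → (g :* h :+ p :* s) :* (g :* h :+ p :* s)
               := p :* (s :* (g :* h :+ p :* s) :+ :- (p :* (h :* t))) :+ (g :* g :* h :+ p :* (g :* s) :+ p :* p :* t) :* h) refl g h P s t ⟩
        P * (s * (g * h + P * s) + - (P * (h * t))) + (g * g * h + P * (g * s) + P * P * t) * h
          ≈⟨ +-cong (*-congˡ (+-congʳ (*-congˡ Pω≈))) (*-congʳ F≈) ⟨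
        P * (s * (P * ω) + - (P * (h * t))) + F * h
          ≈⟨ +-congʳ (*-congˡ (solve 4 (λ s p w v → s :* (p :* w) :+ :- (p :* v) := p :* (s :* w :+ :- v)) refl s P ω (h * t))) ⟩
        P * (P * (s * ω + - (h * t))) + F * h ∎)))
      found = closed ω (quadratic-integral ŝ (Z.- (ĥ Z.* t̂)) ω²≡)
      q̂ = proj₁ found
      q = proj₁ q̂
      k = proj₁ (proj₂ found)
      ω≈ = proj₂ (proj₂ found)
      FPk≈ : F * (P * k) ≈ g * h + P * (s - q)
      FPk≈ = begin
        F * (P * k)                  ≈⟨ solve 4 (λ f p k q → f :* (p :* k) := p :* (q :+ f :* k) :- p :* q) refl F P k q ⟩
        P * (q + F * k) - P * q      ≈⟨ +-congʳ (trans (*-congˡ (sym ω≈)) Pω≈) ⟩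
        (g * h + P * s) - P * q      ≈⟨ solve 4 (λ w p s q → (w :+ p :* s) :- p :* q := w :+ p :* (s :- q)) refl (g * h) P s q ⟩
        g * h + P * (s - q)          ∎
      gh = ĝ Z.* ĥ
      k̂ : Z.Carrier
      k̂ = P * k , integral-quotient {F = F̂} monic (integral-resp (sym FPk≈) (proj₂ (gh Z.+ Z.ι (+ p) Z.* (ŝ Z.- q̂))))
      p∣k̂ : + p Z.∣ᴾ k̂
      p∣k̂ = Z.∣ᴾ-monic {H = F̂} {l = gh} {k = k̂} monic (Z.pol-pad (ℕₚ.≤⇒≤′ i+j<d) (Z.pol-raise (Z.pol-* mon-g mon-h)))
        (ŝ Z.- q̂ , trans (+-congʳ FPk≈) (solve 2 (λ w v → (w :+ v) :- w := v) refl (g * h) (P * (s - q))))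
      p∣1 : + p ∣ + 1
      p∣1 = Z.∣ᴾ-lead (Z.pol-* mon-g mon-h) (Z.∣ᴾ-resp {f = F̂ Z.* k̂ Z.+ Z.- (Z.ι (+ p) Z.* (ŝ Z.- q̂))} {g = gh}
        (trans (+-congʳ FPk≈) (solve 2 (λ w v → (w :+ v) :- v := w) refl (g * h) (P * (s - q))))
        (Z.∣ᴾ-+ {f = F̂ Z.* k̂} {g = Z.- (Z.ι (+ p) Z.* (ŝ Z.- q̂))} (Z.∣ᴾ-* {f = k̂} F̂ p∣k̂) (Z.∣ᴾ-neg {f = Z.ι (+ p) Z.* (ŝ Z.- q̂)} (ŝ Z.- q̂ , refl))))

-- The trinomial X⁷ + aX + b

Δ : ℤ → ℤ → ℤ
Δ a b = (+ 7) ℤ.^ 7 ℤ.* b ℤ.^ 6 ℤ.+ (+ 6) ℤ.^ 6 ℤ.* a ℤ.^ 7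

F⟨_,_⟩ F′⟨_,_⟩ : ℤ → ℤ → ℤ → ℤ
F⟨ a , b ⟩ c = c ℤ.^ 7 ℤ.+ a ℤ.* c ℤ.+ b
F′⟨ a , b ⟩ c = + 7 ℤ.* c ℤ.^ 6 ℤ.+ a

module Trinomials (Z : PolynomialRing) where
  open Polynomials Z

  -- The monic polynomial with the given lower coefficients. In this form degree and derivative are
  -- computed by recursion, which supplies both for the explicit g and h below.
  horner : List ℤ → Carrier
  horner []       = ι (+ 1)
  horner (c ∷ cs) = ι c + X * horner cs

  horner-D : List ℤ → Carrier
  horner-D []       = ι (+ 0)
  horner-D (c ∷ cs) = horner cs + X * horner-D cs

  horner-monic : ∀ cs {f} → f ≈ horner cs → Monic (length cs) f
  horner-monic []       e = const e
  horner-monic (c ∷ cs) e = step c (horner-monic cs refl) e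

  D-horner : ∀ cs → D (horner cs) ≈ horner-D cs
  D-horner []       = trans (D-ι (+ 1)) (sym ι-0)
  D-horner (c ∷ cs) = begin
    D (ι c + X * horner cs)                             ≈⟨ D-+ (ι c) (X * horner cs) ⟩
    D (ι c) + D (X * horner cs)                         ≈⟨ +-cong (D-ι c) (D-* X (horner cs)) ⟩
    0# + (D X * horner cs + X * D (horner cs))          ≈⟨ +-identityˡ _ ⟩
    D X * horner cs + X * D (horner cs)                 ≈⟨ +-cong (trans (*-congʳ D-X) (*-identityˡ _)) (*-congˡ (D-horner cs)) ⟩
    horner cs + X * horner-D cs                         ∎

  trinomial : Carrier → Carrier → Carrier
  trinomial α β = X ^ 7 + α * X + β

  trinomial-cong : ∀ {α α′ β β′} → α ≈ α′ → β ≈ β′ → trinomial α β ≈ trinomial α′ β′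
  trinomial-cong e f = +-cong (+-congˡ (*-congʳ e)) f

  trinomial-horner : ∀ a b → trinomial (ι a) (ι b) ≈ horner (b ∷ a ∷ + 0 ∷ + 0 ∷ + 0 ∷ + 0 ∷ + 0 ∷ [])
  trinomial-horner a b = solve 3 (λ x a b → x :^ 7 :+ a :* x :+ b
    := b :+ x :* (a :+ x :* (con (+ 0) :+ x :* (con (+ 0) :+ x :* (con (+ 0) :+ x :* (con (+ 0) :+ x :* (con (+ 0) :+ x :* con (+ 1)))))))) refl X (ι a) (ι b)

  trinomial-monic : ∀ a b → Monic 7 (trinomial (ι a) (ι b))
  trinomial-monic a b = horner-monic (b ∷ a ∷ + 0 ∷ + 0 ∷ + 0 ∷ + 0 ∷ + 0 ∷ []) (trinomial-horner a b)

  D-trinomial : ∀ a b → D (trinomial (ι a) (ι b)) ≈ ι (+ 7) * X ^ 6 + ι a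
  D-trinomial a b = trans (trans (D-cong (trinomial-horner a b)) (D-horner (b ∷ a ∷ + 0 ∷ + 0 ∷ + 0 ∷ + 0 ∷ + 0 ∷ [])))
    (solve 2 (λ x a → (a :+ x :* (con (+ 0) :+ x :* (con (+ 0) :+ x :* (con (+ 0) :+ x :* (con (+ 0) :+ x :* (con (+ 0) :+ x :* con (+ 1))))))) :+ x :* (
       (con (+ 0) :+ x :* (con (+ 0) :+ x :* (con (+ 0) :+ x :* (con (+ 0) :+ x :* (con (+ 0) :+ x :* con (+ 1)))))) :+ x :* (
       (con (+ 0) :+ x :* (con (+ 0) :+ x :* (con (+ 0) :+ x :* (con (+ 0) :+ x :* con (+ 1))))) :+ x :* (
       (con (+ 0) :+ x :* (con (+ 0) :+ x :* (con (+ 0) :+ x :* con (+ 1)))) :+ x :* (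
       (con (+ 0) :+ x :* (con (+ 0) :+ x :* con (+ 1))) :+ x :* (
       (con (+ 0) :+ x :* con (+ 1)) :+ x :* (con (+ 1) :+ x :* con (+ 0)))))))
       := con (+ 7) :* x :^ 6 :+ a) refl X (ι a))

  -- Then F ≡ g (gh + ps) modulo p², and (gh + ps) / p is a root of Y² − sY + ht modulo F.
  record Singular (p : ℕ) (F : Carrier) : Set where
    field
      {i j}     : ℕ
      g h s t   : Carrier
      monic-g   : Monic i g
      monic-h   : Monic j h
      bound     : i ℕ.+ j ℕ.< 7
      expansion : F ≈ g * g * h + ι (+ p) * (g * s) + ι (+ p) * ι (+ p) * t

  -- (X⁷ − c⁷ − 7c⁶(X − c)) / (X − c)²
  cofactor : ℤ → Carrier
  cofactor c = horner (+ 6 ℤ.* c ℤ.^ 5 ∷ + 5 ℤ.* c ℤ.^ 4 ∷ + 4 ℤ.* c ℤ.^ 3 ∷ + 3 ℤ.* c ℤ.^ 2 ∷ + 2 ℤ.* c ∷ [])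

  cofactor-monic : ∀ c → Monic 5 (cofactor c)
  cofactor-monic c = horner-monic (+ 6 ℤ.* c ℤ.^ 5 ∷ + 5 ℤ.* c ℤ.^ 4 ∷ + 4 ℤ.* c ℤ.^ 3 ∷ + 3 ℤ.* c ℤ.^ 2 ∷ + 2 ℤ.* c ∷ []) refl

  ι-*-^ : ∀ k c n → ι (k ℤ.* c ℤ.^ n) ≈ ι k * ι c ^ n
  ι-*-^ k c n = trans (ι-* k (c ℤ.^ n)) (*-congˡ (ι-^ c n))

  ι-Δ : ∀ a b → ι (Δ a b) ≈ ι (+ 823543) * ι b ^ 6 + ι (+ 46656) * ι a ^ 7
  ι-Δ a b = trans (ι-+ _ _) (+-cong (ι-*-^ ((+ 7) ℤ.^ 7) b 6) (ι-*-^ ((+ 6) ℤ.^ 6) a 7))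

  ι-F : ∀ a b c → ι (F⟨ a , b ⟩ c) ≈ ι c ^ 7 + ι a * ι c + ι b
  ι-F a b c = trans (ι-+ _ b) (+-congʳ (trans (ι-+ _ _) (+-cong (ι-^ c 7) (ι-* a c))))

  ι-F′ : ∀ a b c → ι (F′⟨ a , b ⟩ c) ≈ ι (+ 7) * ι c ^ 6 + ι a
  ι-F′ a b c = trans (ι-+ _ a) (+-congʳ (ι-*-^ (+ 7) c 6))

  ι-6a : ∀ a n → ι ((+ 6 ℤ.* a) ℤ.^ n) ≈ (ι (+ 6) * ι a) ^ n
  ι-6a a n = trans (ι-^ _ n) (^-congˡ n (ι-* (+ 6) a))

  ι-root : ∀ a b c → ι (+ 6 ℤ.* a ℤ.* c ℤ.+ + 7 ℤ.* b) ≈ ι (+ 6) * ι a * ι c + ι (+ 7) * ι b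
  ι-root a b c = trans (ι-+ _ _) (+-cong (trans (ι-* _ c) (*-congʳ (ι-* (+ 6) a))) (ι-* (+ 7) b))

  -- At the root −7b/6a of 6aX + 7b, F and F′ take the values −bΔ/(6a)⁷ and Δ/(6a)⁶.
  ∣-F : ∀ {m} a b c → m ∣ + 6 ℤ.* a ℤ.* c ℤ.+ + 7 ℤ.* b → m ∣ (+ 6 ℤ.* a) ℤ.^ 7 ℤ.* F⟨ a , b ⟩ c ℤ.+ b ℤ.* Δ a b
  ∣-F {m} a b c d = ∣ᴾ-ι (∣ᴾ-resp (begin
      R * ι (+ 6 ℤ.* a ℤ.* c ℤ.+ + 7 ℤ.* b)
        ≈⟨ *-congˡ (ι-root a b c) ⟩
      R * (ι (+ 6) * ι a * ι c + ι (+ 7) * ι b)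
        ≈⟨ solve 3 (λ a b c → let y = con (+ 6) :* a :* c ; z = con (+ 7) :* b in
             (y :^ 6 :- y :^ 5 :* z :+ y :^ 4 :* z :^ 2 :- y :^ 3 :* z :^ 3 :+ y :^ 2 :* z :^ 4 :- y :* z :^ 5 :+ z :^ 6 :+ a :* (con (+ 6) :* a) :^ 6) :* (y :+ z)
             := (con (+ 6) :* a) :^ 7 :* (c :^ 7 :+ a :* c :+ b) :+ b :* (con (+ 823543) :* b :^ 6 :+ con (+ 46656) :* a :^ 7)) refl (ι a) (ι b) (ι c) ⟩
      (ι (+ 6) * ι a) ^ 7 * (ι c ^ 7 + ι a * ι c + ι b) + ι b * (ι (+ 823543) * ι b ^ 6 + ι (+ 46656) * ι a ^ 7)
        ≈⟨ +-cong (*-cong (ι-6a a 7) (ι-F a b c)) (*-congˡ (ι-Δ a b)) ⟨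
      ι ((+ 6 ℤ.* a) ℤ.^ 7) * ι (F⟨ a , b ⟩ c) + ι b * ι (Δ a b)
        ≈⟨ trans (ι-+ _ _) (+-cong (ι-* _ _) (ι-* _ _)) ⟨
      ι ((+ 6 ℤ.* a) ℤ.^ 7 ℤ.* F⟨ a , b ⟩ c ℤ.+ b ℤ.* Δ a b) ∎)
    (∣ᴾ-* R (∣⇒∣ᴾ d)))
    where
    y = ι (+ 6) * ι a * ι c
    z = ι (+ 7) * ι b
    -- The alternating sum is (y⁷ + z⁷) / (y + z); the last summand takes care of a c + b.
    R = y ^ 6 - y ^ 5 * z + y ^ 4 * z ^ 2 - y ^ 3 * z ^ 3 + y ^ 2 * z ^ 4 - y * z ^ 5 + z ^ 6 + ι a * (ι (+ 6) * ι a) ^ 6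

  ∣-F′ : ∀ {m} a b c → m ∣ + 6 ℤ.* a ℤ.* c ℤ.+ + 7 ℤ.* b → m ∣ Δ a b → m ∣ (+ 6 ℤ.* a) ℤ.^ 6 ℤ.* F′⟨ a , b ⟩ c
  ∣-F′ {m} a b c d e = ∣ᴾ-ι (∣ᴾ-resp (begin
      R * ι (+ 6 ℤ.* a ℤ.* c ℤ.+ + 7 ℤ.* b) + ι (Δ a b)
        ≈⟨ +-cong (*-congˡ (ι-root a b c)) (ι-Δ a b) ⟩
      R * (ι (+ 6) * ι a * ι c + ι (+ 7) * ι b) + (ι (+ 823543) * ι b ^ 6 + ι (+ 46656) * ι a ^ 7)
        ≈⟨ solve 3 (λ a b c → let y = con (+ 6) :* a :* c ; z = con (+ 7) :* b in
             (con (+ 7) :* ((y :- z) :* (y :^ 4 :+ y :^ 2 :* z :^ 2 :+ z :^ 4))) :* (y :+ z) :+ (con (+ 823543) :* b :^ 6 :+ con (+ 46656) :* a :^ 7)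
             := (con (+ 6) :* a) :^ 6 :* (con (+ 7) :* c :^ 6 :+ a)) refl (ι a) (ι b) (ι c) ⟩
      (ι (+ 6) * ι a) ^ 6 * (ι (+ 7) * ι c ^ 6 + ι a)
        ≈⟨ trans (ι-* _ _) (*-cong (ι-6a a 6) (ι-F′ a b c)) ⟨
      ι ((+ 6 ℤ.* a) ℤ.^ 6 ℤ.* F′⟨ a , b ⟩ c) ∎)
    (∣ᴾ-+ (∣ᴾ-* R (∣⇒∣ᴾ d)) (∣⇒∣ᴾ e)))
    where
    y = ι (+ 6) * ι a * ι c
    z = ι (+ 7) * ι b
    -- R (y + z) = 7 (y⁶ - z⁶), and 7 z⁶ is the first term of Δ.
    R = ι (+ 7) * ((y - z) * (y ^ 4 + y ^ 2 * z ^ 2 + z ^ 4))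

  cofactor≈ : ∀ c → cofactor c ≈ ι (+ 6) * ι c ^ 5 + X * (ι (+ 5) * ι c ^ 4 + X * (ι (+ 4) * ι c ^ 3 + X * (ι (+ 3) * ι c ^ 2 + X * (ι (+ 2) * ι c + X * ι (+ 1)))))
  cofactor≈ c = +-cong (ι-*-^ (+ 6) c 5) (*-congˡ (+-cong (ι-*-^ (+ 5) c 4) (*-congˡ (+-cong (ι-*-^ (+ 4) c 3)
    (*-congˡ (+-cong (ι-*-^ (+ 3) c 2) (*-congˡ (+-congʳ (ι-* (+ 2) c)))))))))

  linear : ℤ → Carrier
  linear c = X - ι c

  linear-monic : ∀ c → Monic 1 (linear c)
  linear-monic c = horner-monic (ℤ.- c ∷ [])
    (trans (solve 2 (λ x c → x :- c := :- c :+ x :* con (+ 1)) refl X (ι c)) (+-congʳ (sym (ι-neg c))))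

  D-linear : ∀ c → D (linear c) ≈ 1#
  D-linear c = begin
    D (X - ι c)              ≈⟨ D-+ X (- ι c) ⟩
    D X + D (- ι c)          ≈⟨ +-cong D-X (trans (D-cong (sym (ι-neg c))) (D-ι (ℤ.- c))) ⟩
    1# + 0#                  ≈⟨ +-identityʳ 1# ⟩
    1#                       ∎

  taylor : ∀ a b c → trinomial (ι a) (ι b) ≈ linear c ^ 2 * cofactor c + (ι (F′⟨ a , b ⟩ c) * linear c + ι (F⟨ a , b ⟩ c))
  taylor a b c = begin
    trinomial (ι a) (ι b)
      ≈⟨ solve 4 (λ x a b c → x :^ 7 :+ a :* x :+ b :=
           (x :- c) :^ 2 :* (con (+ 6) :* c :^ 5 :+ x :* (con (+ 5) :* c :^ 4 :+ x :* (con (+ 4) :* c :^ 3 :+ x :* (con (+ 3) :* c :^ 2 :+ x :* (con (+ 2) :* c :+ x :* con (+ 1))))))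
           :+ ((con (+ 7) :* c :^ 6 :+ a) :* (x :- c) :+ (c :^ 7 :+ a :* c :+ b))) refl X (ι a) (ι b) (ι c) ⟩
    _ ≈⟨ +-cong (*-congˡ (sym (cofactor≈ c))) (+-cong (*-congʳ (sym (ι-F′ a b c))) (sym (ι-F a b c))) ⟩
    linear c ^ 2 * cofactor c + (ι (F′⟨ a , b ⟩ c) * linear c + ι (F⟨ a , b ⟩ c)) ∎

  -- The Taylor expansion at c already has the required shape, with s = F′(c) / p and t = F(c) / p².
  singular-root : ∀ {p a b} c s t → F′⟨ a , b ⟩ c ≡ s ℤ.* + p → F⟨ a , b ⟩ c ≡ t ℤ.* (+ p ℤ.* + p) →
    Singular p (trinomial (ι a) (ι b))
  singular-root {p} {a} {b} c s t F′≡ F≡ = record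
    { g = linear c ; h = cofactor c ; s = ι s ; t = ι t
    ; monic-g = linear-monic c ; monic-h = cofactor-monic c
    ; bound = ℕ.s≤s (ℕ.s≤s (ℕ.s≤s (ℕ.s≤s (ℕ.s≤s (ℕ.s≤s (ℕ.s≤s ℕ.z≤n))))))
    ; expansion = begin
        trinomial (ι a) (ι b)
          ≈⟨ taylor a b c ⟩
        linear c ^ 2 * cofactor c + (ι (F′⟨ a , b ⟩ c) * linear c + ι (F⟨ a , b ⟩ c))
          ≈⟨ +-congˡ (+-cong (*-congʳ (trans (ι-cong F′≡) (ι-* s (+ p)))) (trans (ι-cong F≡) (trans (ι-* t _) (*-congˡ (ι-* (+ p) (+ p)))))) ⟩
        linear c ^ 2 * cofactor c + ((ι s * ι (+ p)) * linear c + ι t * (ι (+ p) * ι (+ p)))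
          ≈⟨ solve 5 (λ g h p s t → g :^ 2 :* h :+ ((s :* p) :* g :+ t :* (p :* p)) := g :* g :* h :+ p :* (g :* s) :+ p :* p :* t) refl (linear c) (cofactor c) (ι (+ p)) (ι s) (ι t) ⟩
        linear c * linear c * cofactor c + ι (+ p) * (linear c * ι s) + ι (+ p) * ι (+ p) * ι t ∎ }

  -- The obstruction that no integer c detects: F ≡ X (X² + 1)³ modulo 3, and -1 is not a square.
  -- Two of the three factors form g², the third goes into h, and s = -X³ because X (X² + 1)³ = X⁷ +
  -- X + 3X³ (X² + 1).
  singular-3 : ∀ m n → Singular 3 (trinomial (ι (+ 1 ℤ.+ m ℤ.* + 9)) (ι (n ℤ.* + 9)))
  singular-3 m n = record
    { g = ι (+ 1) + X * (ι (+ 0) + X * ι (+ 1)) ; h = X * (ι (+ 1) + X * (ι (+ 0) + X * ι (+ 1)))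
    ; s = - X ^ 3 ; t = ι m * X + ι n
    ; monic-g = horner-monic (+ 1 ∷ + 0 ∷ []) refl
    ; monic-h = pol-shift (horner-monic (+ 1 ∷ + 0 ∷ []) refl)
    ; bound = ℕ.s≤s (ℕ.s≤s (ℕ.s≤s (ℕ.s≤s (ℕ.s≤s (ℕ.s≤s ℕ.z≤n)))))
    ; expansion = trans (trinomial-cong (trans (ι-+ _ _) (+-congˡ (ι-* m (+ 9)))) (ι-* n (+ 9)))
        (solve 3 (λ x m n → let g = con (+ 1) :+ x :* (con (+ 0) :+ x :* con (+ 1)) in
          x :^ 7 :+ (con (+ 1) :+ m :* con (+ 9)) :* x :+ n :* con (+ 9)
          := g :* g :* (x :* g) :+ con (+ 3) :* (g :* (:- (x :^ 3))) :+ con (+ 3) :* con (+ 3) :* (m :* x :+ n)) refl X (ι m) (ι n)) }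

  module _ {p : ℕ} (pr : Prime p) where
    open ModuloPrime Z pr

    separable-horner : ∀ cs {G} u v w → G ≈ horner cs → u * horner cs + v * horner-D cs ≈ ι (+ 1) + P * w → Separable G
    separable-horner cs {G} u v w G≈ e = u , v , w , (begin
      u * G + v * D G                    ≈⟨ +-cong (*-congˡ G≈) (*-congˡ (trans (D-cong G≈) (D-horner cs))) ⟩
      u * horner cs + v * horner-D cs    ≈⟨ e ⟩
      ι (+ 1) + P * w                    ≈⟨ +-congʳ ι-1 ⟩
      1# + P * w                         ∎)

    invertible : ∀ {g f} u v → f ≈ ι (+ 1) + P * u + g * v → f - 1# ∈⟨ + p , g ⟩
    invertible {g} {f} u v e = u , v , (begin
      f - 1#                                      ≈⟨ +-cong e (-‿cong (sym ι-1)) ⟩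
      (ι (+ 1) + P * u + g * v) - ι (+ 1)         ≈⟨ solve 4 (λ p u g v → (con (+ 1) :+ p :* u :+ g :* v) :- con (+ 1) := p :* u :+ g :* v) refl P u g v ⟩
      P * u + g * v                               ∎)

    ι-inverse : ∀ {y m l} → y ℤ.* m ≡ + 1 ℤ.+ + p ℤ.* l → ι y * ι m ≈ ι (+ 1) + P * ι l
    ι-inverse {y} {m} {l} e = trans (sym (ι-* y m)) (trans (ι-cong e) (trans (ι-+ _ _) (+-congˡ (ι-* (+ p) l))))

    -- X F′ − 7F = −(6aX + 7b), and W is the cofactor in (6aX)⁶ − (7b)⁶ = (6aX + 7b) W.
    separable-trinomial : ∀ a b → ¬ + p ∣ Δ a b → Separable (trinomial (ι a) (ι b))
    separable-trinomial a b ¬d = let y , l , e = prime-inverse (Δ a b) pr ¬d in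
      -- -49 W F + (6⁶a⁶ + 7 W X) F′ = 7 W (X F′ - 7F) + 6⁶a⁶ F′ = Δ, and y inverts Δ modulo p.
      ι y * (ι -[1+ 48 ] * W) , ι y * (ι (+ 46656) * ι a ^ 6 + ι (+ 7) * (W * X)) , ι l , (begin
        (ι y * (ι -[1+ 48 ] * W)) * F + (ι y * (ι (+ 46656) * ι a ^ 6 + ι (+ 7) * (W * X))) * D F
          ≈⟨ +-congˡ (*-congˡ (D-trinomial a b)) ⟩
        (ι y * (ι -[1+ 48 ] * W)) * F + (ι y * (ι (+ 46656) * ι a ^ 6 + ι (+ 7) * (W * X))) * (ι (+ 7) * X ^ 6 + ι a)
          ≈⟨ identity X (ι a) (ι b) (ι y) ⟩
        ι y * (ι (+ 823543) * ι b ^ 6 + ι (+ 46656) * ι a ^ 7)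
          ≈⟨ *-congˡ (ι-Δ a b) ⟨
        ι y * ι (Δ a b)
          ≈⟨ ι-inverse e ⟩
        ι (+ 1) + P * ι l
          ≈⟨ +-congʳ ι-1 ⟩
        1# + P * ι l ∎)
      where
      F = trinomial (ι a) (ι b)
      W = (ι (+ 6) * ι a * X - ι (+ 7) * ι b) * ((ι (+ 6) * ι a * X) ^ 4 + (ι (+ 6) * ι a * X) ^ 2 * (ι (+ 7) * ι b) ^ 2 + (ι (+ 7) * ι b) ^ 4)
      identity : ∀ x a b y → let w = (ι (+ 6) * a * x - ι (+ 7) * b) * ((ι (+ 6) * a * x) ^ 4 + (ι (+ 6) * a * x) ^ 2 * (ι (+ 7) * b) ^ 2 + (ι (+ 7) * b) ^ 4) in
        (y * (ι -[1+ 48 ] * w)) * (x ^ 7 + a * x + b) + (y * (ι (+ 46656) * a ^ 6 + ι (+ 7) * (w * x))) * (ι (+ 7) * x ^ 6 + a)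
        ≈ y * (ι (+ 823543) * b ^ 6 + ι (+ 46656) * a ^ 7)
      identity = solve 4 (λ x a b y →
        let w = (con (+ 6) :* a :* x :- con (+ 7) :* b) :* ((con (+ 6) :* a :* x) :^ 4 :+ (con (+ 6) :* a :* x) :^ 2 :* (con (+ 7) :* b) :^ 2 :+ (con (+ 7) :* b) :^ 4) in
        (y :* (con -[1+ 48 ] :* w)) :* (x :^ 7 :+ a :* x :+ b) :+ (y :* (con (+ 46656) :* a :^ 6 :+ con (+ 7) :* (w :* x))) :* (con (+ 7) :* x :^ 6 :+ a)
        := y :* (con (+ 823543) :* b :^ 6 :+ con (+ 46656) :* a :^ 7)) refl

    -- With g = 1 the ideal (p, g) is the whole ring, in which even T = 0 is a unit.
    data-unramified : ∀ a b → ¬ + p ∣ Δ a b → DedekindData (trinomial (ι a) (ι b))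
    data-unramified a b ¬d = record
      { e = 0 ; g = 1# ; h = F ; T = 0# ; T⁻¹ = 0#
      ; monic-g = pol-1
      ; monic-gh = pol-resp (sym (*-identityˡ F)) (trinomial-monic a b)
      ; separable = let u , v , w , e = separable-trinomial a b ¬d in
          u , v , w , trans (+-cong (*-congˡ (*-identityˡ F)) (*-congˡ (D-cong (*-identityˡ F)))) e
      ; factorisation = sym (trans (+-cong (trans (*-congʳ (*-identityˡ 1#)) (*-identityˡ F)) (zeroʳ P)) (+-identityʳ F))
      ; T-invertible = ideal-resp (*-identityˡ _) (ideal-G (0# * 0# - 1#)) }
      where F = trinomial (ι a) (ι b)

    -- F ≡ X⁷ modulo p, and T = a′X + b′ reduces to b′ modulo X: its invertibility is Eisenstein's
    -- condition p² ∤ b.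
    data-eisenstein : ∀ a′ b′ → ¬ + p ∣ b′ → DedekindData (trinomial (ι (a′ ℤ.* + p)) (ι (b′ ℤ.* + p)))
    data-eisenstein a′ b′ ¬d = let y , l , e = prime-inverse b′ pr ¬d in record
      { e = 6 ; g = X ; h = ι (+ 1) ; T = ι a′ * X + ι b′ ; T⁻¹ = ι y
      ; monic-g = pol-var
      ; monic-gh = horner-monic (+ 0 ∷ []) X≈
      ; separable = separable-horner (+ 0 ∷ []) (ι (+ 0)) (ι (+ 1)) (ι (+ 0)) X≈
          (solve 2 (λ x p → con (+ 0) :* (con (+ 0) :+ x :* con (+ 1)) :+ con (+ 1) :* (con (+ 1) :+ x :* con (+ 0)) := con (+ 1) :+ p :* con (+ 0)) refl X P)
      ; factorisation = trans (trinomial-cong (ι-* a′ (+ p)) (ι-* b′ (+ p)))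
          (solve 4 (λ x a b p → x :^ 7 :+ (a :* p) :* x :+ b :* p := x :^ 7 :* con (+ 1) :+ p :* (a :* x :+ b)) refl X (ι a′) (ι b′) P)
      ; T-invertible = invertible (ι l) (ι y * ι a′) (begin
          ι y * (ι a′ * X + ι b′)                      ≈⟨ solve 4 (λ y a x b → y :* (a :* x :+ b) := y :* b :+ x :* (y :* a)) refl (ι y) (ι a′) X (ι b′) ⟩
          ι y * ι b′ + X * (ι y * ι a′)                ≈⟨ +-congʳ (ι-inverse e) ⟩
          ι (+ 1) + P * ι l + X * (ι y * ι a′)         ∎) }
      where
      X≈ : X * ι (+ 1) ≈ horner (+ 0 ∷ [])
      X≈ = solve 1 (λ x → x :* con (+ 1) := con (+ 0) :+ x :* con (+ 1)) refl X

    -- Modulo p, X F′ - 7F is -6a (X - c) with 6a a unit. It vanishes at every multiple root and has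
    -- only a simple zero, so c is an exact double root and the only multiple one. Modulo g, T is t
    -- = F(c) / p.
    data-double-root : ∀ {a b} c s t w → F′⟨ a , b ⟩ c ≡ s ℤ.* + p → F⟨ a , b ⟩ c ≡ t ℤ.* + p → ¬ + p ∣ t →
      + 6 ℤ.* a ℤ.* c ℤ.+ + 7 ℤ.* b ≡ w ℤ.* + p → ¬ + p ∣ + 6 ℤ.* a → DedekindData (trinomial (ι a) (ι b))
    data-double-root {a} {b} c s t w F′≡ F≡ ¬p∣t c≡ ¬p∣6a = record
      { e = 1 ; g = g ; h = h ; T = ι s * g + ι t ; T⁻¹ = ι y
      ; monic-g = linear-monic c
      ; monic-gh = pol-* (linear-monic c) (cofactor-monic c)
      ; separable = separable-gh
      ; factorisation = F≈
      ; T-invertible = invertible (ι l) (ι y * ι s) (begin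
          ι y * (ι s * g + ι t)                    ≈⟨ solve 4 (λ y s g t → y :* (s :* g :+ t) := y :* t :+ g :* (y :* s)) refl (ι y) (ι s) g (ι t) ⟩
          ι y * ι t + g * (ι y * ι s)              ≈⟨ +-congʳ (ι-inverse yt≡) ⟩
          ι (+ 1) + P * ι l + g * (ι y * ι s)      ∎) }
      where
      g = linear c
      h = cofactor c
      F = trinomial (ι a) (ι b)
      y = proj₁ (prime-inverse t pr ¬p∣t)
      l = proj₁ (proj₂ (prime-inverse t pr ¬p∣t))
      yt≡ = proj₂ (proj₂ (prime-inverse t pr ¬p∣t))
      F≈ : F ≈ g ^ 2 * h + P * (ι s * g + ι t)
      F≈ = begin
        F                                                              ≈⟨ taylor a b c ⟩
        g ^ 2 * h + (ι (F′⟨ a , b ⟩ c) * g + ι (F⟨ a , b ⟩ c))          ≈⟨ +-congˡ (+-cong (*-congʳ (trans (ι-cong F′≡) (ι-* s (+ p)))) (trans (ι-cong F≡) (ι-* t (+ p)))) ⟩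
        g ^ 2 * h + ((ι s * P) * g + ι t * P)                          ≈⟨ solve 5 (λ g h s p t → g :^ 2 :* h :+ ((s :* p) :* g :+ t :* p) := g :^ 2 :* h :+ p :* (s :* g :+ t)) refl g h (ι s) P (ι t) ⟩
        g ^ 2 * h + P * (ι s * g + ι t)                                ∎
      DF≈ : D F ≈ ι (+ 2) * (g * h) + g ^ 2 * D h + P * ι s
      DF≈ = begin
        D F
          ≈⟨ D-cong F≈ ⟩
        D (g ^ 2 * h + P * (ι s * g + ι t))
          ≈⟨ trans (D-+ _ _) (+-cong (D-* _ _) (D-* _ _)) ⟩
        (D (g ^ 2) * h + g ^ 2 * D h) + (D P * (ι s * g + ι t) + P * D (ι s * g + ι t))
          ≈⟨ +-cong (+-congʳ (*-congʳ (trans (D-^ g 1) (*-congˡ (*-congˡ (D-linear c))))))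
               (+-cong (*-congʳ (D-ι (+ p))) (*-congˡ (trans (D-+ _ _) (+-cong (trans (D-* _ _) (+-cong (*-congʳ (D-ι s)) (*-congˡ (D-linear c)))) (D-ι t))))) ⟩
        ((ι (+ 2) * (g ^ 1 * 1#)) * h + g ^ 2 * D h) + (0# * (ι s * g + ι t) + P * ((0# * g + ι s * 1#) + 0#))
          ≈⟨ +-cong (+-congʳ (*-congʳ (*-congˡ (*-congˡ (sym ι-1)))))
               (+-cong (*-congʳ (sym ι-0)) (*-congˡ (+-cong (+-cong (*-congʳ (sym ι-0)) (*-congˡ (sym ι-1))) (sym ι-0)))) ⟩
        ((ι (+ 2) * (g ^ 1 * ι (+ 1))) * h + g ^ 2 * D h) + (ι (+ 0) * (ι s * g + ι t) + P * ((ι (+ 0) * g + ι s * ι (+ 1)) + ι (+ 0)))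
          ≈⟨ solve 6 (λ g h k p s t → ((con (+ 2) :* (g :^ 1 :* con (+ 1))) :* h :+ g :^ 2 :* k) :+ (con (+ 0) :* (s :* g :+ t) :+ p :* ((con (+ 0) :* g :+ s :* con (+ 1)) :+ con (+ 0)))
               := con (+ 2) :* (g :* h) :+ g :^ 2 :* k :+ p :* s) refl g h (D h) P (ι s) (ι t) ⟩
        ι (+ 2) * (g * h) + g ^ 2 * D h + P * ι s ∎
      -- This is (X F′ - 7F) / g with F replaced by g² h, hence -6a modulo p.
      B = X * (ι (+ 2) * h + g * D h) - ι (+ 7) * (g * h)
      euler : X * D F - ι (+ 7) * F ≈ - (ι (+ 6) * ι a * g + ι w * P)
      euler = begin
        X * D F - ι (+ 7) * F
          ≈⟨ +-congʳ (*-congˡ (D-trinomial a b)) ⟩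
        X * (ι (+ 7) * X ^ 6 + ι a) - ι (+ 7) * F
          ≈⟨ solve 4 (λ x a b c → x :* (con (+ 7) :* x :^ 6 :+ a) :- con (+ 7) :* (x :^ 7 :+ a :* x :+ b)
               := :- (con (+ 6) :* a :* (x :- c) :+ (con (+ 6) :* a :* c :+ con (+ 7) :* b))) refl X (ι a) (ι b) (ι c) ⟩
        - (ι (+ 6) * ι a * g + (ι (+ 6) * ι a * ι c + ι (+ 7) * ι b))
          ≈⟨ -‿cong (+-congˡ (trans (sym (ι-root a b c)) (trans (ι-cong c≡) (ι-* w (+ p))))) ⟩
        - (ι (+ 6) * ι a * g + ι w * P) ∎
      -- Euler's relation divided by g.
      divided : + p ∣ᴾ B + ι (+ 6) * ι a
      divided = ∣ᴾ-cancel (linear-monic c) (ι (+ 7) * (ι s * g + ι t) - X * ι s - ι w , (begin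
        g * (B + ι (+ 6) * ι a)
          ≈⟨ solve 9 (λ x g h k p s t w a →
               g :* ((x :* (con (+ 2) :* h :+ g :* k) :- con (+ 7) :* (g :* h)) :+ con (+ 6) :* a)
               := (x :* (con (+ 2) :* (g :* h) :+ g :^ 2 :* k :+ p :* s) :- con (+ 7) :* (g :^ 2 :* h :+ p :* (s :* g :+ t)))
                  :+ p :* (con (+ 7) :* (s :* g :+ t) :- x :* s) :+ con (+ 6) :* a :* g) refl X g h (D h) P (ι s) (ι t) (ι w) (ι a) ⟩
        (X * (ι (+ 2) * (g * h) + g ^ 2 * D h + P * ι s) - ι (+ 7) * (g ^ 2 * h + P * (ι s * g + ι t))) + P * (ι (+ 7) * (ι s * g + ι t) - X * ι s) + ι (+ 6) * ι a * g
          ≈⟨ +-congʳ (+-congʳ (trans (+-cong (*-congˡ (sym DF≈)) (-‿cong (*-congˡ (sym F≈)))) euler)) ⟩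
        - (ι (+ 6) * ι a * g + ι w * P) + P * (ι (+ 7) * (ι s * g + ι t) - X * ι s) + ι (+ 6) * ι a * g
          ≈⟨ solve 4 (λ q w p v → :- (q :+ w :* p) :+ p :* v :+ q := p :* (v :- w)) refl (ι (+ 6) * ι a * g) (ι w) P (ι (+ 7) * (ι s * g + ι t) - X * ι s) ⟩
        P * (ι (+ 7) * (ι s * g + ι t) - X * ι s - ι w) ∎))
      m = proj₁ divided
      6a² = + 6 ℤ.* a ℤ.* (+ 6 ℤ.* a)
      inv = prime-inverse 6a² pr (λ d → ¬p∣6a (prime-∣-* (+ 6 ℤ.* a) (+ 6 ℤ.* a) pr d ¬p∣6a))
      i = ι (proj₁ inv)
      n = ι (proj₁ (proj₂ inv))
      -- L equals X h - 6a. It comes from (6a)² = (X h)² - (X h - 6a)(X h + 6a), whose last factor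
      -- is 7gh - X (gh)′ modulo p.
      L = X * h + (B - P * m)
      -- Modulo (p, gh, (gh)′) one has h² = 0 and X h = −6a, so (6a)² = 0.
      separable-gh : Separable (g * h)
      separable-gh = i * (- (X * X * D h) - ι (+ 7) * L) , i * (X * X * h + X * L) , n + i * (m * L) , (begin
        (i * (- (X * X * D h) - ι (+ 7) * L)) * (g * h) + (i * (X * X * h + X * L)) * D (g * h)
          ≈⟨ +-congˡ (*-congˡ (trans (D-* g h) (+-congʳ (trans (*-congʳ (D-linear c)) (*-identityˡ h))))) ⟩
        (i * (- (X * X * D h) - ι (+ 7) * L)) * (g * h) + (i * (X * X * h + X * L)) * (h + g * D h)
          ≈⟨ solve 7 (λ x g h k p m i → let B = x :* (con (+ 2) :* h :+ g :* k) :- con (+ 7) :* (g :* h)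
                                            L = x :* h :+ (B :- p :* m) in
               (i :* (:- (x :* x :* k) :- con (+ 7) :* L)) :* (g :* h) :+ (i :* (x :* x :* h :+ x :* L)) :* (h :+ g :* k)
               := i :* ((B :- p :* m) :* (B :- p :* m)) :+ p :* (i :* (m :* L))) refl X g h (D h) P m i ⟩
        i * ((B - P * m) * (B - P * m)) + P * (i * (m * L))
          ≈⟨ +-congʳ (*-congˡ (*-cong B-Pm≈ B-Pm≈)) ⟩
        i * (- (ι (+ 6) * ι a) * - (ι (+ 6) * ι a)) + P * (i * (m * L))
          ≈⟨ +-congʳ (*-congˡ (solve 1 (λ q → :- q :* :- q := q :* q) refl (ι (+ 6) * ι a))) ⟩
        i * ((ι (+ 6) * ι a) * (ι (+ 6) * ι a)) + P * (i * (m * L))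
          ≈⟨ +-congʳ (*-congˡ (sym (trans (ι-* _ _) (*-cong (ι-* (+ 6) a) (ι-* (+ 6) a))))) ⟩
        i * ι 6a² + P * (i * (m * L))
          ≈⟨ +-congʳ (trans (ι-inverse (proj₂ (proj₂ inv))) (+-congʳ ι-1)) ⟩
        (1# + P * n) + P * (i * (m * L))
          ≈⟨ solve 4 (λ e p n v → (e :+ p :* n) :+ p :* v := e :+ p :* (n :+ v)) refl 1# P n (i * (m * L)) ⟩
        1# + P * (n + i * (m * L)) ∎)
        where
        B-Pm≈ : B - P * m ≈ - (ι (+ 6) * ι a)
        B-Pm≈ = trans (+-congˡ (-‿cong (sym (proj₂ divided)))) (solve 2 (λ b q → b :- (b :+ q) := :- q) refl B (ι (+ 6) * ι a))

  -- F ≡ (X + b)⁷ modulo 7 by Fermat. The hypothesis, multiplied by b, rewrites the constant term so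
  -- that 7 divides F - g⁷ visibly. Modulo g, T is F(-b) / 7 = b t.
  data-7 : ∀ (pr : Prime 7) a′ b t → + 1 ≡ t ℤ.* + 7 ℤ.+ a′ ℤ.* + 7 ℤ.+ b ℤ.^ 6 → ¬ + 7 ∣ b ℤ.* t →
    ModuloPrime.DedekindData Z pr (trinomial (ι (a′ ℤ.* + 7)) (ι b))
  data-7 pr a′ b t 1≡ ¬d = let y , l , e = prime-inverse (b ℤ.* t) pr ¬d in record
    { e = 6 ; g = g ; h = ι (+ 1) ; T = g * Q + ι b * ι t ; T⁻¹ = ι y
    ; monic-g = horner-monic (b ∷ []) refl
    ; monic-gh = horner-monic (b ∷ []) g≈
    ; separable = separable-horner pr (b ∷ []) (ι (+ 0)) (ι (+ 1)) (ι (+ 0)) g≈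
        (solve 2 (λ x b → con (+ 0) :* (b :+ x :* con (+ 1)) :+ con (+ 1) :* (con (+ 1) :+ x :* con (+ 0)) := con (+ 1) :+ con (+ 7) :* con (+ 0)) refl X (ι b))
    ; factorisation = trans (trinomial-cong (ι-* a′ (+ 7)) ιb≈)
        (solve 4 (λ x b a t → let g = b :+ x :* con (+ 1) in
          x :^ 7 :+ (a :* con (+ 7)) :* x :+ b :* (t :* con (+ 7) :+ a :* con (+ 7) :+ b :^ 6)
          := g :^ 7 :* con (+ 1) :+ con (+ 7) :* (g :* (:- (b :* g :^ 5) :+ con (+ 3) :* b :^ 2 :* g :^ 4 :- con (+ 5) :* b :^ 3 :* g :^ 3
               :+ con (+ 5) :* b :^ 4 :* g :^ 2 :- con (+ 3) :* b :^ 5 :* g :+ b :^ 6 :+ a) :+ b :* t)) refl X (ι b) (ι a′) (ι t))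
    ; T-invertible = invertible pr (ι l) (ι y * Q) (begin
        ι y * (g * Q + ι b * ι t)                  ≈⟨ solve 4 (λ y g q w → y :* (g :* q :+ w) := y :* w :+ g :* (y :* q)) refl (ι y) g Q (ι b * ι t) ⟩
        ι y * (ι b * ι t) + g * (ι y * Q)          ≈⟨ +-congʳ (trans (*-congˡ (sym (ι-* b t))) (ι-inverse pr e)) ⟩
        ι (+ 1) + ι (+ 7) * ι l + g * (ι y * Q)    ∎) }
    where
    g = ι b + X * ι (+ 1)
    -- From X⁷ = (g - b)⁷: the coefficients 1, 3, 5, 5, 3, 1 are the binomial coefficients C(7, k)
    -- divided by 7.
    Q = - (ι b * g ^ 5) + ι (+ 3) * ι b ^ 2 * g ^ 4 - ι (+ 5) * ι b ^ 3 * g ^ 3 + ι (+ 5) * ι b ^ 4 * g ^ 2 - ι (+ 3) * ι b ^ 5 * g + ι b ^ 6 + ι a′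
    g≈ : g * ι (+ 1) ≈ horner (b ∷ [])
    g≈ = solve 1 (λ g → g :* con (+ 1) := g) refl g
    ιb≈ : ι b ≈ ι b * (ι t * ι (+ 7) + ι a′ * ι (+ 7) + ι b ^ 6)
    ιb≈ = begin
      ι b                                                        ≈⟨ solve 1 (λ b → b := b :* con (+ 1)) refl (ι b) ⟩
      ι b * ι (+ 1)                                              ≈⟨ *-congˡ (trans (ι-cong 1≡) (trans (ι-+ _ _) (+-cong (trans (ι-+ _ _) (+-cong (ι-* t (+ 7)) (ι-* a′ (+ 7)))) (ι-^ b 6)))) ⟩
      ι b * (ι t * ι (+ 7) + ι a′ * ι (+ 7) + ι b ^ 6)           ∎

  module _ (pr : Prime 3) (ε a′ b′ : ℤ) (ε²≡1 : ε ℤ.* ε ≡ + 1) where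

    -- ε = 1 is the case a ≡ -1 and ε = -1 the case a ≡ 1; in both F ≡ X (X² - ε)³ modulo 3. Modulo
    -- g, T is a′X + b′ with X² = ε, of norm b′² - ε a′², and its conjugate b′ - a′X yields the
    -- inverse. With ε³ in the coefficient the factorisation is an identity in ε.
    data-3 : ¬ + 3 ∣ b′ ℤ.* b′ ℤ.- ε ℤ.* (a′ ℤ.* a′) →
      ModuloPrime.DedekindData Z pr (trinomial (ι (a′ ℤ.* + 3 ℤ.- ε ℤ.^ 3)) (ι (b′ ℤ.* + 3)))
    data-3 ¬d = let y , l , e = prime-inverse _ pr ¬d in record
      { e = 2 ; g = g ; h = X ; T = ι ε * X ^ 3 * g + (ι a′ * X + ι b′) ; T⁻¹ = ι y * (ι b′ - ι a′ * X)
      ; monic-g = horner-monic (ℤ.- ε ∷ + 0 ∷ []) (+-congʳ (sym (ι-neg ε)))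
      ; monic-gh = horner-monic (+ 0 ∷ ℤ.- ε ∷ + 0 ∷ []) gX≈
      ; separable = separable-horner pr (+ 0 ∷ ℤ.- ε ∷ + 0 ∷ []) (ι (+ 0)) (- ι ε) (- (ι ε * X ^ 2)) gX≈ (begin
          ι (+ 0) * horner (+ 0 ∷ ℤ.- ε ∷ + 0 ∷ []) + - ι ε * ((ι (ℤ.- ε) + X * (ι (+ 0) + X * ι (+ 1))) + X * ((ι (+ 0) + X * ι (+ 1)) + X * (ι (+ 1) + X * ι (+ 0))))
            ≈⟨ +-congˡ (*-congˡ (+-congʳ (+-congʳ (ι-neg ε)))) ⟩
          ι (+ 0) * horner (+ 0 ∷ ℤ.- ε ∷ + 0 ∷ []) + - ι ε * ((- ι ε + X * (ι (+ 0) + X * ι (+ 1))) + X * ((ι (+ 0) + X * ι (+ 1)) + X * (ι (+ 1) + X * ι (+ 0))))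
            ≈⟨ solve 3 (λ z e x → con (+ 0) :* z :+ :- e :* ((:- e :+ x :* (con (+ 0) :+ x :* con (+ 1))) :+ x :* ((con (+ 0) :+ x :* con (+ 1)) :+ x :* (con (+ 1) :+ x :* con (+ 0))))
                 := e :* e :+ con (+ 3) :* :- (e :* x :^ 2)) refl (horner (+ 0 ∷ ℤ.- ε ∷ + 0 ∷ [])) (ι ε) X ⟩
          ι ε * ι ε + ι (+ 3) * - (ι ε * X ^ 2)
            ≈⟨ +-congʳ (trans (sym (ι-* ε ε)) (ι-cong ε²≡1)) ⟩
          ι (+ 1) + ι (+ 3) * - (ι ε * X ^ 2) ∎)
      ; factorisation = trans (trinomial-cong (trans (ι-+ _ _) (+-cong (ι-* a′ (+ 3)) (trans (ι-neg _) (-‿cong (ι-^ ε 3))))) (ι-* b′ (+ 3)))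
          (solve 4 (λ x e a b → let g = :- e :+ x :* (con (+ 0) :+ x :* con (+ 1)) in
            x :^ 7 :+ (a :* con (+ 3) :- e :^ 3) :* x :+ b :* con (+ 3)
            := g :^ 3 :* x :+ con (+ 3) :* (e :* x :^ 3 :* g :+ (a :* x :+ b))) refl X (ι ε) (ι a′) (ι b′))
      ; T-invertible = invertible pr (ι l) (ι y * ((ι b′ - ι a′ * X) * (ι ε * X ^ 3) - ι a′ * ι a′)) (begin
          (ι y * (ι b′ - ι a′ * X)) * (ι ε * X ^ 3 * g + (ι a′ * X + ι b′))
            ≈⟨ solve 5 (λ x e a b y → let g = :- e :+ x :* (con (+ 0) :+ x :* con (+ 1)) in
                 (y :* (b :- a :* x)) :* (e :* x :^ 3 :* g :+ (a :* x :+ b))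
                 := y :* (b :* b :- e :* (a :* a)) :+ g :* (y :* ((b :- a :* x) :* (e :* x :^ 3) :- a :* a))) refl X (ι ε) (ι a′) (ι b′) (ι y) ⟩
          ι y * (ι b′ * ι b′ - ι ε * (ι a′ * ι a′)) + g * (ι y * ((ι b′ - ι a′ * X) * (ι ε * X ^ 3) - ι a′ * ι a′))
            ≈⟨ +-congʳ (trans (*-congˡ (sym (trans (ι-+ _ _) (+-cong (ι-* b′ b′) (trans (ι-neg _) (-‿cong (trans (ι-* ε _) (*-congˡ (ι-* a′ a′))))))))) (ι-inverse pr e)) ⟩
          ι (+ 1) + ι (+ 3) * ι l + g * (ι y * ((ι b′ - ι a′ * X) * (ι ε * X ^ 3) - ι a′ * ι a′)) ∎) }
      where
      g = - ι ε + X * (ι (+ 0) + X * ι (+ 1))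
      gX≈ : g * X ≈ horner (+ 0 ∷ ℤ.- ε ∷ + 0 ∷ [])
      gX≈ = trans (solve 2 (λ e x → (:- e :+ x :* (con (+ 0) :+ x :* con (+ 1))) :* x := con (+ 0) :+ x :* (:- e :+ x :* (con (+ 0) :+ x :* con (+ 1)))) refl (ι ε) X)
        (+-congˡ (*-congˡ (+-congʳ (sym (ι-neg ε)))))

  module _ (pr : Prime 2) where

    private
      g = ι (+ 1) + X * (ι (+ 0) + X * (ι (+ 0) + X * ι (+ 1)))

    -- T = −X g + m X + n, where F = X⁷ + (2m − 1) X + 2n.
    data-2 : ∀ {F} m n → F ≈ trinomial (ι (+ 2) * m - ι (+ 1)) (ι (+ 2) * n) →
      ∀ T⁻¹ u v → T⁻¹ * (- (X * g) + (m * X + n)) ≈ ι (+ 1) + ι (+ 2) * u + g * v → ModuloPrime.DedekindData Z pr F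
    data-2 m n F≈ T⁻¹ u v e = record
      { e = 1 ; g = g ; h = X ; T = - (X * g) + (m * X + n) ; T⁻¹ = T⁻¹
      ; monic-g = horner-monic (+ 1 ∷ + 0 ∷ + 0 ∷ []) refl
      ; monic-gh = horner-monic (+ 0 ∷ + 1 ∷ + 0 ∷ + 0 ∷ []) gX≈
      ; separable = separable-horner pr (+ 0 ∷ + 1 ∷ + 0 ∷ + 0 ∷ []) (ι (+ 0)) (ι (+ 1)) (ι (+ 2) * X ^ 3) gX≈
          (solve 1 (λ x → let g = con (+ 1) :+ x :* (con (+ 0) :+ x :* (con (+ 0) :+ x :* con (+ 1))) in
            con (+ 0) :* (con (+ 0) :+ x :* g) :+ con (+ 1) :* (g :+ x :* ((con (+ 0) :+ x :* (con (+ 0) :+ x :* con (+ 1))) :+ x :* ((con (+ 0) :+ x :* con (+ 1)) :+ x :* (con (+ 1) :+ x :* con (+ 0)))))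
            := con (+ 1) :+ con (+ 2) :* (con (+ 2) :* x :^ 3)) refl X)
      ; factorisation = trans F≈
          (solve 3 (λ x m n → let g = con (+ 1) :+ x :* (con (+ 0) :+ x :* (con (+ 0) :+ x :* con (+ 1))) in
            x :^ 7 :+ (con (+ 2) :* m :- con (+ 1)) :* x :+ con (+ 2) :* n
            := g :^ 2 :* x :+ con (+ 2) :* (:- (x :* g) :+ (m :* x :+ n))) refl X m n)
      ; T-invertible = invertible pr u v e }
      where
      gX≈ : g * X ≈ horner (+ 0 ∷ + 1 ∷ + 0 ∷ + 0 ∷ [])
      gX≈ = solve 2 (λ g x → g :* x := con (+ 0) :+ x :* g) refl g X

    -- The coefficients of T become 2m + 2 and 2n + 1, so T ≡ 1 modulo (2, g).
    data-2-odd : ∀ m n → ModuloPrime.DedekindData Z pr (trinomial (ι (+ 3 ℤ.+ m ℤ.* + 4)) (ι (+ 2 ℤ.+ n ℤ.* + 4)))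
    data-2-odd m n = data-2 (ι (+ 2) * ι m + ι (+ 2)) (ι (+ 2) * ι n + ι (+ 1))
      (trinomial-cong
        (trans (trans (ι-+ _ _) (+-congˡ (ι-* m (+ 4)))) (solve 1 (λ m → con (+ 3) :+ m :* con (+ 4) := con (+ 2) :* (con (+ 2) :* m :+ con (+ 2)) :- con (+ 1)) refl (ι m)))
        (trans (trans (ι-+ _ _) (+-congˡ (ι-* n (+ 4)))) (solve 1 (λ n → con (+ 2) :+ n :* con (+ 4) := con (+ 2) :* (con (+ 2) :* n :+ con (+ 1))) refl (ι n))))
      (ι (+ 1)) ((ι m + ι (+ 1)) * X + ι n) (- X)
      (solve 4 (λ x g m n → con (+ 1) :* (:- (x :* g) :+ ((con (+ 2) :* m :+ con (+ 2)) :* x :+ (con (+ 2) :* n :+ con (+ 1))))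
        := con (+ 1) :+ con (+ 2) :* ((m :+ con (+ 1)) :* x :+ n) :+ g :* :- x) refl X g (ι m) (ι n))

    -- Here T ≡ X modulo (2, g), and X³ ≡ -1 modulo g makes -X² an inverse.
    data-2-even : ∀ m n → ModuloPrime.DedekindData Z pr (trinomial (ι (+ 1 ℤ.+ m ℤ.* + 4)) (ι (n ℤ.* + 4)))
    data-2-even m n = data-2 (ι (+ 2) * ι m + ι (+ 1)) (ι (+ 2) * ι n)
      (trinomial-cong
        (trans (trans (ι-+ _ _) (+-congˡ (ι-* m (+ 4)))) (solve 1 (λ m → con (+ 1) :+ m :* con (+ 4) := con (+ 2) :* (con (+ 2) :* m :+ con (+ 1)) :- con (+ 1)) refl (ι m)))
        (trans (ι-* n (+ 4)) (solve 1 (λ n → n :* con (+ 4) := con (+ 2) :* (con (+ 2) :* n)) refl (ι n))))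
      (- X ^ 2) (- (ι m * X ^ 3) - ι n * X ^ 2) (X ^ 3 - ι (+ 1))
      (solve 3 (λ x m n → let g = con (+ 1) :+ x :* (con (+ 0) :+ x :* (con (+ 0) :+ x :* con (+ 1))) in
        (:- (x :^ 2)) :* (:- (x :* g) :+ ((con (+ 2) :* m :+ con (+ 1)) :* x :+ con (+ 2) :* n))
        := con (+ 1) :+ con (+ 2) :* (:- (m :* x :^ 3) :- n :* x :^ 2) :+ g :* (x :^ 3 :- con (+ 1))) refl X (ι m) (ι n))

-- Integer congruences behind the conditions

module Arithmetic where
  open +-*-Solver using (solve; con; _:+_; _:*_; _:-_; :-_; _:^_; _:=_)

  residue : ∀ n .{{_ : ℕ.NonZero n}} x → Σ (Fin n) λ r → ∃[ q ] (x ≡ + toℕ r ℤ.+ q ℤ.* + n)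
  residue n x = fromℕ< (n%ℕd<d x n) , x /ℕ n ,
    ≡.trans (a≡a%ℕn+[a/ℕn]*n x n) (≡.cong (λ r → + r ℤ.+ (x /ℕ n) ℤ.* + n) (≡.sym (Finₚ.toℕ-fromℕ< (n%ℕd<d x n))))

  ∣-remainder : ∀ {n x} y q → n ∣ x → x ≡ y ℤ.+ q ℤ.* n → n ∣ y
  ∣-remainder {n} y q d e = ∣m+n∣m⇒∣n (≡.subst (n ∣_) (≡.trans e (ℤₚ.+-comm y (q ℤ.* n))) d) (divides q ≡.refl)

  p²≡ : ∀ p → + (p ℕ.^ 2) ≡ + p ℤ.* + p
  p²≡ p = ≡.trans (≡.cong (λ w → + (p ℕ.* w)) (ℕₚ.*-identityʳ p)) (ℤₚ.pos-* p p)

  p¹≡ : ∀ p → + (p ℕ.^ 1) ≡ + p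
  p¹≡ p = ≡.cong +_ (ℕₚ.*-identityʳ p)

  prime-cancel : ∀ {p} m n → Prime p → m ℤ.* + p ≡ n ℤ.* + p → m ≡ n
  prime-cancel {p} m n pr = ℤₚ.*-cancelʳ-≡ m n (+ p) {{prime⇒nonZero pr}}

  prime²-∣-* : ∀ {p} m n → Prime p → ¬ + p ∣ m → + p ℤ.* + p ∣ m ℤ.* n → + p ℤ.* + p ∣ n
  prime²-∣-* {p} m n pr ¬d (divides k e) with prime-∣-* m n pr (divides (k ℤ.* + p) (≡.trans e (≡.sym (ℤₚ.*-assoc k _ _)))) ¬d
  ... | divides n′ ≡.refl with prime-∣-* m n′ pr (divides k (prime-cancel _ _ pr (≡.trans (ℤₚ.*-assoc m n′ (+ p)) (≡.trans e (≡.sym (ℤₚ.*-assoc k (+ p) (+ p))))))) ¬d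
  ...   | divides n″ ≡.refl = divides n″ (ℤₚ.*-assoc n″ (+ p) (+ p))

  prime∤^ : ∀ {p} m n → Prime p → ¬ + p ∣ m → ¬ + p ∣ m ℤ.^ n
  prime∤^ m n pr ¬d d = ¬d (prime-∣-^ m n pr d)

  prime∤prime : ∀ {p q} → Prime p → Prime q → p ≢ q → ¬ + p ∣ + q
  prime∤prime pr qr p≢q d with prime⇒irreducible qr (∣⇒∣ᵤ d)
  ... | inj₁ ≡.refl = ∤1 pr (divides (+ 1) ≡.refl)
  ... | inj₂ p≡q = p≢q p≡q

  prime-2 : Prime 2
  prime-2 = from-yes (prime? 2)
  prime-3 : Prime 3
  prime-3 = from-yes (prime? 3)
  prime-7 : Prime 7
  prime-7 = from-yes (prime? 7)

  prime-∣-lincomb : ∀ {p} k l x y m n → Prime p → ¬ + p ∣ k → + p ∣ l ⊎ + p ∣ y →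
    + p ∣ k ℤ.* x ℤ.^ m ℤ.+ l ℤ.* y ℤ.^ suc n → + p ∣ x
  prime-∣-lincomb {p} k l x y m n pr p∤k p∣l⊎y d = prime-∣-^ x m pr (prime-∣-* k (x ℤ.^ m) pr
    (∣m+n∣m⇒∣n (≡.subst (+ p ∣_) (ℤₚ.+-comm (k ℤ.* x ℤ.^ m) (l ℤ.* y ℤ.^ suc n)) d) (second p∣l⊎y)) p∤k)
    where
    second : + p ∣ l ⊎ + p ∣ y → + p ∣ l ℤ.* y ℤ.^ suc n
    second (inj₁ e) = ∣m⇒∣m*n (y ℤ.^ suc n) e
    second (inj₂ e) = ∣n⇒∣m*n l (∣m⇒∣m*n (y ℤ.^ n) e)

  p∤6 : ∀ {p} → Prime p → p ≢ 2 → p ≢ 3 → ¬ + p ∣ + 6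
  p∤6 pr p≢2 p≢3 d = prime∤prime pr prime-3 p≢3 (prime-∣-* (+ 2) (+ 3) pr d (prime∤prime pr prime-2 p≢2))

  -- The alternative p ∣ 6⁶ is for p = 2 and p = 3: there Δ ≡ 7⁷b⁶, whatever a is.
  ∣Δ∧∣a⇒∣b : ∀ {p} a b → Prime p → p ≢ 7 → + p ∣ Δ a b → + p ∣ (+ 6) ℤ.^ 6 ⊎ + p ∣ a → + p ∣ b
  ∣Δ∧∣a⇒∣b a b pr p≢7 d e =
    prime-∣-lincomb ((+ 7) ℤ.^ 7) ((+ 6) ℤ.^ 6) b a 6 6 pr (prime∤^ (+ 7) 7 pr (prime∤prime pr prime-7 p≢7)) e d

  ∣Δ∧∣b⇒∣a : ∀ {p} a b → Prime p → p ≢ 2 → p ≢ 3 → + p ∣ Δ a b → + p ∣ (+ 7) ℤ.^ 7 ⊎ + p ∣ b → + p ∣ a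
  ∣Δ∧∣b⇒∣a {p} a b pr p≢2 p≢3 d e =
    prime-∣-lincomb ((+ 6) ℤ.^ 6) ((+ 7) ℤ.^ 7) a b 7 5 pr (prime∤^ (+ 6) 6 pr (p∤6 pr p≢2 p≢3)) e
      (≡.subst (+ p ∣_) (ℤₚ.+-comm ((+ 7) ℤ.^ 7 ℤ.* b ℤ.^ 6) ((+ 6) ℤ.^ 6 ℤ.* a ℤ.^ 7)) d)

  -- Newton's step y ↦ y (2 − 6a y) lifts the inverse of 6a from p to p².
  root-mod-p² : ∀ {p} a b → Prime p → ¬ + p ∣ + 6 ℤ.* a → ∃[ c ] (+ p ℤ.* + p ∣ + 6 ℤ.* a ℤ.* c ℤ.+ + 7 ℤ.* b)
  root-mod-p² {p} a b pr ¬d = let y , l , e = prime-inverse (+ 6 ℤ.* a) pr ¬d in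
    ℤ.- (+ 7 ℤ.* b) ℤ.* (y ℤ.* (+ 2 ℤ.- y ℤ.* (+ 6 ℤ.* a))) ,
    divides (+ 7 ℤ.* b ℤ.* (l ℤ.* l)) (≡.trans (newton (+ 6 ℤ.* a) (+ 7 ℤ.* b) y)
      (≡.trans (≡.cong (λ w → + 7 ℤ.* b ℤ.* ((w ℤ.- + 1) ℤ.* (w ℤ.- + 1))) e) (collect (+ 7 ℤ.* b) (+ p) l)))
    where
    newton : ∀ m z y → m ℤ.* (ℤ.- z ℤ.* (y ℤ.* (+ 2 ℤ.- y ℤ.* m))) ℤ.+ z ≡ z ℤ.* ((y ℤ.* m ℤ.- + 1) ℤ.* (y ℤ.* m ℤ.- + 1))
    newton = solve 3 (λ m z y → m :* (:- z :* (y :* (con (+ 2) :- y :* m))) :+ z := z :* ((y :* m :- con (+ 1)) :* (y :* m :- con (+ 1)))) ≡.refl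
    collect : ∀ z p l → z ℤ.* ((+ 1 ℤ.+ p ℤ.* l ℤ.- + 1) ℤ.* (+ 1 ℤ.+ p ℤ.* l ℤ.- + 1)) ≡ z ℤ.* (l ℤ.* l) ℤ.* (p ℤ.* p)
    collect = solve 3 (λ z p l → z :* ((con (+ 1) :+ p :* l :- con (+ 1)) :* (con (+ 1) :+ p :* l :- con (+ 1))) := z :* (l :* l) :* (p :* p)) ≡.refl

  square-mod-3 : ∀ x → + 3 ∣ x ⊎ ∃[ k ] (x ℤ.* x ≡ + 1 ℤ.+ k ℤ.* + 3)
  square-mod-3 x with residue 3 x
  ... | zero , q , e = inj₁ (divides q (≡.trans e (ℤₚ.+-identityˡ _)))
  ... | suc zero , q , ≡.refl = inj₂ (+ 2 ℤ.* q ℤ.+ + 3 ℤ.* q ℤ.* q , solve 1 (λ q → (con (+ 1) :+ q :* con (+ 3)) :* (con (+ 1) :+ q :* con (+ 3)) := con (+ 1) :+ (con (+ 2) :* q :+ con (+ 3) :* q :* q) :* con (+ 3)) ≡.refl q)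
  ... | suc (suc zero) , q , ≡.refl = inj₂ (+ 1 ℤ.+ + 4 ℤ.* q ℤ.+ + 3 ℤ.* q ℤ.* q , solve 1 (λ q → (con (+ 2) :+ q :* con (+ 3)) :* (con (+ 2) :+ q :* con (+ 3)) := con (+ 1) :+ (con (+ 1) :+ con (+ 4) :* q :+ con (+ 3) :* q :* q) :* con (+ 3)) ≡.refl q)

  -- Nonzero squares are 1 modulo 3, so the norm form at ε = -1 has no nontrivial zero; -1 is left
  -- visible to match `data-3`.
  sum-of-squares-mod-3 : ∀ x y → + 3 ∣ y ℤ.* y ℤ.- -[1+ 0 ] ℤ.* (x ℤ.* x) → + 3 ∣ x × + 3 ∣ y
  sum-of-squares-mod-3 x y d with square-mod-3 x | square-mod-3 y
  ... | inj₁ d₁ | inj₁ d₂ = d₁ , d₂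
  ... | inj₂ (k , e) | inj₂ (j , f) = ⊥-elim (from-no (+ 3 ∣? + 2) (∣-remainder (+ 2) (j ℤ.+ k) d
    (≡.trans (≡.cong₂ (λ u v → u ℤ.- -[1+ 0 ] ℤ.* v) f e) (solve 2 (λ j k → (con (+ 1) :+ j :* con (+ 3)) :- con -[1+ 0 ] :* (con (+ 1) :+ k :* con (+ 3)) := con (+ 2) :+ (j :+ k) :* con (+ 3)) ≡.refl j k))))
  ... | inj₁ (divides u ≡.refl) | inj₂ (j , f) = ⊥-elim (from-no (+ 3 ∣? + 1) (∣-remainder (+ 1) (j ℤ.+ u ℤ.* u ℤ.* + 3) d
    (≡.trans (≡.cong (λ w → w ℤ.- -[1+ 0 ] ℤ.* (u ℤ.* + 3 ℤ.* (u ℤ.* + 3))) f) (solve 2 (λ j u → (con (+ 1) :+ j :* con (+ 3)) :- con -[1+ 0 ] :* (u :* con (+ 3) :* (u :* con (+ 3))) := con (+ 1) :+ (j :+ u :* u :* con (+ 3)) :* con (+ 3)) ≡.refl j u))))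
  ... | inj₂ (k , e) | inj₁ (divides u ≡.refl) = ⊥-elim (from-no (+ 3 ∣? + 1) (∣-remainder (+ 1) (k ℤ.+ u ℤ.* u ℤ.* + 3) d
    (≡.trans (≡.cong (λ w → u ℤ.* + 3 ℤ.* (u ℤ.* + 3) ℤ.- -[1+ 0 ] ℤ.* w) e) (solve 2 (λ k u → u :* con (+ 3) :* (u :* con (+ 3)) :- con -[1+ 0 ] :* (con (+ 1) :+ k :* con (+ 3)) := con (+ 1) :+ (k :+ u :* u :* con (+ 3)) :* con (+ 3)) ≡.refl k u))))

  -- At ε = 1 the norm form splits into two linear factors, whence the two valuations in condition
  -- (3).
  difference-of-squares-∤ : ∀ {p} x y → Prime p → ¬ + p ∣ y ℤ.+ x → ¬ + p ∣ y ℤ.- x → ¬ + p ∣ y ℤ.* y ℤ.- + 1 ℤ.* (x ℤ.* x)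
  difference-of-squares-∤ {p} x y pr ¬d ¬e d = ¬e (prime-∣-* (y ℤ.+ x) (y ℤ.- x) pr
    (≡.subst (+ p ∣_) (solve 2 (λ y x → y :* y :- con (+ 1) :* (x :* x) := (y :+ x) :* (y :- x)) ≡.refl y x) d) ¬d)

  -≡⇒≡+ : ∀ x y {z} → x ℤ.- y ≡ z → x ≡ y ℤ.+ z
  -≡⇒≡+ x y ≡.refl = solve 2 (λ x y → x := y :+ (x :- y)) ≡.refl x y

  ∣-^ : ∀ {n} x y k → n ∣ x ℤ.- y → n ∣ x ℤ.^ k ℤ.- y ℤ.^ k
  ∣-^ x y zero d = divides (+ 0) ≡.refl
  ∣-^ {n} x y (suc k) d = ≡.subst (n ∣_) (regroup x y (x ℤ.^ k) (y ℤ.^ k))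
    (∣m∣n⇒∣m+n (∣n⇒∣m*n x (∣-^ x y k d)) (∣m⇒∣m*n (y ℤ.^ k) d))
    where
    regroup : ∀ x y u v → x ℤ.* (u ℤ.- v) ℤ.+ (x ℤ.- y) ℤ.* v ≡ x ℤ.* u ℤ.- y ℤ.* v
    regroup = solve 4 (λ x y u v → x :* (u :- v) :+ (x :- y) :* v := x :* u :- y :* v) ≡.refl

  fermat-7 : ∀ b → ¬ + 7 ∣ b → + 7 ∣ b ℤ.^ 6 ℤ.- + 1
  fermat-7 b 7∤b = from-residue (residue 7 b)
    where
    reduce : ∀ r q → b ≡ r ℤ.+ q ℤ.* + 7 → + 7 ∣ r ℤ.^ 6 ℤ.- + 1 → + 7 ∣ b ℤ.^ 6 ℤ.- + 1
    reduce r q e d = ≡.subst (+ 7 ∣_) (telescope (b ℤ.^ 6) (r ℤ.^ 6) (+ 1))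
      (∣m∣n⇒∣m+n (∣-^ b r 6 (divides q (≡.trans (≡.cong (ℤ._- r) e) (cancel r (q ℤ.* + 7))))) d)
      where
      telescope : ∀ x y z → (x ℤ.- y) ℤ.+ (y ℤ.- z) ≡ x ℤ.- z
      telescope = solve 3 (λ x y z → (x :- y) :+ (y :- z) := x :- z) ≡.refl
      cancel : ∀ r w → r ℤ.+ w ℤ.- r ≡ w
      cancel = solve 2 (λ r w → r :+ w :- r := w) ≡.refl
    from-residue : (Σ (Fin 7) λ r → ∃[ q ] (b ≡ + toℕ r ℤ.+ q ℤ.* + 7)) → + 7 ∣ b ℤ.^ 6 ℤ.- + 1
    from-residue (zero , q , e) = ⊥-elim (7∤b (divides q (≡.trans e (ℤₚ.+-identityˡ _))))
    -- The witnesses are (r⁶ - 1) / 7.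
    from-residue (suc zero , q , e) = reduce (+ 1) q e (divides (+ 0) ≡.refl)
    from-residue (suc (suc zero) , q , e) = reduce (+ 2) q e (divides (+ 9) ≡.refl)
    from-residue (suc (suc (suc zero)) , q , e) = reduce (+ 3) q e (divides (+ 104) ≡.refl)
    from-residue (suc (suc (suc (suc zero))) , q , e) = reduce (+ 4) q e (divides (+ 585) ≡.refl)
    from-residue (suc (suc (suc (suc (suc zero)))) , q , e) = reduce (+ 5) q e (divides (+ 2232) ≡.refl)
    from-residue (suc (suc (suc (suc (suc (suc zero))))) , q , e) = reduce (+ 6) q e (divides (+ 6665) ≡.refl)

  -- Equivalence of the conditions with the local criteria

  module Criterion (Z : PolynomialRing) (a b : ℤ) where
    open Trinomials Z
    open Polynomials Z using (ι)

    F : Polynomials.Carrier Z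
    F = trinomial (ι a) (ι b)

    module _ {p} (pr : Prime p) where

      transport : ∀ {a′ b′} → a ≡ a′ → b ≡ b′ →
        ModuloPrime.DedekindData Z pr (trinomial (ι a′) (ι b′)) → ModuloPrime.DedekindData Z pr F
      transport ≡.refl ≡.refl d = d

      data-1 : + p ∣ a → + p ∣ b → νEq p 1 b → ModuloPrime.DedekindData Z pr F
      data-1 (divides a′ a≡) (divides b′ b≡) (_ , ¬p²) = transport a≡ b≡ (data-eisenstein pr a′ b′
        (λ { (divides b″ ≡.refl) → ¬p² (∣⇒∣ᵤ (divides b″ (≡.trans b≡ (≡.trans (ℤₚ.*-assoc b″ (+ p) (+ p)) (≡.cong (b″ ℤ.*_) (≡.sym (p²≡ p))))))) }))

      -- c agrees with -7b/6a modulo p², so (6a)⁷ F(c) ≡ -b Δ modulo p². As p ∤ b, p² ∣ F(c) would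
      -- force p² ∣ Δ.
      data-6 : + p ∣ Δ a b → ¬ + p ∣ + 6 ℤ.* a → ¬ + p ∣ b → νLe p 1 (Δ a b) → ModuloPrime.DedekindData Z pr F
      data-6 p∣Δ ¬p∣6a ¬p∣b ¬p²∣Δ =
        data-double-root pr c (quotient p∣F′) (quotient p∣F) (w ℤ.* + p) (_∣_.equality p∣F′) (_∣_.equality p∣F) ¬p∣t
          (≡.trans c≡ (≡.sym (ℤₚ.*-assoc w _ _))) ¬p∣6a
        where
        open ℤᵈ using (quotient)
        c = proj₁ (root-mod-p² a b pr ¬p∣6a)
        p²∣ = proj₂ (root-mod-p² a b pr ¬p∣6a)
        w = quotient p²∣
        c≡ = _∣_.equality p²∣
        p∣ : + p ∣ + 6 ℤ.* a ℤ.* c ℤ.+ + 7 ℤ.* b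
        p∣ = divides (w ℤ.* + p) (≡.trans c≡ (≡.sym (ℤₚ.*-assoc w _ _)))
        p∣F′ : + p ∣ F′⟨ a , b ⟩ c
        p∣F′ = prime-∣-* _ _ pr (∣-F′ a b c p∣ p∣Δ) (prime∤^ _ 6 pr ¬p∣6a)
        p∣F : + p ∣ F⟨ a , b ⟩ c
        p∣F = prime-∣-* _ _ pr
          (∣m+n∣m⇒∣n (≡.subst (+ p ∣_) (ℤₚ.+-comm ((+ 6 ℤ.* a) ℤ.^ 7 ℤ.* F⟨ a , b ⟩ c) _) (∣-F a b c p∣)) (∣n⇒∣m*n b p∣Δ))
          (prime∤^ _ 7 pr ¬p∣6a)
        ¬p∣t : ¬ + p ∣ quotient p∣F
        ¬p∣t (divides t′ t≡) = ¬p²∣Δ (∣⇒∣ᵤ (≡.subst (_∣ Δ a b) (≡.sym (p²≡ p)) (prime²-∣-* b (Δ a b) pr ¬p∣b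
          (∣m+n∣m⇒∣n (∣-F a b c p²∣) (∣n⇒∣m*n ((+ 6 ℤ.* a) ℤ.^ 7)
            (divides t′ (≡.trans (_∣_.equality p∣F) (≡.trans (≡.cong (ℤ._* + p) t≡) (ℤₚ.*-assoc t′ (+ p) (+ p))))))))))

    data-at-2 : (pr : Prime 2) → Cond2 a b → + 2 ∣ b → ¬ + 2 ∣ a → ModuloPrime.DedekindData Z pr F
    data-at-2 pr c₂ 2∣b 2∤a with c₂ (∣⇒∣ᵤ 2∣b) (λ d → 2∤a (∣ᵤ⇒∣ d))
    ... | inj₁ (d , e) with ∣ᵤ⇒∣ {+ 4} {a ℤ.- + 3} d | ∣ᵤ⇒∣ {+ 4} {b ℤ.- + 2} e
    ...   | divides m a≡ | divides n b≡ = transport pr (-≡⇒≡+ a (+ 3) a≡) (-≡⇒≡+ b (+ 2) b≡) (data-2-odd pr m n)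
    data-at-2 pr c₂ 2∣b 2∤a | inj₂ (d , e) with ∣ᵤ⇒∣ {+ 4} {a ℤ.- + 1} d | ∣ᵤ⇒∣ {+ 4} {b ℤ.- + 0} e
    ...   | divides m a≡ | divides n b≡ = transport pr (-≡⇒≡+ a (+ 1) a≡) (≡.trans (≡.sym (ℤₚ.+-identityʳ b)) b≡) (data-2-even pr m n)

    data-at-3 : (pr : Prime 3) → Cond3 a b → Cond4 a b → + 3 ∣ b → ¬ + 3 ∣ a → ModuloPrime.DedekindData Z pr F
    data-at-3 pr c₃ c₄ 3∣b@(divides b′ b≡) 3∤a with residue 3 a
    ... | zero , q , e = ⊥-elim (3∤a (divides q (≡.trans e (ℤₚ.+-identityˡ _))))
    ... | suc zero , q , e = transport pr (≡.trans e (ℤₚ.+-comm (+ 1) (q ℤ.* + 3))) b≡ (data-3 pr -[1+ 0 ] q b′ ≡.refl ¬3∣)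
      where
      3∣a-1 : + 3 ∣ a ℤ.- + 1
      3∣a-1 = divides q (≡.trans (≡.cong (ℤ._- + 1) e) (solve 1 (λ q → con (+ 1) :+ q :* con (+ 3) :- con (+ 1) := q :* con (+ 3)) ≡.refl q))
      ¬3∣ : ¬ + 3 ∣ b′ ℤ.* b′ ℤ.- -[1+ 0 ] ℤ.* (q ℤ.* q)
      ¬3∣ d with sum-of-squares-mod-3 q b′ d | c₄ (∣⇒∣ᵤ 3∣b) (∣⇒∣ᵤ 3∣a-1)
      -- 3 ∣ q means a ≡ 1 modulo 9, which excludes the residues 4 and 7.
      ... | divides j ≡.refl , _ | inj₁ d₉ = from-no (+ 9 ∣? -[1+ 2 ]) (∣-remainder -[1+ 2 ] j (∣ᵤ⇒∣ d₉)
        (≡.trans (≡.cong (ℤ._- + 4) e) (solve 1 (λ j → con (+ 1) :+ j :* con (+ 3) :* con (+ 3) :- con (+ 4) := con -[1+ 2 ] :+ j :* con (+ 9)) ≡.refl j)))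
      ... | divides j ≡.refl , _ | inj₂ (inj₁ d₉) = from-no (+ 9 ∣? -[1+ 5 ]) (∣-remainder -[1+ 5 ] j (∣ᵤ⇒∣ d₉)
        (≡.trans (≡.cong (ℤ._- + 7) e) (solve 1 (λ j → con (+ 1) :+ j :* con (+ 3) :* con (+ 3) :- con (+ 7) := con -[1+ 5 ] :+ j :* con (+ 9)) ≡.refl j)))
      ... | _ , divides k ≡.refl | inj₂ (inj₂ (_ , ¬9∣b)) = ¬9∣b (∣⇒∣ᵤ (divides k (≡.trans b≡ (ℤₚ.*-assoc k (+ 3) (+ 3)))))
    ... | suc (suc zero) , q , e = transport pr a≡ b≡ (data-3 pr (+ 1) a′ b′ ≡.refl ¬3∣)
      where
      a′ = q ℤ.+ + 1
      a≡ : a ≡ a′ ℤ.* + 3 ℤ.- + 1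
      a≡ = ≡.trans e (solve 1 (λ q → con (+ 2) :+ q :* con (+ 3) := (q :+ con (+ 1)) :* con (+ 3) :- con (+ 1)) ≡.refl q)
      3∣a+1 : + 3 ∣ a ℤ.- -[1+ 0 ]
      3∣a+1 = divides a′ (≡.trans (≡.cong (ℤ._- -[1+ 0 ]) a≡) (solve 1 (λ w → w :- con (+ 1) :- con -[1+ 0 ] := w) ≡.refl (a′ ℤ.* + 3)))
      both = c₃ (∣⇒∣ᵤ 3∣b) (∣⇒∣ᵤ 3∣a+1)
      ¬3∣ : ¬ + 3 ∣ b′ ℤ.* b′ ℤ.- + 1 ℤ.* (a′ ℤ.* a′)
      -- b + 1 + a = 3 (b′ + a′) and b - 1 - a = 3 (b′ - a′), so condition (3) says that 3 divides
      -- neither b′ + a′ nor b′ - a′.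
      ¬3∣ = difference-of-squares-∤ a′ b′ pr
        (λ (divides k f) → proj₂ (proj₁ both) (∣⇒∣ᵤ (divides k (≡.trans (≡.cong₂ (λ u v → u ℤ.+ + 1 ℤ.+ v) b≡ a≡) (≡.trans (sum-3 b′ a′)
          (≡.trans (≡.cong (ℤ._* + 3) f) (ℤₚ.*-assoc k (+ 3) (+ 3))))))))
        (λ (divides k f) → proj₂ (proj₂ both) (∣⇒∣ᵤ (divides k (≡.trans (≡.cong₂ (λ u v → u ℤ.- + 1 ℤ.- v) b≡ a≡) (≡.trans (difference-3 b′ a′)
          (≡.trans (≡.cong (ℤ._* + 3) f) (ℤₚ.*-assoc k (+ 3) (+ 3))))))))
        where
        sum-3 : ∀ b a → b ℤ.* + 3 ℤ.+ + 1 ℤ.+ (a ℤ.* + 3 ℤ.- + 1) ≡ (b ℤ.+ a) ℤ.* + 3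
        sum-3 = solve 2 (λ b a → b :* con (+ 3) :+ con (+ 1) :+ (a :* con (+ 3) :- con (+ 1)) := (b :+ a) :* con (+ 3)) ≡.refl
        difference-3 : ∀ b a → b ℤ.* + 3 ℤ.- + 1 ℤ.- (a ℤ.* + 3 ℤ.- + 1) ≡ (b ℤ.- a) ℤ.* + 3
        difference-3 = solve 2 (λ b a → b :* con (+ 3) :- con (+ 1) :- (a :* con (+ 3) :- con (+ 1)) := (b :- a) :* con (+ 3)) ≡.refl

    data-at-7 : (pr : Prime 7) → Cond5 a b → + 7 ∣ a → ¬ + 7 ∣ b → ModuloPrime.DedekindData Z pr F
    data-at-7 pr c₅ 7∣a@(divides a′ a≡) 7∤b with c₅ (∣⇒∣ᵤ 7∣a) (λ d → 7∤b (∣ᵤ⇒∣ d))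
    ... | d , ¬49 with ∣ᵤ⇒∣ {+ 7} {+ 1 ℤ.- a ℤ.- b ℤ.^ 6} d
    ...   | divides t e = transport pr a≡ ≡.refl (data-7 pr a′ b t
      (≡.trans (regroup (+ 1) a (b ℤ.^ 6)) (≡.cong₂ (λ u v → u ℤ.+ v ℤ.+ b ℤ.^ 6) e a≡))
      λ 7∣bt → 7∤t (prime-∣-* b t pr 7∣bt 7∤b))
      where
      regroup : ∀ o a w → o ≡ (o ℤ.- a ℤ.- w) ℤ.+ a ℤ.+ w
      regroup = solve 3 (λ o a w → o := (o :- a :- w) :+ a :+ w) ≡.refl
      7∤t : ¬ + 7 ∣ t
      7∤t (divides u ≡.refl) = ¬49 (∣⇒∣ᵤ (divides u (≡.trans e (ℤₚ.*-assoc u (+ 7) (+ 7)))))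

    -- A prime p ∣ Δ ties a to b: p ∣ a forces p ∣ b unless p = 7, p = 2 and p = 3 force p ∣ b, and
    -- p = 7 forces p ∣ a. What is left is p ∤ 6ab, the case of one double root.
    conditions⇒data : Cond1 a b → Cond2 a b → Cond3 a b → Cond4 a b → Cond5 a b → Cond6 a b →
      ∀ {p} (pr : Prime p) → ModuloPrime.DedekindData Z pr F
    conditions⇒data c₁ c₂ c₃ c₄ c₅ c₆ {p} pr = split (+ p ∣? Δ a b) (+ p ∣? a) (+ p ∣? b) (p ℕ.≟ 2) (p ℕ.≟ 3) (p ℕ.≟ 7)
      where
      split : Dec (+ p ∣ Δ a b) → Dec (+ p ∣ a) → Dec (+ p ∣ b) → Dec (p ≡ 2) → Dec (p ≡ 3) → Dec (p ≡ 7) →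
        ModuloPrime.DedekindData Z pr F
      split (no p∤Δ) _ _ _ _ _ = data-unramified pr a b p∤Δ
      split (yes p∣Δ) (yes p∣a) (yes p∣b) _ _ _ = data-1 pr p∣a p∣b (c₁ p pr (∣⇒∣ᵤ p∣a) (∣⇒∣ᵤ p∣b))
      split (yes p∣Δ) (yes p∣a) (no p∤b) _ _ (yes ≡.refl) = data-at-7 pr c₅ p∣a p∤b
      split (yes p∣Δ) (yes p∣a) (no p∤b) _ _ (no p≢7) = ⊥-elim (p∤b (∣Δ∧∣a⇒∣b a b pr p≢7 p∣Δ (inj₂ p∣a)))
      split (yes p∣Δ) (no p∤a) _ (yes ≡.refl) _ _ =
        -- 23328 = 6⁶ / 2; likewise 15552 = 6⁶ / 3 and 117649 = 7⁷ / 7 below.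
        data-at-2 pr c₂ (∣Δ∧∣a⇒∣b a b pr (λ ()) p∣Δ (inj₁ (divides (+ 23328) ≡.refl))) p∤a
      split (yes p∣Δ) (no p∤a) _ (no _) (yes ≡.refl) _ =
        data-at-3 pr c₃ c₄ (∣Δ∧∣a⇒∣b a b pr (λ ()) p∣Δ (inj₁ (divides (+ 15552) ≡.refl))) p∤a
      split (yes p∣Δ) (no p∤a) _ (no p≢2) (no p≢3) (yes ≡.refl) =
        ⊥-elim (p∤a (∣Δ∧∣b⇒∣a a b pr p≢2 p≢3 p∣Δ (inj₁ (divides (+ 117649) ≡.refl))))
      split (yes p∣Δ) (no p∤a) _ (no p≢2) (no p≢3) (no p≢7) = data-6 pr p∣Δ
        (λ d → p∤a (prime-∣-* (+ 6) a pr d (p∤6 pr p≢2 p≢3)))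
        (λ d → p∤a (∣Δ∧∣b⇒∣a a b pr p≢2 p≢3 p∣Δ (inj₂ d)))
        (c₆ p pr p≢2 p≢3 p≢7 (λ (d , _) → p∤a (∣ᵤ⇒∣ d)))

    module _ (nonsingular : ∀ {p} → Prime p → ¬ Singular p F) where

      -- All conditions but (4) are instances of this: c = 0 for (1), 1 for (2), ±1 for (3), -b for
      -- (5), and -7b/6a modulo p² for (6).
      singular-at : ∀ {p} → Prime p → ∀ c → + p ∣ F′⟨ a , b ⟩ c → ¬ + p ℤ.* + p ∣ F⟨ a , b ⟩ c
      singular-at pr c (divides s s≡) (divides t t≡) = nonsingular pr (singular-root c s t s≡ t≡)

      F-0 : F⟨ a , b ⟩ (+ 0) ≡ b
      F-0 = ≡.trans (≡.cong (λ w → + 0 ℤ.+ w ℤ.+ b) (ℤₚ.*-zeroʳ a)) (ℤₚ.+-identityˡ b)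

      F-1 : F⟨ a , b ⟩ (+ 1) ≡ b ℤ.+ + 1 ℤ.+ a
      F-1 = lemma a b
        where
        lemma : ∀ a b → + 1 ℤ.+ a ℤ.* + 1 ℤ.+ b ≡ b ℤ.+ + 1 ℤ.+ a
        lemma = solve 2 (λ a b → con (+ 1) :+ a :* con (+ 1) :+ b := b :+ con (+ 1) :+ a) ≡.refl

      F-[-1] : F⟨ a , b ⟩ -[1+ 0 ] ≡ b ℤ.- + 1 ℤ.- a
      F-[-1] = lemma a b
        where
        lemma : ∀ a b → -[1+ 0 ] ℤ.+ a ℤ.* -[1+ 0 ] ℤ.+ b ≡ b ℤ.- + 1 ℤ.- a
        lemma = solve 2 (λ a b → con -[1+ 0 ] :+ a :* con -[1+ 0 ] :+ b := b :- con (+ 1) :- a) ≡.refl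

      cond1 : Cond1 a b
      cond1 p pr p∣a p∣b = ≡.subst (λ w → ℤ.∣ w ∣ ℕᵈ.∣ ℤ.∣ b ∣) (≡.sym (p¹≡ p)) p∣b , λ p²∣b →
        singular-at pr (+ 0) (≡.subst (+ p ∣_) (≡.sym (ℤₚ.+-identityˡ a)) (∣ᵤ⇒∣ p∣a))
          (≡.subst₂ _∣_ (p²≡ p) (≡.sym F-0) (∣ᵤ⇒∣ p²∣b))

      4∤F-1 : + 2 ∣ + 7 ℤ.+ a → ¬ + 4 ∣ b ℤ.+ + 1 ℤ.+ a
      4∤F-1 2∣ 4∣ = singular-at prime-2 (+ 1) 2∣ (≡.subst (+ 4 ∣_) (≡.sym F-1) 4∣)

      -- For a odd and b even the excluded pairs (a, b) modulo 4 are (1, 2) and (3, 0), exactly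
      -- those with 4 ∣ a + b + 1 = F(1); F′(1) = 7 + a is even anyway.
      cond2 : Cond2 a b
      cond2 2∣b 2∤a = split (residue 4 a) (residue 4 b)
        where
        even-a : ∀ x q → a ≡ x ℤ.* + 2 ℤ.+ q ℤ.* + 4 → ⊥
        even-a x q e = 2∤a (∣⇒∣ᵤ (divides (x ℤ.+ q ℤ.* + 2) (≡.trans e (lemma x q))))
          where
          lemma : ∀ x q → x ℤ.* + 2 ℤ.+ q ℤ.* + 4 ≡ (x ℤ.+ q ℤ.* + 2) ℤ.* + 2
          lemma = solve 2 (λ x q → x :* con (+ 2) :+ q :* con (+ 4) := (x :+ q :* con (+ 2)) :* con (+ 2)) ≡.refl
        odd-b : ∀ x q → ¬ + 2 ∣ x → b ≡ x ℤ.+ q ℤ.* + 4 → ⊥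
        odd-b x q ¬d e = ¬d (∣-remainder x (q ℤ.* + 2) (∣ᵤ⇒∣ 2∣b) (≡.trans e (≡.cong (λ w → x ℤ.+ w) (≡.sym (ℤₚ.*-assoc q (+ 2) (+ 2))))))
        mod-4 : ∀ {y} x q → y ≡ x ℤ.+ q ℤ.* + 4 → ModEq 4 y x
        mod-4 x q e = ∣⇒∣ᵤ (divides q (≡.trans (≡.cong (ℤ._- x) e) (lemma x (q ℤ.* + 4))))
          where
          lemma : ∀ x w → x ℤ.+ w ℤ.- x ≡ w
          lemma = solve 2 (λ x w → x :+ w :- x := w) ≡.refl
        2∣7+a : ∀ q k → a ≡ + 1 ℤ.+ k ℤ.* + 2 ℤ.+ q ℤ.* + 4 → + 2 ∣ + 7 ℤ.+ a
        2∣7+a q k e = divides (+ 4 ℤ.+ k ℤ.+ q ℤ.* + 2) (≡.trans (≡.cong (λ w → + 7 ℤ.+ w) e) (lemma q k))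
          where
          lemma : ∀ q k → + 7 ℤ.+ (+ 1 ℤ.+ k ℤ.* + 2 ℤ.+ q ℤ.* + 4) ≡ (+ 4 ℤ.+ k ℤ.+ q ℤ.* + 2) ℤ.* + 2
          lemma = solve 2 (λ q k → con (+ 7) :+ (con (+ 1) :+ k :* con (+ 2) :+ q :* con (+ 4)) := (con (+ 4) :+ k :+ q :* con (+ 2)) :* con (+ 2)) ≡.refl
        split : (Σ (Fin 4) λ r → ∃[ q ] (a ≡ + toℕ r ℤ.+ q ℤ.* + 4)) → (Σ (Fin 4) λ r → ∃[ q ] (b ≡ + toℕ r ℤ.+ q ℤ.* + 4)) →
          (ModEq 4 a (+ 3) × ModEq 4 b (+ 2)) ⊎ (ModEq 4 a (+ 1) × ModEq 4 b (+ 0))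
        split (zero , q , e) _ = ⊥-elim (even-a (+ 0) q e)
        split (suc (suc zero) , q , e) _ = ⊥-elim (even-a (+ 1) q e)
        split _ (suc zero , q , e) = ⊥-elim (odd-b (+ 1) q (from-no (+ 2 ∣? + 1)) e)
        split _ (suc (suc (suc zero)) , q , e) = ⊥-elim (odd-b (+ 3) q (from-no (+ 2 ∣? + 3)) e)
        split (suc zero , q , e) (zero , j , f) = inj₂ (mod-4 (+ 1) q e , mod-4 (+ 0) j f)
        split (suc (suc (suc zero)) , q , e) (suc (suc zero) , j , f) = inj₁ (mod-4 (+ 3) q e , mod-4 (+ 2) j f)
        split (suc zero , q , e) (suc (suc zero) , j , f) = ⊥-elim (4∤F-1 (2∣7+a q (+ 0) e)
          (divides (+ 1 ℤ.+ j ℤ.+ q) (≡.trans (≡.cong₂ (λ u v → u ℤ.+ + 1 ℤ.+ v) f e)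
            (solve 2 (λ q j → con (+ 2) :+ j :* con (+ 4) :+ con (+ 1) :+ (con (+ 1) :+ q :* con (+ 4)) := (con (+ 1) :+ j :+ q) :* con (+ 4)) ≡.refl q j))))
        split (suc (suc (suc zero)) , q , e) (zero , j , f) = ⊥-elim (4∤F-1 (2∣7+a q (+ 1) e)
          (divides (+ 1 ℤ.+ j ℤ.+ q) (≡.trans (≡.cong₂ (λ u v → u ℤ.+ + 1 ℤ.+ v) f e)
            (solve 2 (λ q j → con (+ 0) :+ j :* con (+ 4) :+ con (+ 1) :+ (con (+ 3) :+ q :* con (+ 4)) := (con (+ 1) :+ j :+ q) :* con (+ 4)) ≡.refl q j))))

      cond3 : Cond3 a b
      cond3 3∣b 3∣a+1 =
          (∣⇒∣ᵤ (≡.subst (+ 3 ∣_) (sum-form a b) (∣m∣n⇒∣m+n b∣ a∣))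
            , λ 9∣ → singular-at prime-3 (+ 1) 3∣F′ (≡.subst (+ 9 ∣_) (≡.sym F-1) (∣ᵤ⇒∣ 9∣)))
        , (∣⇒∣ᵤ (≡.subst (+ 3 ∣_) (difference-form a b) (∣m∣n⇒∣m+n b∣ (∣n⇒∣m*n -[1+ 0 ] a∣)))
            , λ 9∣ → singular-at prime-3 -[1+ 0 ] 3∣F′ (≡.subst (+ 9 ∣_) (≡.sym F-[-1]) (∣ᵤ⇒∣ 9∣)))
        where
        b∣ : + 3 ∣ b
        b∣ = ∣ᵤ⇒∣ 3∣b
        a∣ : + 3 ∣ a ℤ.- -[1+ 0 ]
        a∣ = ∣ᵤ⇒∣ 3∣a+1
        sum-form : ∀ a b → b ℤ.+ (a ℤ.- -[1+ 0 ]) ≡ b ℤ.+ + 1 ℤ.+ a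
        sum-form = solve 2 (λ a b → b :+ (a :- con -[1+ 0 ]) := b :+ con (+ 1) :+ a) ≡.refl
        difference-form : ∀ a b → b ℤ.+ -[1+ 0 ] ℤ.* (a ℤ.- -[1+ 0 ]) ≡ b ℤ.- + 1 ℤ.- a
        difference-form = solve 2 (λ a b → b :+ con -[1+ 0 ] :* (a :- con -[1+ 0 ]) := b :- con (+ 1) :- a) ≡.refl
        -- F′(1) and F′(-1) are both 7 + a, so this serves both roots.
        3∣F′ : + 3 ∣ + 7 ℤ.+ a
        3∣F′ = ≡.subst (+ 3 ∣_) (lemma a) (∣m∣n⇒∣m+n a∣ (divides (+ 2) ≡.refl))
          where
          lemma : ∀ a → a ℤ.- -[1+ 0 ] ℤ.+ + 6 ≡ + 7 ℤ.+ a
          lemma = solve 1 (λ a → a :- con -[1+ 0 ] :+ con (+ 6) := con (+ 7) :+ a) ≡.refl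

      -- Modulo 9, a ≡ 1 modulo 3 leaves the residues 1, 4 and 7; residue 1 together with 9 ∣ b is
      -- the singular configuration.
      cond4 : Cond4 a b
      cond4 3∣b 3∣a-1 = split (+ 9 ∣? b) (residue 9 a)
        where
        impossible : ∀ r q → ¬ + 3 ∣ r ℤ.- + 1 → a ≡ r ℤ.+ q ℤ.* + 9 → ⊥
        impossible r q ¬d e = ¬d (∣-remainder (r ℤ.- + 1) (q ℤ.* + 3) (∣ᵤ⇒∣ 3∣a-1) (≡.trans (≡.cong (ℤ._- + 1) e) (lemma r q)))
          where
          lemma : ∀ r q → r ℤ.+ q ℤ.* + 9 ℤ.- + 1 ≡ r ℤ.- + 1 ℤ.+ q ℤ.* + 3 ℤ.* + 3
          lemma = solve 2 (λ r q → r :+ q :* con (+ 9) :- con (+ 1) := r :- con (+ 1) :+ q :* con (+ 3) :* con (+ 3)) ≡.refl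
        mod-9 : ∀ r q → a ≡ r ℤ.+ q ℤ.* + 9 → ModEq 9 a r
        mod-9 r q e = ∣⇒∣ᵤ (divides q (≡.trans (≡.cong (ℤ._- r) e) (lemma r (q ℤ.* + 9))))
          where
          lemma : ∀ x w → x ℤ.+ w ℤ.- x ≡ w
          lemma = solve 2 (λ x w → x :+ w :- x := w) ≡.refl
        singular : ∀ m n → a ≡ + 1 ℤ.+ m ℤ.* + 9 → b ≡ n ℤ.* + 9 → Singular 3 F
        singular m n a≡ b≡ = ≡.subst₂ (λ a b → Singular 3 (trinomial (ι a) (ι b))) (≡.sym a≡) (≡.sym b≡) (singular-3 m n)
        split : Dec (+ 9 ∣ b) → (Σ (Fin 9) λ r → ∃[ q ] (a ≡ + toℕ r ℤ.+ q ℤ.* + 9)) → ModEq 9 a (+ 4) ⊎ ModEq 9 a (+ 7) ⊎ νEq 3 1 b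
        split (no 9∤b) _ = inj₂ (inj₂ (3∣b , λ d → 9∤b (∣ᵤ⇒∣ d)))
        split (yes (divides n b≡)) (suc zero , q , e) = ⊥-elim (nonsingular prime-3 (singular q n e b≡))
        split _ (suc (suc (suc (suc zero))) , q , e) = inj₁ (mod-9 (+ 4) q e)
        split _ (suc (suc (suc (suc (suc (suc (suc zero)))))) , q , e) = inj₂ (inj₁ (mod-9 (+ 7) q e))
        split _ (zero , q , e) = ⊥-elim (impossible (+ 0) q (from-no (+ 3 ∣? -[1+ 0 ])) e)
        split _ (suc (suc zero) , q , e) = ⊥-elim (impossible (+ 2) q (from-no (+ 3 ∣? + 1)) e)
        split _ (suc (suc (suc zero)) , q , e) = ⊥-elim (impossible (+ 3) q (from-no (+ 3 ∣? + 2)) e)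
        split _ (suc (suc (suc (suc (suc zero)))) , q , e) = ⊥-elim (impossible (+ 5) q (from-no (+ 3 ∣? + 4)) e)
        split _ (suc (suc (suc (suc (suc (suc zero))))) , q , e) = ⊥-elim (impossible (+ 6) q (from-no (+ 3 ∣? + 5)) e)
        split _ (suc (suc (suc (suc (suc (suc (suc (suc zero))))))) , q , e) = ⊥-elim (impossible (+ 8) q (from-no (+ 3 ∣? + 7)) e)

      -- F(-b) = b (1 - a - b⁶), and 7 ∣ F′(-b) because 7 ∣ a. The lower bound on the valuation is
      -- Fermat's theorem.
      cond5 : Cond5 a b
      cond5 7∣a 7∤b =
        ∣⇒∣ᵤ (≡.subst (+ 7 ∣_) (regroup a (b ℤ.^ 6)) (∣n⇒∣m*n -[1+ 0 ] (∣m∣n⇒∣m+n a∣ (fermat-7 b (λ d → 7∤b (∣⇒∣ᵤ d)))))) ,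
        λ 49∣ → singular-at prime-7 (ℤ.- b)
          (∣m∣n⇒∣m+n (∣m⇒∣m*n ((ℤ.- b) ℤ.^ 6) (divides (+ 1) ≡.refl)) a∣)
          (≡.subst (+ 49 ∣_) (F-[-b] a b) (∣n⇒∣m*n b (∣ᵤ⇒∣ 49∣)))
        where
        a∣ : + 7 ∣ a
        a∣ = ∣ᵤ⇒∣ 7∣a
        regroup : ∀ a w → -[1+ 0 ] ℤ.* (a ℤ.+ (w ℤ.- + 1)) ≡ + 1 ℤ.- a ℤ.- w
        regroup = solve 2 (λ a w → con -[1+ 0 ] :* (a :+ (w :- con (+ 1))) := con (+ 1) :- a :- w) ≡.refl
        F-[-b] : ∀ a b → b ℤ.* (+ 1 ℤ.- a ℤ.- b ℤ.^ 6) ≡ F⟨ a , b ⟩ (ℤ.- b)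
        F-[-b] = solve 2 (λ a b → b :* (con (+ 1) :- a :- b :^ 6) := (:- b) :^ 7 :+ a :* (:- b) :+ b) ≡.refl

      -- If p² ∣ Δ, the approximate root c satisfies p ∣ F′(c) and p² ∣ F(c) after cancelling powers
      -- of 6a; p ∤ a, since otherwise p ∣ Δ would give p ∣ b too.
      cond6 : Cond6 a b
      cond6 p pr p≢2 p≢3 p≢7 ¬both p²∣Δ =
        singular-at pr c
          (prime-∣-* _ _ pr (∣-F′ a b c (p∣p² ∣root) (p∣p² p²∣)) (prime∤^ _ 6 pr p∤6a))
          (prime²-∣-* _ _ pr (prime∤^ _ 7 pr p∤6a) (∣m+n∣m⇒∣n
            (≡.subst (+ p ℤ.* + p ∣_) (ℤₚ.+-comm ((+ 6 ℤ.* a) ℤ.^ 7 ℤ.* F⟨ a , b ⟩ c) (b ℤ.* Δ a b)) (∣-F a b c ∣root)) (∣n⇒∣m*n b p²∣)))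
        where
        p²∣ : + p ℤ.* + p ∣ Δ a b
        p²∣ = ≡.subst (_∣ Δ a b) (p²≡ p) (∣ᵤ⇒∣ p²∣Δ)
        p∣p² : ∀ {x} → + p ℤ.* + p ∣ x → + p ∣ x
        p∣p² (divides q e) = divides (q ℤ.* + p) (≡.trans e (≡.sym (ℤₚ.*-assoc q (+ p) (+ p))))
        p∤a : ¬ + p ∣ a
        p∤a d = ¬both (∣⇒∣ᵤ d , ∣⇒∣ᵤ (∣Δ∧∣a⇒∣b a b pr p≢7 (p∣p² p²∣) (inj₂ d)))
        p∤6a : ¬ + p ∣ + 6 ℤ.* a
        p∤6a d = p∤a (prime-∣-* (+ 6) a pr d (p∤6 pr p≢2 p≢3))
        c = proj₁ (root-mod-p² a b pr p∤6a)
        ∣root = proj₂ (root-mod-p² a b pr p∤6a)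

      nonsingular⇒conditions : Cond1 a b × Cond2 a b × Cond3 a b × Cond4 a b × Cond5 a b × Cond6 a b
      nonsingular⇒conditions = cond1 , cond2 , cond3 , cond4 , cond5 , cond6

open Arithmetic using (module Criterion)

-- The ring ℚ[x] of coefficient lists

toℚᵘ-ℤtoℚ : ∀ z → ℚ.toℚᵘ (ℤtoℚ z) ℚᵘ.≃ ℚᵘ.mkℚᵘ z 0
toℚᵘ-ℤtoℚ z = ℚₚ.toℚᵘ-fromℚᵘ (ℚᵘ.mkℚᵘ z 0)

ℤtoℚ-+ : ∀ x y → ℤtoℚ (x ℤ.+ y) ≡ ℤtoℚ x ℚ.+ ℤtoℚ y
ℤtoℚ-+ x y = ℚₚ.toℚᵘ-injective (begin
  ℚ.toℚᵘ (ℤtoℚ (x ℤ.+ y))                    ≈⟨ toℚᵘ-ℤtoℚ (x ℤ.+ y) ⟩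
  ℚᵘ.mkℚᵘ (x ℤ.+ y) 0                        ≈⟨ ℚᵘ.*≡* (solve 2 (λ x y → (x :+ y) :* con (+ 1) := (x :* con (+ 1) :+ y :* con (+ 1)) :* con (+ 1)) ≡.refl x y) ⟩
  ℚᵘ.mkℚᵘ x 0 ℚᵘ.+ ℚᵘ.mkℚᵘ y 0               ≈⟨ ℚᵘₚ.+-cong (toℚᵘ-ℤtoℚ x) (toℚᵘ-ℤtoℚ y) ⟨
  ℚ.toℚᵘ (ℤtoℚ x) ℚᵘ.+ ℚ.toℚᵘ (ℤtoℚ y)       ≈⟨ ℚₚ.toℚᵘ-homo-+ (ℤtoℚ x) (ℤtoℚ y) ⟨
  ℚ.toℚᵘ (ℤtoℚ x ℚ.+ ℤtoℚ y)                 ∎)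
  where
  open ℚᵘₚ.≃-Reasoning
  open +-*-Solver

ℤtoℚ-* : ∀ x y → ℤtoℚ (x ℤ.* y) ≡ ℤtoℚ x ℚ.* ℤtoℚ y
ℤtoℚ-* x y = ℚₚ.toℚᵘ-injective (begin
  ℚ.toℚᵘ (ℤtoℚ (x ℤ.* y))                    ≈⟨ toℚᵘ-ℤtoℚ (x ℤ.* y) ⟩
  ℚᵘ.mkℚᵘ (x ℤ.* y) 0                        ≡⟨⟩
  ℚᵘ.mkℚᵘ x 0 ℚᵘ.* ℚᵘ.mkℚᵘ y 0               ≈⟨ ℚᵘₚ.*-cong (toℚᵘ-ℤtoℚ x) (toℚᵘ-ℤtoℚ y) ⟨
  ℚ.toℚᵘ (ℤtoℚ x) ℚᵘ.* ℚ.toℚᵘ (ℤtoℚ y)       ≈⟨ ℚₚ.toℚᵘ-homo-* (ℤtoℚ x) (ℤtoℚ y) ⟨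
  ℚ.toℚᵘ (ℤtoℚ x ℚ.* ℤtoℚ y)                 ∎)
  where open ℚᵘₚ.≃-Reasoning

ℤtoℚ-neg : ∀ x → ℤtoℚ (ℤ.- x) ≡ ℚ.- ℤtoℚ x
ℤtoℚ-neg x = ℚₚ.toℚᵘ-injective (begin
  ℚ.toℚᵘ (ℤtoℚ (ℤ.- x))      ≈⟨ toℚᵘ-ℤtoℚ (ℤ.- x) ⟩
  ℚᵘ.- ℚᵘ.mkℚᵘ x 0           ≈⟨ ℚᵘₚ.-‿cong (toℚᵘ-ℤtoℚ x) ⟨
  ℚᵘ.- ℚ.toℚᵘ (ℤtoℚ x)       ≈⟨ ℚₚ.toℚᵘ-homo‿- (ℤtoℚ x) ⟨
  ℚ.toℚᵘ (ℚ.- ℤtoℚ x)        ∎)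
  where open ℚᵘₚ.≃-Reasoning

ℤtoℚ≡0 : ∀ z → ℤtoℚ z ≡ 0ℚ → z ≡ + 0
ℤtoℚ≡0 z eq with ℚᵘₚ.≃-trans (ℚᵘₚ.≃-sym (toℚᵘ-ℤtoℚ z)) (ℚᵘₚ.≃-reflexive (≡.cong ℚ.toℚᵘ eq))
... | ℚᵘ.*≡* e = ≡.trans (≡.sym (ℤₚ.*-identityʳ z)) e

↧*≡↥ : ∀ c → ℤtoℚ (↧ c) ℚ.* c ≡ ℤtoℚ (↥ c)
↧*≡↥ c = ℚₚ.toℚᵘ-injective (begin
  ℚ.toℚᵘ (ℤtoℚ (↧ c) ℚ.* c)                  ≈⟨ ℚₚ.toℚᵘ-homo-* (ℤtoℚ (↧ c)) c ⟩
  ℚ.toℚᵘ (ℤtoℚ (↧ c)) ℚᵘ.* ℚ.toℚᵘ c          ≈⟨ ℚᵘₚ.*-congʳ (toℚᵘ-ℤtoℚ (↧ c)) ⟩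
  ℚᵘ.mkℚᵘ (↧ c) 0 ℚᵘ.* ℚ.toℚᵘ c              ≈⟨ lemma c ⟩
  ℚᵘ.mkℚᵘ (↥ c) 0                            ≈⟨ toℚᵘ-ℤtoℚ (↥ c) ⟨
  ℚ.toℚᵘ (ℤtoℚ (↥ c))                        ∎)
  where
  open ℚᵘₚ.≃-Reasoning
  open +-*-Solver
  lemma : ∀ c → ℚᵘ.mkℚᵘ (↧ c) 0 ℚᵘ.* ℚ.toℚᵘ c ℚᵘ.≃ ℚᵘ.mkℚᵘ (↥ c) 0
  lemma (mkℚ n d-1 _) = ℚᵘ.*≡* (≡.trans (ℤₚ.*-identityʳ _) (≡.trans (ℤₚ.*-comm (+ suc d-1) n) (≡.cong (λ w → n ℤ.* + suc w) (≡.sym (ℕₚ.+-identityʳ d-1)))))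

ℚ-algebra : ℤ-Algebra
ℚ-algebra = record
  { ring = ℚₚ.+-*-commutativeRing
  ; unit = record
    { ⟦_⟧ = ℤtoℚ ; +-homo = ℤtoℚ-+ ; *-homo = ℤtoℚ-* ; -‿homo = ℤtoℚ-neg ; 0-homo = ≡.refl ; 1-homo = ≡.refl } }

module Convolution (A : ℤ-Algebra) where
  open Algebraic A

  -- Ring laws are proved for coefficient sequences, where trailing zeros cannot interfere, and
  -- carried to lists by `coeff-*`.
  conv : (ℕ → Carrier) → (ℕ → Carrier) → ℕ → Carrier
  conv f g zero    = f 0 * g 0
  conv f g (suc k) = f 0 * g (suc k) + conv (λ i → f (suc i)) g k

  conv-cong : ∀ {f f′ g g′} → (∀ i → f i ≈ f′ i) → (∀ i → g i ≈ g′ i) → ∀ k → conv f g k ≈ conv f′ g′ k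
  conv-cong p q zero    = *-cong (p 0) (q 0)
  conv-cong p q (suc k) = +-cong (*-cong (p 0) (q (suc k))) (conv-cong (λ i → p (suc i)) q k)

  conv-0 : ∀ g k → conv (λ _ → 0#) g k ≈ 0#
  conv-0 g zero    = zeroˡ _
  conv-0 g (suc k) = trans (+-cong (zeroˡ _) (conv-0 g k)) (+-identityˡ 0#)

  -- Unfolds the sum from the other end; commutativity compares the two unfoldings.
  conv-last : ∀ f g k → conv f g (suc k) ≈ conv f (λ i → g (suc i)) k + f (suc k) * g 0
  conv-last f g zero    = refl
  conv-last f g (suc k) = trans (+-congˡ (conv-last (λ i → f (suc i)) g k)) (sym (+-assoc _ _ _))

  conv-comm : ∀ f g k → conv f g k ≈ conv g f k
  conv-comm f g zero    = *-comm _ _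
  conv-comm f g (suc k) = begin
    f 0 * g (suc k) + conv (λ i → f (suc i)) g k    ≈⟨ +-cong (*-comm _ _) (conv-comm (λ i → f (suc i)) g k) ⟩
    g (suc k) * f 0 + conv g (λ i → f (suc i)) k    ≈⟨ +-comm _ _ ⟩
    conv g (λ i → f (suc i)) k + g (suc k) * f 0    ≈⟨ conv-last g f k ⟨
    conv g f (suc k)                                ∎

  conv-+ˡ : ∀ f g h k → conv (λ i → f i + g i) h k ≈ conv f h k + conv g h k
  conv-+ˡ f g h zero    = distribʳ _ _ _
  conv-+ˡ f g h (suc k) = trans (+-congˡ (conv-+ˡ (λ i → f (suc i)) (λ i → g (suc i)) h k))
    (solve 5 (λ a b c d e → (a :+ b) :* c :+ (d :+ e) := (a :* c :+ d) :+ (b :* c :+ e)) refl _ _ _ _ _)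

  conv-scaleˡ : ∀ a f g k → conv (λ i → a * f i) g k ≈ a * conv f g k
  conv-scaleˡ a f g zero    = *-assoc _ _ _
  conv-scaleˡ a f g (suc k) = trans (+-congˡ (conv-scaleˡ a (λ i → f (suc i)) g k))
    (solve 4 (λ a b c d → (a :* b) :* c :+ a :* d := a :* (b :* c :+ d)) refl _ _ _ _)

  conv-assoc : ∀ f g h k → conv (conv f g) h k ≈ conv f (conv g h) k
  conv-assoc f g h zero    = *-assoc _ _ _
  conv-assoc f g h (suc k) = begin
    (f 0 * g 0) * h (suc k) + conv (λ i → f 0 * g (suc i) + conv f′ g i) h k
      ≈⟨ +-congˡ (conv-+ˡ (λ i → f 0 * g (suc i)) (conv f′ g) h k) ⟩
    (f 0 * g 0) * h (suc k) + (conv (λ i → f 0 * g (suc i)) h k + conv (conv f′ g) h k)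
      ≈⟨ +-congˡ (+-cong (conv-scaleˡ (f 0) (λ i → g (suc i)) h k) (conv-assoc f′ g h k)) ⟩
    (f 0 * g 0) * h (suc k) + (f 0 * conv (λ i → g (suc i)) h k + conv f′ (conv g h) k)
      ≈⟨ solve 5 (λ a b c d e → (a :* b) :* c :+ (a :* d :+ e) := a :* (b :* c :+ d) :+ e) refl (f 0) (g 0) (h (suc k)) _ _ ⟩
    f 0 * (g 0 * h (suc k) + conv (λ i → g (suc i)) h k) + conv f′ (conv g h) k ∎
    where f′ = λ i → f (suc i)

open Convolution ℚ-algebra

coeff-+ : ∀ p q k → coeff (p +P q) k ≡ coeff p k ℚ.+ coeff q k
coeff-+ []       q        k       = ≡.sym (ℚₚ.+-identityˡ _)
coeff-+ (c ∷ cs) []       k       = ≡.sym (ℚₚ.+-identityʳ _)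
coeff-+ (c ∷ cs) (d ∷ ds) zero    = ≡.refl
coeff-+ (c ∷ cs) (d ∷ ds) (suc k) = coeff-+ cs ds k

coeff-scale : ∀ a p k → coeff (scaleP a p) k ≡ a ℚ.* coeff p k
coeff-scale a []       k       = ≡.sym (ℚₚ.*-zeroʳ a)
coeff-scale a (c ∷ cs) zero    = ≡.refl
coeff-scale a (c ∷ cs) (suc k) = coeff-scale a cs k

coeff-neg : ∀ p k → coeff (negP p) k ≡ ℚ.- coeff p k
coeff-neg []       k       = ≡.refl
coeff-neg (c ∷ cs) zero    = ≡.refl
coeff-neg (c ∷ cs) (suc k) = coeff-neg cs k

coeff-* : ∀ p q k → coeff (p *P q) k ≡ conv (coeff p) (coeff q) k
coeff-* []       q k       = ≡.sym (conv-0 (coeff q) k)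
coeff-* (c ∷ cs) q zero    = ≡.trans (coeff-+ (scaleP c q) (0ℚ ∷ (cs *P q)) 0)
  (≡.trans (ℚₚ.+-identityʳ _) (coeff-scale c q 0))
coeff-* (c ∷ cs) q (suc k) = ≡.trans (coeff-+ (scaleP c q) (0ℚ ∷ (cs *P q)) (suc k))
  (≡.cong₂ ℚ._+_ (coeff-scale c q (suc k)) (coeff-* cs q k))

-- A record, so that both polynomials can be inferred from an equation between them.
infix 4 _≋_
record _≋_ (p q : Poly) : Set where
  constructor pointwise
  field at : p ≈P q
open _≋_ public

ℚ[x] : CommutativeRing 0ℓ 0ℓ
ℚ[x] = record
  { Carrier = Poly ; _≈_ = _≋_ ; _+_ = _+P_ ; _*_ = _*P_ ; -_ = negP ; 0# = [] ; 1# = 1ℚ ∷ []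
  ; isCommutativeRing = record
    { isRing = record
      { +-isAbelianGroup = record
        { isGroup = record
          { isMonoid = record
            { isSemigroup = record
              { isMagma = record
                { isEquivalence = record
                  { refl  = pointwise λ k → ≡.refl
                  ; sym   = λ e → pointwise λ k → ≡.sym (at e k)
                  ; trans = λ e f → pointwise λ k → ≡.trans (at e k) (at f k) }
                ; ∙-cong = λ {p} {p′} {q} {q′} e f → pointwise λ k →
                    ≡.trans (coeff-+ p q k) (≡.trans (≡.cong₂ ℚ._+_ (at e k) (at f k)) (≡.sym (coeff-+ p′ q′ k))) }
              ; assoc = λ p q r → pointwise λ k →
                  ≡.trans (≡.trans (coeff-+ (p +P q) r k) (≡.cong (ℚ._+ coeff r k) (coeff-+ p q k)))
                  (≡.trans (ℚₚ.+-assoc (coeff p k) (coeff q k) (coeff r k))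
                  (≡.sym (≡.trans (coeff-+ p (q +P r) k) (≡.cong (coeff p k ℚ.+_) (coeff-+ q r k))))) }
            ; identity = (λ p → pointwise λ k → ≡.refl)
                       , (λ p → pointwise λ k → ≡.trans (coeff-+ p [] k) (ℚₚ.+-identityʳ _)) }
          ; inverse = (λ p → pointwise λ k → ≡.trans (coeff-+ (negP p) p k) (≡.trans (≡.cong (ℚ._+ coeff p k) (coeff-neg p k)) (ℚₚ.+-inverseˡ (coeff p k))))
                    , (λ p → pointwise λ k → ≡.trans (coeff-+ p (negP p) k) (≡.trans (≡.cong (coeff p k ℚ.+_) (coeff-neg p k)) (ℚₚ.+-inverseʳ (coeff p k))))
          ; ⁻¹-cong = λ {p} {q} e → pointwise λ k → ≡.trans (coeff-neg p k) (≡.trans (≡.cong ℚ.-_ (at e k)) (≡.sym (coeff-neg q k))) }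
        ; comm = λ p q → pointwise λ k → ≡.trans (coeff-+ p q k) (≡.trans (ℚₚ.+-comm (coeff p k) (coeff q k)) (≡.sym (coeff-+ q p k))) }
      ; *-cong = λ {p} {p′} {q} {q′} e f → pointwise λ k →
          ≡.trans (coeff-* p q k) (≡.trans (conv-cong (at e) (at f) k) (≡.sym (coeff-* p′ q′ k)))
      ; *-assoc = λ p q r → pointwise λ k →
          ≡.trans (≡.trans (coeff-* (p *P q) r k) (conv-cong (coeff-* p q) (λ _ → ≡.refl) k))
          (≡.trans (conv-assoc (coeff p) (coeff q) (coeff r) k)
          (≡.sym (≡.trans (coeff-* p (q *P r) k) (conv-cong (λ _ → ≡.refl) (coeff-* q r) k))))
      ; *-identity = (λ p → pointwise (*P-identityˡ p))
                   , (λ p → pointwise λ k → ≡.trans (*P-comm p (1ℚ ∷ []) k) (*P-identityˡ p k))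
      ; distrib = (λ p q r → pointwise λ k → ≡.trans (*P-comm p (q +P r) k) (≡.trans (*P-distribʳ p q r k)
                    (≡.trans (coeff-+ (q *P p) (r *P p) k) (≡.trans (≡.cong₂ ℚ._+_ (*P-comm q p k) (*P-comm r p k)) (≡.sym (coeff-+ (p *P q) (p *P r) k))))))
                , (λ p q r → pointwise (*P-distribʳ p q r)) }
    ; *-comm = λ p q → pointwise (*P-comm p q) } }
  where
  *P-comm : ∀ p q → (p *P q) ≈P (q *P p)
  *P-comm p q k = ≡.trans (coeff-* p q k) (≡.trans (conv-comm (coeff p) (coeff q) k) (≡.sym (coeff-* q p k)))
  *P-identityˡ : ∀ p → ((1ℚ ∷ []) *P p) ≈P p
  *P-identityˡ p zero    = ≡.trans (coeff-* (1ℚ ∷ []) p 0) (ℚₚ.*-identityˡ _)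
  *P-identityˡ p (suc k) = ≡.trans (coeff-* (1ℚ ∷ []) p (suc k))
    (≡.trans (≡.cong₂ ℚ._+_ (ℚₚ.*-identityˡ (coeff p (suc k))) (conv-0 (coeff p) k)) (ℚₚ.+-identityʳ (coeff p (suc k))))
  *P-distribʳ : ∀ p q r → ((q +P r) *P p) ≈P ((q *P p) +P (r *P p))
  *P-distribʳ p q r k = ≡.trans (coeff-* (q +P r) p k)
    (≡.trans (conv-cong (coeff-+ q r) (λ _ → ≡.refl) k)
    (≡.trans (conv-+ˡ (coeff q) (coeff r) (coeff p) k)
    (≡.sym (≡.trans (coeff-+ (q *P p) (r *P p) k) (≡.cong₂ ℚ._+_ (coeff-* q p k) (coeff-* r p k))))))

∷-cong : ∀ {c d p q} → c ≡ d → p ≋ q → c ∷ p ≋ d ∷ q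
∷-cong c≡d p≋q = pointwise λ { zero → c≡d ; (suc k) → at p≋q k }

0∷[]≋[] : 0ℚ ∷ [] ≋ []
0∷[]≋[] = pointwise λ { zero → ≡.refl ; (suc k) → ≡.refl }

ℚ[x]-algebra : ℤ-Algebra
ℚ[x]-algebra = record
  { ring = ℚ[x]
  ; unit = record
    { ⟦_⟧    = λ c → ℤtoℚ c ∷ []
    ; +-homo = λ m n → ∷-cong (ℤtoℚ-+ m n) refl
    ; *-homo = λ m n → ∷-cong (≡.trans (ℤtoℚ-* m n) (≡.sym (ℚₚ.+-identityʳ _))) refl
    ; -‿homo = λ m → ∷-cong (ℤtoℚ-neg m) refl
    ; 0-homo = 0∷[]≋[]
    ; 1-homo = refl } }
  where open CommutativeRing ℚ[x] using (refl)

-- The product rule (c + X f)′ = f + X f′, which needs no index.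
deriv : Poly → Poly
deriv []       = []
deriv (c ∷ cs) = cs +P (0ℚ ∷ deriv cs)

-- Through coefficients `deriv` is seen to respect `_≋_`; recursion on lists would have to deal with
-- unequal lengths.
coeff-deriv : ∀ p k → coeff (deriv p) k ≡ ℤtoℚ (+ suc k) ℚ.* coeff p (suc k)
coeff-deriv []       k       = ≡.sym (ℚₚ.*-zeroʳ (ℤtoℚ (+ suc k)))
coeff-deriv (c ∷ cs) zero    = ≡.trans (coeff-+ cs (0ℚ ∷ deriv cs) 0)
  (≡.trans (ℚₚ.+-identityʳ (coeff cs 0)) (≡.sym (ℚₚ.*-identityˡ (coeff cs 0))))
coeff-deriv (c ∷ cs) (suc k) = begin
  coeff (cs +P (0ℚ ∷ deriv cs)) (suc k)                          ≡⟨ coeff-+ cs (0ℚ ∷ deriv cs) (suc k) ⟩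
  coeff cs (suc k) ℚ.+ coeff (deriv cs) k                        ≡⟨ ≡.cong (coeff cs (suc k) ℚ.+_) (coeff-deriv cs k) ⟩
  coeff cs (suc k) ℚ.+ ℤtoℚ (+ suc k) ℚ.* coeff cs (suc k)       ≡⟨ ≡.cong (ℚ._+ ℤtoℚ (+ suc k) ℚ.* coeff cs (suc k)) (ℚₚ.*-identityˡ (coeff cs (suc k))) ⟨
  1ℚ ℚ.* coeff cs (suc k) ℚ.+ ℤtoℚ (+ suc k) ℚ.* coeff cs (suc k) ≡⟨ ℚₚ.*-distribʳ-+ (coeff cs (suc k)) 1ℚ (ℤtoℚ (+ suc k)) ⟨
  (1ℚ ℚ.+ ℤtoℚ (+ suc k)) ℚ.* coeff cs (suc k)                   ≡⟨ ≡.cong (ℚ._* coeff cs (suc k)) (ℤtoℚ-+ (+ 1) (+ suc k)) ⟨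
  ℤtoℚ (+ suc (suc k)) ℚ.* coeff cs (suc k)                      ∎
  where open ≡.≡-Reasoning

deriv-cong : ∀ {p q} → p ≋ q → deriv p ≋ deriv q
deriv-cong {p} {q} e = pointwise λ k →
  ≡.trans (coeff-deriv p k) (≡.trans (≡.cong (ℤtoℚ (+ suc k) ℚ.*_) (at e (suc k))) (≡.sym (coeff-deriv q k)))

deriv-+ : ∀ p q → deriv (p +P q) ≋ deriv p +P deriv q
deriv-+ p q = pointwise λ k → let n = ℤtoℚ (+ suc k) in begin
  coeff (deriv (p +P q)) k                               ≡⟨ coeff-deriv (p +P q) k ⟩
  n ℚ.* coeff (p +P q) (suc k)                           ≡⟨ ≡.cong (n ℚ.*_) (coeff-+ p q (suc k)) ⟩
  n ℚ.* (coeff p (suc k) ℚ.+ coeff q (suc k))            ≡⟨ ℚₚ.*-distribˡ-+ n (coeff p (suc k)) (coeff q (suc k)) ⟩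
  n ℚ.* coeff p (suc k) ℚ.+ n ℚ.* coeff q (suc k)        ≡⟨ ≡.cong₂ ℚ._+_ (coeff-deriv p k) (coeff-deriv q k) ⟨
  coeff (deriv p) k ℚ.+ coeff (deriv q) k                ≡⟨ coeff-+ (deriv p) (deriv q) k ⟨
  coeff (deriv p +P deriv q) k                           ∎
  where open ≡.≡-Reasoning

deriv-scale : ∀ c p → deriv (scaleP c p) ≋ scaleP c (deriv p)
deriv-scale c p = pointwise λ k → let n = ℤtoℚ (+ suc k) in begin
  coeff (deriv (scaleP c p)) k       ≡⟨ coeff-deriv (scaleP c p) k ⟩
  n ℚ.* coeff (scaleP c p) (suc k)   ≡⟨ ≡.cong (n ℚ.*_) (coeff-scale c p (suc k)) ⟩
  n ℚ.* (c ℚ.* coeff p (suc k))      ≡⟨ solve 3 (λ n c x → n :* (c :* x) := c :* (n :* x)) ≡.refl n c (coeff p (suc k)) ⟩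
  c ℚ.* (n ℚ.* coeff p (suc k))      ≡⟨ ≡.cong (c ℚ.*_) (coeff-deriv p k) ⟨
  c ℚ.* coeff (deriv p) k            ≡⟨ coeff-scale c (deriv p) k ⟨
  coeff (scaleP c (deriv p)) k       ∎
  where
  open ≡.≡-Reasoning
  open Algebraic ℚ-algebra using (solve; _:*_; _:=_)

x : Poly
x = 0ℚ ∷ 1ℚ ∷ []

module _ where
  open Algebraic ℚ[x]-algebra

  x*≋ : ∀ p → x * p ≋ 0ℚ ∷ p
  x*≋ p = pointwise λ
    { zero    → ≡.trans (coeff-* x p 0) (ℚₚ.*-zeroˡ (coeff p 0))
    ; (suc k) → ≡.trans (coeff-* x p (suc k)) (≡.trans
        (≡.cong₂ ℚ._+_ (ℚₚ.*-zeroˡ (coeff p (suc k))) (≡.trans (≡.sym (coeff-* (1ℚ ∷ []) p k)) (at (*-identityˡ p) k)))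
        (ℚₚ.+-identityˡ _)) }

  ∷≋ : ∀ c p → c ∷ p ≋ (c ∷ []) + x * p
  ∷≋ c p = sym (trans (+-congˡ {c ∷ []} (x*≋ p)) (∷-cong (ℚₚ.+-identityʳ c) refl))

  scale≋ : ∀ c p → scaleP c p ≋ (c ∷ []) * p
  scale≋ c p = sym (trans (+-congˡ 0∷[]≋[]) (+-identityʳ _))

  deriv-* : ∀ p q → deriv (p * q) ≋ deriv p * q + p * deriv q
  deriv-* []       q = refl
  deriv-* (c ∷ cs) q = begin
    deriv (scaleP c q + (0ℚ ∷ cs * q))
      ≈⟨ deriv-+ (scaleP c q) (0ℚ ∷ cs * q) ⟩
    deriv (scaleP c q) + (cs * q + (0ℚ ∷ deriv (cs * q)))
      ≈⟨ +-cong (trans (deriv-scale c q) (scale≋ c (deriv q)))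
           (+-congˡ {cs * q} (trans (sym (x*≋ (deriv (cs * q)))) (*-congˡ {x} (deriv-* cs q)))) ⟩
    (c ∷ []) * deriv q + (cs * q + x * (deriv cs * q + cs * deriv q))
      ≈⟨ rearrange (c ∷ []) (deriv q) cs q x (deriv cs) ⟩
    (cs + x * deriv cs) * q + ((c ∷ []) + x * cs) * deriv q
      ≈⟨ +-cong (*-congʳ {q} (+-congˡ {cs} (x*≋ (deriv cs)))) (*-congʳ {deriv q} (sym (∷≋ c cs))) ⟩
    deriv (c ∷ cs) * q + (c ∷ cs) * deriv q ∎
    where
    rearrange : ∀ c q′ cs q x cs′ → c * q′ + (cs * q + x * (cs′ * q + cs * q′)) ≈ (cs + x * cs′) * q + (c + x * cs) * q′
    rearrange = solve 6 (λ c q′ cs q x cs′ → c :* q′ :+ (cs :* q :+ x :* (cs′ :* q :+ cs :* q′)) := (cs :+ x :* cs′) :* q :+ (c :+ x :* cs) :* q′) refl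

  x-free : ∀ c f → ι c + x * f ≋ 0# → c ≡ + 0 × f ≋ 0#
  x-free c f e = ℤtoℚ≡0 c (at e′ 0) , pointwise (λ k → at e′ (suc k))
    where
    e′ : ℤtoℚ c ∷ f ≋ 0#
    e′ = trans (∷≋ (ℤtoℚ c) f) e

  toℚ[x]≋eval : ∀ q → toℚ[x] q ≋ eval q x
  toℚ[x]≋eval []       = refl
  toℚ[x]≋eval (c ∷ cs) = trans (∷≋ (ℤtoℚ c) (toℚ[x] cs)) (+-congˡ {ι c} (*-congˡ {x} (toℚ[x]≋eval cs)))

  composeP≋eval : ∀ q p → composeP (toℚ[x] q) p ≋ eval q p
  composeP≋eval []       p = refl
  composeP≋eval (c ∷ cs) p = +-congˡ {ι c} (*-congˡ {p} (composeP≋eval cs p))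

  unit-fraction : ∀ n → ∃[ v ] (ι (+ suc n) * v ≋ 1#)
  unit-fraction n = (1/n ∷ []) , (begin
    ι (+ suc n) * (1/n ∷ [])             ≈⟨ scale≋ (ℤtoℚ (+ suc n)) (1/n ∷ []) ⟨
    (ℤtoℚ (+ suc n) ℚ.* 1/n) ∷ []        ≈⟨ ∷-cong (lemma n) refl ⟩
    1# ∎)
    where
    1/n = + 1 ℚ./ suc n
    lemma : ∀ n → ℤtoℚ (+ suc n) ℚ.* (+ 1 ℚ./ suc n) ≡ 1ℚ
    lemma n = ℚₚ.toℚᵘ-injective (ℚᵘₚ.≃-trans (ℚₚ.toℚᵘ-homo-* (ℤtoℚ (+ suc n)) (+ 1 ℚ./ suc n))
      (ℚᵘₚ.≃-trans (ℚᵘₚ.*-cong (toℚᵘ-ℤtoℚ (+ suc n)) (ℚₚ.toℚᵘ-fromℚᵘ (ℚᵘ.mkℚᵘ (+ 1) n)))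
      (ℚᵘ.*≡* (≡.trans (ℤₚ.*-identityʳ _) (≡.trans (ℤₚ.*-identityʳ _) (≡.cong (λ w → + suc w) (≡.sym (≡.trans (ℕₚ.+-identityʳ _) (ℕₚ.+-identityʳ n)))))))))

  denominator : ∀ f → ∃[ n ] ∃[ k ] Pol x k (+ 0) (ι (+ suc n) * f)
  denominator [] = 0 , 0 , const (trans (zeroʳ (ι (+ 1))) (sym ι-0))
  denominator (c ∷ cs) with denominator cs
  -- Denominators are stored as predecessors; the new one is the product of that of `cs` and that of
  -- c.
  ... | n , k , pol = ℕ.pred (suc n ℕ.* suc d) , suc k
      , step (+ suc n ℤ.* ↥ c) (pol-lead (ℤₚ.*-zeroʳ (+ suc d)) (pol-scale (+ suc d) pol)) (begin
        ι (+ (suc n ℕ.* suc d)) * (c ∷ cs)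
          ≈⟨ *-cong (trans (ι-cong (ℤₚ.pos-* (suc n) (suc d))) (ι-* (+ suc n) (+ suc d))) (∷≋ c cs) ⟩
        (ι (+ suc n) * ι (+ suc d)) * ((c ∷ []) + x * cs)
          ≈⟨ rearrange (ι (+ suc n)) (ι (+ suc d)) (c ∷ []) x cs ⟩
        ι (+ suc n) * (ι (+ suc d) * (c ∷ [])) + x * (ι (+ suc d) * (ι (+ suc n) * cs))
          ≈⟨ +-congʳ {x * (ι (+ suc d) * (ι (+ suc n) * cs))} (trans (*-congˡ {ι (+ suc n)} (trans (sym (scale≋ (ℤtoℚ (+ suc d)) (c ∷ []))) (∷-cong (↧*≡↥ c) refl))) (sym (ι-* (+ suc n) (↥ c)))) ⟩
        ι (+ suc n ℤ.* ↥ c) + x * (ι (+ suc d) * (ι (+ suc n) * cs)) ∎)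
    where
    d = ℚ.denominator-1 c
    rearrange : ∀ n d c x cs → (n * d) * (c + x * cs) ≈ n * (d * c) + x * (d * (n * cs))
    rearrange = solve 5 (λ n d c x cs → (n :* d) :* (c :+ x :* cs) := n :* (d :* c) :+ x :* (d :* (n :* cs))) refl

ℚ[x]-polynomials : RationalPolynomialRing
ℚ[x]-polynomials = record
  { algebra     = ℚ[x]-algebra
  ; X           = x
  ; X-free      = x-free
  ; D           = deriv
  ; D-cong      = deriv-cong
  ; D-+         = deriv-+
  ; D-*         = deriv-*
  ; D-ι         = λ c → 0∷[]≋[]
  ; D-X         = pointwise λ { zero → ≡.refl ; (suc zero) → ≡.refl ; (suc (suc k)) → ≡.refl }
  ; fraction    = unit-fraction
  ; denominator = denominator }

-- From coefficient lists to the abstract criteria, and the theorem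

open Algebraic ℚ[x]-algebra
open IntegralPolynomials ℚ[x]-polynomials
open Trinomials ℤ[X] using (horner; trinomial; trinomial-horner; trinomial-monic; Singular)

eval-integral : ∀ q → IsIntegral (eval q x)
eval-integral []       = 0 , const (sym ι-0)
eval-integral (c ∷ cs) = let k , p = eval-integral cs in suc k , step c p refl

-- The list counterpart of `horner`, shaped so that `trinomial7 a b` is an instance by computation.
monicList : List ℤ → Poly
monicList []       = 1ℚ ∷ []
monicList (c ∷ cs) = ℤtoℚ c ∷ monicList cs

monicList≋horner : ∀ cs → monicList cs ≋ proj₁ (horner cs)
monicList≋horner []       = refl
monicList≋horner (c ∷ cs) = trans (∷≋ (ℤtoℚ c) (monicList cs)) (+-congˡ {ι c} (*-congˡ {x} (monicList≋horner cs)))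

module RingOfIntegers (a b : ℤ) where

  F̂ : Z.Carrier
  F̂ = trinomial (Z.ι a) (Z.ι b)

  open Integrality F̂ (trinomial-monic a b)

  F≋ : trinomial7 a b ≋ F
  F≋ = trans (monicList≋horner (b ∷ a ∷ + 0 ∷ + 0 ∷ + 0 ∷ + 0 ∷ + 0 ∷ [])) (sym (trinomial-horner a b))

  -- K has the operations of ℚ[x] and only a coarser equality, so the two evaluations agree on the
  -- nose.
  eval≡ : ∀ cs θ → K.eval cs θ ≡ eval cs θ
  eval≡ []       θ = ≡.refl
  eval≡ (c ∷ cs) θ = ≡.cong (λ w → ι c + θ * w) (eval≡ cs θ)

  algInt⇒integral : ∀ θ → IsAlgInt (trinomial7 a b) θ → IntegralElement θ
  algInt⇒integral θ (_ , (cs , ≡.refl) , k , e) = cs , k , trans (reflexive (eval≡ (cs ++ + 1 ∷ []) θ))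
    (trans (sym (composeP≋eval (cs ++ + 1 ∷ []) θ)) (trans (pointwise e) (*-congʳ {k} F≋)))

  integral⇒algInt : ∀ θ → IntegralElement θ → IsAlgInt (trinomial7 a b) θ
  integral⇒algInt θ (cs , k , e) = cs ++ + 1 ∷ [] , (cs , ≡.refl) , k , at (trans (composeP≋eval (cs ++ + 1 ∷ []) θ)
    (trans (reflexive (≡.sym (eval≡ (cs ++ + 1 ∷ []) θ))) (trans e (*-congʳ {k} (sym F≋)))))

  inZα⇒ : ∀ θ → InZα (trinomial7 a b) θ → ∃[ s ] (θ ≡F proj₁ {B = IsIntegral} s)
  inZα⇒ θ (q , k , e) = (eval q x , eval-integral q) , k , (begin
    θ                                        ≈⟨ split θ (toℚ[x] q) ⟩
    toℚ[x] q + (θ - toℚ[x] q)                ≈⟨ +-cong (toℚ[x]≋eval q) (trans (pointwise e) (*-congʳ {k} F≋)) ⟩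
    eval q x + F * k                         ∎)
    where
    split : ∀ f g → f ≋ g + (f - g)
    split = solve 2 (λ f g → f := g :+ (f :- g)) refl

  ⇒inZα : ∀ θ → ∃[ s ] (θ ≡F proj₁ {B = IsIntegral} s) → InZα (trinomial7 a b) θ
  ⇒inZα θ ((s , _ , pol) , k , e) = let q , s≋ = pol₀⇒eval pol in q , k , at (begin
    θ - toℚ[x] q                 ≈⟨ +-cong (trans e (+-congʳ {F * k} s≋)) (-‿cong (toℚ[x]≋eval q)) ⟩
    (eval q x + F * k) - eval q x  ≈⟨ cancel (eval q x) (F * k) ⟩
    F * k                        ≈⟨ *-congʳ {k} (sym F≋) ⟩
    trinomial7 a b * k           ∎)
    where
    cancel : ∀ f g → (f + g) - f ≋ g
    cancel = solve 2 (λ f g → (f :+ g) :- f := g) refl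

  inZα⇒algInt : ∀ θ → InZα (trinomial7 a b) θ → IsAlgInt (trinomial7 a b) θ
  inZα⇒algInt θ θ∈ = let s , θ≡s = inZα⇒ θ θ∈ in integral⇒algInt θ (congruent-integral s θ≡s)

  nonsingular : (∀ θ → IsAlgInt (trinomial7 a b) θ → InZα (trinomial7 a b) θ) → ∀ {p} → Prime p → ¬ Singular p F̂
  nonsingular closed pr singular = not-integrally-closed {g = g} {h} {s} {t} pr monic-g monic-h bound expansion
    (λ θ θ∈ → inZα⇒ θ (closed θ (integral⇒algInt θ θ∈)))
    where open Singular singular

theorem2p1 : (a b : ℤ) → Irreducible (trinomial7 a b) →
    (∀ (p : ℕ) → Prime p → νLe p 5 a ⊎ νLe p 6 b) →
    (ZαIsRingOfIntegers (trinomial7 a b) ⇔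
    (Cond1 a b × Cond2 a b × Cond3 a b × Cond4 a b × Cond5 a b × Cond6 a b))
theorem2p1 a b _ _ = mk⇔
  (λ (closed , _) → nonsingular⇒conditions (nonsingular closed))
  (λ (c₁ , c₂ , c₃ , c₄ , c₅ , c₆) →
      (λ θ θ∈ → ⇒inZα θ (integrally-closed (conditions⇒data c₁ c₂ c₃ c₄ c₅ c₆) θ (algInt⇒integral θ θ∈)))
    , inZα⇒algInt)
  where
  open RingOfIntegers a b
  open Integrality F̂ (trinomial-monic a b) using (integrally-closed)
  open Criterion ℤ[X] a b using (nonsingular⇒conditions; conditions⇒data)
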